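{- If a model $M\models\mathrm{PA}^+$ satisfies the arithmetic maximality principle and $N\models\mathrm{PA}^+$ is elementarily equivalent to $M$, then $N$ also satisfies the arithmetic maximality principle.
   Context: Fix a consistent computably enumerable theory $\mathrm{PA}^+$ extending $\mathrm{PA}$. For $M\models\mathrm{PA}^+$, $M\models\Diamond^{\mathrm{end}}\varphi$ iff $\varphi$ holds in some end-extension of $M$ that is a model of $\mathrm{PA}^+$, and $\Box^{\mathrm{end}}\varphi$ iff $\varphi$ holds in all such end-extensions. $M$ satisfies the arithmetic maximality principle if $M\models\Diamond^{\mathrm{end}}\Box^{\mathrm{end}}\sigma\to\sigma$ for every sentence $\sigma$ in the language of arithmetic. -}

module Defs where

open import Level using (Level; _⊔_) renaming (suc to lsuc; zero to lzero)
open import Data.Nat using (ℕ; zero; suc; _+_; _*_; _<_)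
open import Data.Fin using (Fin; toℕ) renaming (zero to fz; suc to fs)
open import Data.Vec using (Vec; []; _∷_; lookup)
open import Data.Product using (Σ; _×_; _,_)
open import Data.Empty using (⊥)
open import Relation.Binary.PropositionalEquality using (_≡_)

data Term (n : ℕ) : Set where
  var  : Fin n → Term n
  `0   : Term n
  `S   : Term n → Term n
  _`+_ : Term n → Term n → Term n
  _`*_ : Term n → Term n → Term n

data Formula : ℕ → Set where
  `⊥   : ∀ {n} → Formula n
  _`≐_ : ∀ {n} → Term n → Term n → Formula n
  _`⇒_ : ∀ {n} → Formula n → Formula n → Formula n
  `∀   : ∀ {n} → Formula (suc n) → Formula n

infixr 5 _`⇒_

Sentence : Set
Sentence = Formula 0

`¬ : ∀ {n} → Formula n → Formula n
`¬ φ = φ `⇒ `⊥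

∀* : ∀ {n} → Formula n → Sentence
∀* {zero}  φ = φ
∀* {suc n} φ = ∀* (`∀ φ)

extR : ∀ {n m} → (Fin n → Fin m) → Fin (suc n) → Fin (suc m)
extR ρ fz     = fz
extR ρ (fs i) = fs (ρ i)

renT : ∀ {n m} → (Fin n → Fin m) → Term n → Term m
renT ρ (var i)  = var (ρ i)
renT ρ `0       = `0
renT ρ (`S t)   = `S (renT ρ t)
renT ρ (t `+ s) = renT ρ t `+ renT ρ s
renT ρ (t `* s) = renT ρ t `* renT ρ s

extS : ∀ {n m} → (Fin n → Term m) → Fin (suc n) → Term (suc m)
extS σ fz     = var fz
extS σ (fs i) = renT fs (σ i)

subT : ∀ {n m} → (Fin n → Term m) → Term n → Term m
subT σ (var i)  = σ i
subT σ `0       = `0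
subT σ (`S t)   = `S (subT σ t)
subT σ (t `+ s) = subT σ t `+ subT σ s
subT σ (t `* s) = subT σ t `* subT σ s

subF : ∀ {n m} → (Fin n → Term m) → Formula n → Formula m
subF σ `⊥       = `⊥
subF σ (t `≐ s) = subT σ t `≐ subT σ s
subF σ (φ `⇒ ψ) = subF σ φ `⇒ subF σ ψ
subF σ (`∀ φ)   = `∀ (subF (extS σ) φ)

atZero : ∀ {n} → Fin (suc n) → Term n
atZero fz     = `0
atZero (fs i) = var i

atSucc : ∀ {n} → Fin (suc n) → Term (suc n)
atSucc fz     = `S (var fz)
atSucc (fs i) = var (fs i)

x₀ x₁ : ∀ {n} → Term (suc (suc n))
x₀ = var fz
x₁ = var (fs fz)

data PA : Sentence → Set where
  ax-S≢0  : PA (`∀ (`¬ (`S (var fz) `≐ `0)))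
  ax-Sinj : PA (`∀ (`∀ ((`S x₁ `≐ `S x₀) `⇒ (x₁ `≐ x₀))))
  ax-+0   : PA (`∀ ((var fz `+ `0) `≐ var fz))
  ax-+S   : PA (`∀ (`∀ ((x₁ `+ `S x₀) `≐ `S (x₁ `+ x₀))))
  ax-*0   : PA (`∀ ((var fz `* `0) `≐ `0))
  ax-*S   : PA (`∀ (`∀ ((x₁ `* `S x₀) `≐ ((x₁ `* x₀) `+ x₁))))
  ax-ind  : ∀ {n} (φ : Formula (suc n)) →
            PA (∀* (subF atZero φ `⇒ `∀ (φ `⇒ subF atSucc φ) `⇒ `∀ φ))

record Structure (ℓ : Level) : Set (lsuc ℓ) where
  field
    Carrier : Set ℓ
    zeroᴹ   : Carrier
    sucᴹ    : Carrier → Carrier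
    _+ᴹ_    : Carrier → Carrier → Carrier
    _*ᴹ_    : Carrier → Carrier → Carrier
open Structure public

module _ {ℓ : Level} (M : Structure ℓ) where
  evalT : ∀ {n} → (Fin n → Carrier M) → Term n → Carrier M
  evalT ρ (var i)  = ρ i
  evalT ρ `0       = zeroᴹ M
  evalT ρ (`S t)   = sucᴹ M (evalT ρ t)
  evalT ρ (t `+ s) = _+ᴹ_ M (evalT ρ t) (evalT ρ s)
  evalT ρ (t `* s) = _*ᴹ_ M (evalT ρ t) (evalT ρ s)

  cons : ∀ {n} → Carrier M → (Fin n → Carrier M) → Fin (suc n) → Carrier M
  cons a ρ fz     = a
  cons a ρ (fs i) = ρ i

  Sat : ∀ {n} → (Fin n → Carrier M) → Formula n → Set ℓ
  Sat ρ `⊥       = Level.Lift ℓ ⊥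
  Sat ρ (t `≐ s) = evalT ρ t ≡ evalT ρ s
  Sat ρ (φ `⇒ ψ) = Sat ρ φ → Sat ρ ψ
  Sat ρ (`∀ φ)   = (a : Carrier M) → Sat (cons a ρ) φ

  emptyEnv : Fin 0 → Carrier M
  emptyEnv ()

_⊨_ : ∀ {ℓ} → Structure ℓ → Sentence → Set ℓ
M ⊨ σ = Sat M (emptyEnv M) σ

Theory : Set₁
Theory = Sentence → Set

_⊨T_ : ∀ {ℓ} → Structure ℓ → Theory → Set ℓ
M ⊨T T = ∀ σ → T σ → M ⊨ σ

_≡ₑ_ : ∀ {ℓ} → Structure ℓ → Structure ℓ → Set ℓ
M ≡ₑ N = ∀ σ → (M ⊨ σ → N ⊨ σ) × (N ⊨ σ → M ⊨ σ)

-- End-extensions (up to isomorphic copy: an embedding whose image is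
-- an initial segment; x ≤ y means ∃ z. x + z = y)

record EndExtension {ℓ} (M N : Structure ℓ) : Set ℓ where
  field
    emb     : Carrier M → Carrier N
    inj     : ∀ a b → emb a ≡ emb b → a ≡ b
    pres-0  : emb (zeroᴹ M) ≡ zeroᴹ N
    pres-S  : ∀ a → emb (sucᴹ M a) ≡ sucᴹ N (emb a)
    pres-+  : ∀ a b → emb (_+ᴹ_ M a b) ≡ _+ᴹ_ N (emb a) (emb b)
    pres-*  : ∀ a b → emb (_*ᴹ_ M a b) ≡ _*ᴹ_ N (emb a) (emb b)
    initial : ∀ (c : Carrier N) (b : Carrier M) →
              Σ (Carrier N) (λ z → _+ᴹ_ N c z ≡ emb b) →
              Σ (Carrier M) (λ a → emb a ≡ c)

-- the end-extension modalities relative to a theory T (= PA⁺)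
◇end : ∀ {ℓ} → Theory → Structure ℓ → (Structure ℓ → Set (lsuc ℓ)) → Set (lsuc ℓ)
◇end {ℓ} T M P = Σ (Structure ℓ) (λ N → EndExtension M N × (N ⊨T T) × P N)

□end : ∀ {ℓ} → Theory → Structure ℓ → (Structure ℓ → Set (lsuc ℓ)) → Set (lsuc ℓ)
□end {ℓ} T M P = (N : Structure ℓ) → EndExtension M N → N ⊨T T → P N

AMP : ∀ {ℓ} → Theory → Structure ℓ → Set (lsuc ℓ)
AMP {ℓ} T M = (σ : Sentence) →
  ◇end T M (λ N → □end T N (λ K → Level.Lift (lsuc ℓ) (K ⊨ σ))) → M ⊨ σ

data PR : ℕ → Set where
  zer  : ∀ {n} → PR n
  succ : PR 1
  proj : ∀ {n} → Fin n → PR n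
  comp : ∀ {n m} → PR m → Vec (PR n) m → PR n
  prec : ∀ {n} → PR n → PR (suc (suc n)) → PR (suc n)
  mu   : ∀ {n} → PR (suc n) → PR n

mutual
  data _[_]⇓_ : ∀ {n} → PR n → Vec ℕ n → ℕ → Set where
    ev-zer  : ∀ {n} {xs : Vec ℕ n} → zer [ xs ]⇓ 0
    ev-succ : ∀ {x} → succ [ x ∷ [] ]⇓ suc x
    ev-proj : ∀ {n} {xs : Vec ℕ n} (i : Fin n) → proj i [ xs ]⇓ lookup xs i
    ev-comp : ∀ {n m} {f : PR m} {gs : Vec (PR n) m} {xs ys z} →
              gs [ xs ]⇓* ys → f [ ys ]⇓ z → comp f gs [ xs ]⇓ z
    ev-rec0 : ∀ {n} {g : PR n} {h xs z} → g [ xs ]⇓ z → prec g h [ 0 ∷ xs ]⇓ z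
    ev-recS : ∀ {n} {g : PR n} {h xs y r z} →
              prec g h [ y ∷ xs ]⇓ r → h [ y ∷ r ∷ xs ]⇓ z →
              prec g h [ suc y ∷ xs ]⇓ z
    ev-mu   : ∀ {n} {f : PR (suc n)} {xs y} →
              f [ y ∷ xs ]⇓ 0 →
              (∀ z → z < y → Σ ℕ (λ k → f [ z ∷ xs ]⇓ suc k)) →
              mu f [ xs ]⇓ y

  data _[_]⇓*_ : ∀ {n m} → Vec (PR n) m → Vec ℕ n → Vec ℕ m → Set where
    ev-[] : ∀ {n} {xs : Vec ℕ n} → [] [ xs ]⇓* []
    ev-∷  : ∀ {n m} {g : PR n} {gs : Vec (PR n) m} {xs y ys} →
            g [ xs ]⇓ y → gs [ xs ]⇓* ys → (g ∷ gs) [ xs ]⇓* (y ∷ ys)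

-- Gödel numbering via Cantor pairing
tri : ℕ → ℕ
tri zero    = zero
tri (suc k) = suc k + tri k

pair : ℕ → ℕ → ℕ
pair a b = tri (a + b) + b

codeT : ∀ {n} → Term n → ℕ
codeT (var i)  = pair 0 (toℕ i)
codeT `0       = pair 1 0
codeT (`S t)   = pair 2 (codeT t)
codeT (t `+ s) = pair 3 (pair (codeT t) (codeT s))
codeT (t `* s) = pair 4 (pair (codeT t) (codeT s))

codeF : ∀ {n} → Formula n → ℕ
codeF `⊥       = pair 0 0
codeF (t `≐ s) = pair 1 (pair (codeT t) (codeT s))
codeF (φ `⇒ ψ) = pair 2 (pair (codeF φ) (codeF ψ))
codeF (`∀ φ)   = pair 3 (codeF φ)

CE : Theory → Set
CE T = Σ (PR 1) (λ e → ∀ σ →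
         (T σ → Σ ℕ (λ y → e [ codeF σ ∷ [] ]⇓ y)) ×
         (Σ ℕ (λ y → e [ codeF σ ∷ [] ]⇓ y) → T σ))

-- For every sentence φ there are sentences A₀, A₁, … such that a model of T has an end-extension
-- satisfying T + φ if and only if it satisfies all Aₖ.  Hence which sentences are possible in a model,
-- and then also which are possibly necessary, depends only on its theory, and the theorem follows.
--
-- Aₖ says that for every m some finite set looks below m like the truth set of a Henkin model of φ and
-- of the axioms of T with code and halting witness below k.  If K is an end-extension of M satisfying
-- T + φ, such a set is read off in K from the values of the first m Henkin names, and since the least
-- code of a set of numbers below m ∈ M is bounded by an element of M, it belongs to M.  Conversely, if M
-- satisfies all Aₖ, a definable leftmost branch of the tree of approximations is the truth set of a
-- Henkin model, which satisfies T + φ and end-extends M by induction in M.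
--
-- No proof calculus, no substitution and no definable truth predicate is needed: formulas are evaluated
-- under coded environments, and only conditions about standard formulas have to be met.
module Submission where

-- The difficulty is that `M` need not believe `T + φ` to be consistent: nonstandard codes may pass
-- the halting test, and the cut of standard numbers has no definition in `M`. The sentences `Aₖ`
-- therefore deal with one standard bound at a time, in the manner of the Orey-Hájek criterion with
-- its consistency statements for finite subtheories. The tree behind the converse, on the other
-- hand, does not mention standardness: a node of level `m` serves every `k` up to `m`, standard or
-- not, that can be served at all levels. Its leftmost branch then serves all standard `k` at once.
--
-- The passage from possible sentences to possibly necessary ones uses that impossibility is
-- witnessed by a single sentence. If `σ` is necessary in an end-extension `N'` of `N`, then some
-- `Aₖ` for the negation of `σ` fails in `N'`. The negation of this one sentence is possible in `N`,
-- hence in `M`, and `σ` is necessary in every model of `T` that satisfies it.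

open import Defs
open import Level using (Level; Lift; lift; lower; _⊔_) renaming (suc to lsuc; zero to lzero)
open import Axiom.ExcludedMiddle using (ExcludedMiddle)
open import Axiom.UniquenessOfIdentityProofs.WithK using (uip)
open import Algebra.Bundles using (CommutativeSemiring)
open import Algebra.Structures.Biased using (module IsCommutativeSemiringˡ)
import Algebra.Solver.Ring.NaturalCoefficients.Default as SemiringSolver
open import Data.Nat as ℕ using (ℕ; zero; suc)
import Data.Nat.Properties as ℕP
open import Data.Nat.Tactic.RingSolver using (solve-∀)
open import Data.Fin using (Fin; zero; suc; toℕ; fromℕ<; _↑ˡ_; _↑ʳ_; #_)
import Data.Fin.Properties as FinP
open import Data.Vec using (Vec; []; _∷_; lookup; tabulate)
open import Data.Vec.Properties using (tabulate-cong; lookup∘tabulate)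
open import Data.Product using (Σ; _×_; _,_; proj₁; proj₂)
open import Data.Sum using (_⊎_; inj₁; inj₂)
open import Data.Unit using (⊤; tt)
open import Data.Empty using (⊥; ⊥-elim)
open import Relation.Nullary using (¬_; Dec; yes; no)
open import Relation.Nullary.Decidable using (True)
open import Relation.Binary.PropositionalEquality using (_≡_; refl; sym; trans; cong; cong₂; subst; subst₂; isEquivalence; module ≡-Reasoning)

-- Arithmetic over an abstract class of definable predicates

infix 3 _⟺_
_⟺_ : ∀ {a b} → Set a → Set b → Set (a ⊔ b)
A ⟺ B = (A → B) × (B → A)

module Identities {a b} (R : CommutativeSemiring a b) where
  open CommutativeSemiring R using (_+_; _*_; 1#; _≈_) renaming (refl to ≈-refl)
  open SemiringSolver R

  interchange-+ : ∀ a c x y → (a + c) + (x + y) ≈ (a + x) + (c + y)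
  interchange-+ = solve 4 (λ a c x y → (a :+ c) :+ (x :+ y) := (a :+ x) :+ (c :+ y)) ≈-refl

  expand-* : ∀ a c x y → a * c + (a * y + x * (c + y)) ≈ (a + x) * (c + y)
  expand-* = solve 4 (λ a c x y → a :* c :+ (a :* y :+ x :* (c :+ y)) := (a :+ x) :* (c :+ y)) ≈-refl

  square-suc : ∀ x → ((x * x + x) + 1#) + x ≈ (x + 1#) * (x + 1#)
  square-suc = solve 1 (λ x → ((x :* x :+ x) :+ con 1) :+ x := (x :+ con 1) :* (x :+ con 1)) ≈-refl

  collect : ∀ d y w a → d * y + (a + d * w) ≈ a + d * (y + w)
  collect = solve 4 (λ d y w a → d :* y :+ (a :+ d :* w) := a :+ d :* (y :+ w)) ≈-refl

  -- With `j = i + z`, `b = z q` and the moduli `u = i b + 1`, `v = j b + 1`, the difference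
  -- `j u - i v` is `z`. Multiplying by `j q a` turns `z` into `j b a = v a - a`; the identity is
  -- this equation with the negative terms moved across.
  combination₁ : ∀ i z q a → a + (i + z) * q * (i + z) * ((i * (z * q) + 1#) * a) ≈
                             ((i + z) * (z * q) + 1#) * (a + (i + z) * q * i * a)
  combination₁ = solve 4 (λ i z q a → a :+ (i :+ z) :* q :* (i :+ z) :* ((i :* (z :* q) :+ con 1) :* a) :=
                                      ((i :+ z) :* (z :* q) :+ con 1) :* (a :+ (i :+ z) :* q :* i :* a)) ≈-refl

  -- The same computation for `i = j + z`: now `j u - i v = - z`, so the multiples of the two moduli
  -- swap sides.
  combination₂ : ∀ j z q a → a + (j * (z * q) + 1#) * (j * q * (j + z) * a) ≈
                             (j * (z * q) + 1#) * a + j * q * j * (((j + z) * (z * q) + 1#) * a)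
  combination₂ = solve 4 (λ j z q a → a :+ (j :* (z :* q) :+ con 1) :* (j :* q :* (j :+ z) :* a) :=
                                      (j :* (z :* q) :+ con 1) :* a :+ j :* q :* j :* (((j :+ z) :* (z :* q) :+ con 1) :* a)) ≈-refl

  pull₁ : ∀ a j q d r → a + d * (j * q * j * r) ≈ a + j * q * j * (d * r)
  pull₁ = solve 5 (λ a j q d r → a :+ d :* (j :* q :* j :* r) := a :+ j :* q :* j :* (d :* r)) ≈-refl

  pull₂ : ∀ a j q d r → d * a + j * q * j * (d * r) ≈ d * (a + j * q * j * r)
  pull₂ = solve 5 (λ a j q d r → d :* a :+ j :* q :* j :* (d :* r) := d :* (a :+ j :* q :* j :* r)) ≈-refl

-- Classically, falsity, implication and universal quantification generate the other connectives,
-- and the graphs of the operations generate all terms, so these closure conditions suffice. `dCst`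
-- admits parameters, which turns `ind` into induction with parameters.
record Arith {ℓ} (M : Structure ℓ) : Set (lsuc ℓ) where
  field
    em   : ExcludedMiddle ℓ
    Def  : ∀ {n} → ((Fin n → Carrier M) → Set ℓ) → Set ℓ
    dIff : ∀ {n} {P Q : (Fin n → Carrier M) → Set ℓ} → (∀ ρ → P ρ ⟺ Q ρ) → Def P → Def Q
    dRen : ∀ {n m} {P : (Fin n → Carrier M) → Set ℓ} (r : Fin n → Fin m) →
           Def P → Def (λ ρ → P (λ i → ρ (r i)))
    d⊥   : ∀ {n} → Def {n} (λ _ → Lift ℓ ⊥)
    dImp : ∀ {n} {P Q : (Fin n → Carrier M) → Set ℓ} → Def P → Def Q → Def (λ ρ → P ρ → Q ρ)
    dAll : ∀ {n} {Q : (Fin n → Carrier M) → Carrier M → Set ℓ} →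
           Def {suc n} (λ ρ → Q (λ i → ρ (suc i)) (ρ zero)) → Def (λ ρ → ∀ a → Q ρ a)
    dVar : ∀ {n} (i j : Fin n) → Def (λ ρ → ρ i ≡ ρ j)
    dCst : ∀ {n} (i : Fin n) c → Def (λ ρ → ρ i ≡ c)
    dSuc : ∀ {n} (i j : Fin n) → Def (λ ρ → ρ i ≡ sucᴹ M (ρ j))
    dAdd : ∀ {n} (i j k : Fin n) → Def (λ ρ → ρ i ≡ _+ᴹ_ M (ρ j) (ρ k))
    dMul : ∀ {n} (i j k : Fin n) → Def (λ ρ → ρ i ≡ _*ᴹ_ M (ρ j) (ρ k))
    S≢0  : ∀ a → sucᴹ M a ≡ zeroᴹ M → ⊥
    Sinj : ∀ a b → sucᴹ M a ≡ sucᴹ M b → a ≡ b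
    +0   : ∀ a → _+ᴹ_ M a (zeroᴹ M) ≡ a
    +S   : ∀ a b → _+ᴹ_ M a (sucᴹ M b) ≡ sucᴹ M (_+ᴹ_ M a b)
    *0   : ∀ a → _*ᴹ_ M a (zeroᴹ M) ≡ zeroᴹ M
    *S   : ∀ a b → _*ᴹ_ M a (sucᴹ M b) ≡ _+ᴹ_ M (_*ᴹ_ M a b) a
    ind  : {P : Carrier M → Set ℓ} → Def {1} (λ ρ → P (ρ zero)) →
           P (zeroᴹ M) → (∀ a → P a → P (sucᴹ M a)) → ∀ a → P a

module Arithmetic {ℓ} (M : Structure ℓ) (A : Arith M) where
  open Arith A public

  C : Set ℓ
  C = Carrier M
  O : C
  O = zeroᴹ M
  S : C → C
  S = sucᴹ M
  infixl 6 _+_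
  infixl 7 _*_
  _+_ _*_ : C → C → C
  _+_ = _+ᴹ_ M
  _*_ = _*ᴹ_ M

  Pred : ℕ → Set (lsuc ℓ)
  Pred n = (Fin n → C) → Set ℓ

  Fun : ℕ → Set ℓ
  Fun n = (Fin n → C) → C

  opaque
    dne : ∀ {P : Set ℓ} → ¬ ¬ P → P
    dne {P} h with em {P}
    ... | yes p = p
    ... | no np = ⊥-elim (h np)

    dNot : ∀ {n} {P : Pred n} → Def P → Def (λ ρ → ¬ P ρ)
    dNot d = dIff (λ ρ → (λ f p → lower (f p)) , λ f p → lift (f p)) (dImp d d⊥)

    dAnd : ∀ {n} {P Q : Pred n} → Def P → Def Q → Def (λ ρ → P ρ × Q ρ)
    dAnd d e = dIff (λ ρ → (λ f → dne λ n → f λ p q → n (p , q)) , λ { (p , q) f → f p q })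
                    (dNot (dImp d (dNot e)))

    dOr : ∀ {n} {P Q : Pred n} → Def P → Def Q → Def (λ ρ → P ρ ⊎ Q ρ)
    dOr d e = dIff (λ ρ → (λ f → dne λ n → n (inj₂ (f λ p → n (inj₁ p))))
                        , λ { (inj₁ p) n → ⊥-elim (n p) ; (inj₂ q) _ → q })
                   (dImp (dNot d) e)

    dEx : ∀ {n} {Q : (Fin n → C) → C → Set ℓ} →
          Def {suc n} (λ ρ → Q (λ i → ρ (suc i)) (ρ zero)) → Def (λ ρ → Σ C λ a → Q ρ a)
    dEx {Q = Q} d = dIff (λ ρ → (λ f → dne λ n → f λ a q → n (a , q)) , λ { (a , q) f → f a q })
                    (dNot (dAll {Q = λ ρ a → ¬ Q ρ a} (dNot d)))

    dIffP : ∀ {n} {P Q : Pred n} → Def P → Def Q → Def (λ ρ → P ρ ⟺ Q ρ)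
    dIffP d e = dAnd (dImp d e) (dImp e d)

  record DF {n} (f : Fun n) : Set ℓ where
    constructor df
    field graph : Def {suc n} (λ ρ → ρ zero ≡ f (λ i → ρ (suc i)))
  open DF public

  private
    shift : ∀ {n} → Fin (suc n) → Fin (suc (suc n))
    shift zero    = zero
    shift (suc i) = suc (suc i)

  opaque
    -- Only graphs on variables are assumed to be definable, so a composite is unfolded by
    -- quantifying over the intermediate value.
    compose₁ : ∀ {n} {R : C → (Fin n → C) → Set ℓ} {f : Fun n} → DF f →
      Def {suc n} (λ ρ → R (ρ zero) (λ i → ρ (suc i))) → Def (λ ρ → R (f ρ) ρ)
    compose₁ {R = R} {f} (df d) r =
      dIff (λ ρ → (λ { (_ , refl , h) → h }) , λ h → f ρ , refl , h)
           (dEx {Q = λ ρ a → (a ≡ f ρ) × R a ρ} (dAnd d r))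

    fVar : ∀ {n} {i : Fin n} → DF (λ ρ → ρ i)
    fVar {i = i} = df (dVar zero (suc i))

    fCst : ∀ {n} {c : C} → DF {n} (λ ρ → c)
    fCst {c = c} = df (dCst zero c)

    weaken : ∀ {n} {f : Fun n} → DF f → DF {suc n} (λ ρ → f (λ i → ρ (suc i)))
    weaken (df d) = df (dRen shift d)

    infix 4 _≐_
    _≐_ : ∀ {n} {f g : Fun n} → DF f → DF g → Def (λ ρ → f ρ ≡ g ρ)
    _≐_ {f = f} {g} d e =
      compose₁ {R = λ a ρ → a ≡ g ρ} d
        (compose₁ {R = λ b ρ → ρ zero ≡ b} (weaken e) (dVar (suc zero) zero))

    fSuc : ∀ {n} {f : Fun n} → DF f → DF (λ ρ → S (f ρ))
    fSuc {f = f} d = df (compose₁ {R = λ a ρ → ρ zero ≡ S a} (weaken d) (dSuc (suc zero) zero))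

    infixl 6 _⊕_
    infixl 7 _⊛_
    _⊕_ : ∀ {n} {f g : Fun n} → DF f → DF g → DF (λ ρ → f ρ + g ρ)
    _⊕_ {f = f} {g} d e = df (compose₁ {R = λ a ρ → ρ zero ≡ a + g (λ i → ρ (suc i))} (weaken d)
      (compose₁ {R = λ b ρ → ρ (suc zero) ≡ ρ zero + b} (weaken (weaken e)) (dAdd (suc (suc zero)) (suc zero) zero)))

    _⊛_ : ∀ {n} {f g : Fun n} → DF f → DF g → DF (λ ρ → f ρ * g ρ)
    _⊛_ {f = f} {g} d e = df (compose₁ {R = λ a ρ → ρ zero ≡ a * g (λ i → ρ (suc i))} (weaken d)
      (compose₁ {R = λ b ρ → ρ (suc zero) ≡ ρ zero * b} (weaken (weaken e)) (dMul (suc (suc zero)) (suc zero) zero)))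

  opaque
    +-identityˡ : ∀ a → O + a ≡ a
    +-identityˡ = ind (fCst ⊕ fVar ≐ fVar) (+0 O) λ a h → trans (+S O a) (cong S h)

    +-sucˡ : ∀ a b → S a + b ≡ S (a + b)
    +-sucˡ a = ind (fCst ⊕ fVar ≐ fSuc (fCst ⊕ fVar)) (trans (+0 (S a)) (cong S (sym (+0 a))))
      λ b h → trans (+S (S a) b) (trans (cong S h) (cong S (sym (+S a b))))

    +-comm : ∀ a b → a + b ≡ b + a
    +-comm a = ind (fCst ⊕ fVar ≐ fVar ⊕ fCst) (trans (+0 a) (sym (+-identityˡ a)))
      λ b h → trans (+S a b) (trans (cong S h) (sym (+-sucˡ b a)))

    +-assoc : ∀ a b c → (a + b) + c ≡ a + (b + c)
    +-assoc a b = ind (fCst ⊕ fVar ≐ fCst ⊕ (fCst ⊕ fVar)) (trans (+0 (a + b)) (cong (a +_) (sym (+0 b))))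
      λ c h → trans (+S (a + b) c) (trans (cong S h) (trans (sym (+S a (b + c))) (cong (a +_) (sym (+S b c)))))

    *-zeroˡ : ∀ a → O * a ≡ O
    *-zeroˡ = ind (fCst ⊛ fVar ≐ fCst) (*0 O) λ a h → trans (*S O a) (trans (+0 (O * a)) h)

    *-sucˡ : ∀ a b → S a * b ≡ a * b + b
    *-sucˡ a = ind (fCst ⊛ fVar ≐ fCst ⊛ fVar ⊕ fVar)
      (trans (*0 (S a)) (trans (sym (*0 a)) (sym (+0 (a * O)))))
      λ b h → begin
        S a * S b             ≡⟨ *S (S a) b ⟩
        S a * b + S a         ≡⟨ cong (_+ S a) h ⟩
        (a * b + b) + S a     ≡⟨ +S _ a ⟩
        S ((a * b + b) + a)   ≡⟨ cong S (trans (+-assoc _ b a) (trans (cong (a * b +_) (+-comm b a)) (sym (+-assoc _ a b)))) ⟩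
        S ((a * b + a) + b)   ≡⟨ sym (+S _ b) ⟩
        (a * b + a) + S b     ≡⟨ cong (_+ S b) (sym (*S a b)) ⟩
        a * S b + S b ∎
      where open ≡-Reasoning

    *-comm : ∀ a b → a * b ≡ b * a
    *-comm a = ind (fCst ⊛ fVar ≐ fVar ⊛ fCst) (trans (*0 a) (sym (*-zeroˡ a)))
      λ b h → trans (*S a b) (trans (cong (_+ a) h) (sym (*-sucˡ b a)))

    *-distribˡ-+ : ∀ a b c → a * (b + c) ≡ a * b + a * c
    *-distribˡ-+ a b = ind (fCst ⊛ (fCst ⊕ fVar) ≐ fCst ⊕ fCst ⊛ fVar)
      (trans (cong (a *_) (+0 b)) (trans (sym (+0 (a * b))) (cong (a * b +_) (sym (*0 a)))))
      λ c h → trans (cong (a *_) (+S b c)) (trans (*S a (b + c)) (trans (cong (_+ a) h)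
        (trans (+-assoc _ _ a) (cong (a * b +_) (sym (*S a c))))))

    *-distribʳ-+ : ∀ a b c → (b + c) * a ≡ b * a + c * a
    *-distribʳ-+ a b c = trans (*-comm _ a) (trans (*-distribˡ-+ a b c) (cong₂ _+_ (*-comm a b) (*-comm a c)))

    *-assoc : ∀ a b c → (a * b) * c ≡ a * (b * c)
    *-assoc a b = ind (fCst ⊛ fVar ≐ fCst ⊛ (fCst ⊛ fVar))
      (trans (*0 _) (trans (sym (*0 a)) (cong (a *_) (sym (*0 b)))))
      λ c h → trans (*S (a * b) c) (trans (cong (_+ a * b) h) (trans (sym (*-distribˡ-+ a (b * c) b)) (cong (a *_) (sym (*S b c)))))

    *-identityˡ : ∀ a → S O * a ≡ a
    *-identityˡ a = trans (*-sucˡ O a) (trans (cong (_+ a) (*-zeroˡ a)) (+-identityˡ a))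

  commutativeSemiring : CommutativeSemiring ℓ ℓ
  commutativeSemiring = record
    { Carrier = C ; _≈_ = _≡_ ; _+_ = _+_ ; _*_ = _*_ ; 0# = O ; 1# = S O
    ; isCommutativeSemiring = IsCommutativeSemiringˡ.isCommutativeSemiring record
      { +-isCommutativeMonoid = record
        { isMonoid = record
          { isSemigroup = record
            { isMagma = record { isEquivalence = isEquivalence ; ∙-cong = cong₂ _+_ }
            ; assoc = +-assoc }
          ; identity = +-identityˡ , +0 }
        ; comm = +-comm }
      ; *-isCommutativeMonoid = record
        { isMonoid = record
          { isSemigroup = record
            { isMagma = record { isEquivalence = isEquivalence ; ∙-cong = cong₂ _*_ }
            ; assoc = *-assoc }
          ; identity = *-identityˡ , λ a → trans (*-comm a _) (*-identityˡ a) }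
        ; comm = *-comm }
      ; distribʳ = *-distribʳ-+
      ; zeroˡ = *-zeroˡ } }

  open Identities commutativeSemiring

  opaque
    S≡ : ∀ a → S a ≡ a + S O
    S≡ a = trans (cong S (sym (+0 a))) (sym (+S a O))

    +-cancelˡ : ∀ a {b c} → a + b ≡ a + c → b ≡ c
    +-cancelˡ a {b} {c} = ind {λ a → a + b ≡ a + c → b ≡ c} (dImp (fVar ⊕ fCst ≐ fVar ⊕ fCst) (fCst ≐ fCst))
      (λ h → trans (sym (+-identityˡ b)) (trans h (+-identityˡ c)))
      (λ a ih h → ih (Sinj _ _ (trans (sym (+-sucˡ a b)) (trans h (+-sucˡ a c))))) a

    zero? : ∀ a → a ≡ O ⊎ Σ C λ b → a ≡ S b
    zero? = ind (dOr (fVar ≐ fCst) (dEx (fVar ≐ fSuc fVar))) (inj₁ refl) (λ a _ → inj₂ (a , refl))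

  opaque
    +≡0 : ∀ {a b} → a + b ≡ O → a ≡ O × b ≡ O
    +≡0 {a} {b} h with zero? b
    ... | inj₁ refl = trans (sym (+0 a)) h , refl
    ... | inj₂ (c , refl) = ⊥-elim (S≢0 _ (trans (sym (+S a c)) h))

    *≢0 : ∀ {a b} → ¬ a ≡ O → ¬ b ≡ O → ¬ a * b ≡ O
    *≢0 {a} {b} na nb h with zero? b
    ... | inj₁ p = nb p
    ... | inj₂ (c , refl) = na (proj₂ (+≡0 (trans (sym (*S a c)) h)))

  infix 4 _≤_ _<_
  _≤_ _<_ : C → C → Set ℓ
  a ≤ b = Σ C λ z → a + z ≡ b
  a < b = S a ≤ b

  opaque
    infix 4 _≤̇_ _<̇_
    _≤̇_ : ∀ {n} {f g : Fun n} → DF f → DF g → Def (λ ρ → f ρ ≤ g ρ)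
    d ≤̇ e = dEx (weaken d ⊕ fVar ≐ weaken e)

    _<̇_ : ∀ {n} {f g : Fun n} → DF f → DF g → Def (λ ρ → f ρ < g ρ)
    d <̇ e = fSuc d ≤̇ e

  opaque
    ≤-refl : ∀ {a} → a ≤ a
    ≤-refl = O , +0 _

    ≤-reflexive : ∀ {a b} → a ≡ b → a ≤ b
    ≤-reflexive refl = ≤-refl

    ≤-trans : ∀ {a b c} → a ≤ b → b ≤ c → a ≤ c
    ≤-trans {a} (x , refl) (y , refl) = x + y , sym (+-assoc a x y)

    O≤ : ∀ {a} → O ≤ a
    O≤ = _ , +-identityˡ _

    m≤m+n : ∀ a b → a ≤ a + b
    m≤m+n a b = b , refl

    m≤n+m : ∀ a b → a ≤ b + a
    m≤n+m a b = b , +-comm a b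

    s≤s : ∀ {a b} → a ≤ b → S a ≤ S b
    s≤s (z , refl) = z , +-sucˡ _ z

    s≤s⁻¹ : ∀ {a b} → S a ≤ S b → a ≤ b
    s≤s⁻¹ (z , h) = z , Sinj _ _ (trans (sym (+-sucˡ _ z)) h)

    n<Sn : ∀ {a} → a < S a
    n<Sn = ≤-refl

    <⇒≤ : ∀ {a b} → a < b → a ≤ b
    <⇒≤ h = ≤-trans (S O , trans (+S _ O) (cong S (+0 _))) h

    ≤∧<⇒< : ∀ {a b c} → a ≤ b → b < c → a < c
    ≤∧<⇒< h k = ≤-trans (s≤s h) k

    <-trans : ∀ {a b c} → a < b → b < c → a < c
    <-trans h k = ≤∧<⇒< (<⇒≤ h) k

    n≮0 : ∀ {a} → ¬ a < O
    n≮0 (z , h) = S≢0 _ (proj₁ (+≡0 h))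

    <-irrefl : ∀ {a} → ¬ a < a
    <-irrefl {a} (z , h) = S≢0 z (+-cancelˡ a (trans (+S a z) (trans (sym (+-sucˡ a z)) (trans h (sym (+0 a))))))

    ≤⇒<∨≡ : ∀ {a b} → a ≤ b → a < b ⊎ a ≡ b
    ≤⇒<∨≡ {a} (z , refl) with zero? z
    ... | inj₁ refl = inj₂ (sym (+0 a))
    ... | inj₂ (y , refl) = inj₁ (y , trans (+-sucˡ a y) (sym (+S a y)))

  opaque
    _≤?_ : ∀ a b → a ≤ b ⊎ b < a
    a ≤? b = ind {λ b → a ≤ b ⊎ b < a} (dOr (fCst ≤̇ fVar) (fVar <̇ fCst)) base step b
      where
        base : a ≤ O ⊎ O < a
        base with zero? a
        ... | inj₁ refl = inj₁ ≤-refl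
        ... | inj₂ (c , refl) = inj₂ (s≤s O≤)
        step : ∀ b → a ≤ b ⊎ b < a → a ≤ S b ⊎ S b < a
        step b (inj₁ h) = inj₁ (≤-trans h (<⇒≤ n<Sn))
        step b (inj₂ h) with ≤⇒<∨≡ h
        ... | inj₁ k = inj₂ k
        ... | inj₂ refl = inj₁ ≤-refl

  opaque
    <S⇒<∨≡ : ∀ {a b} → a < S b → a < b ⊎ a ≡ b
    <S⇒<∨≡ h = ≤⇒<∨≡ (s≤s⁻¹ h)

    +-mono-≤ : ∀ {a b c d} → a ≤ b → c ≤ d → a + c ≤ b + d
    +-mono-≤ {a} {c = c} (x , refl) (y , refl) = x + y ,
      interchange-+ a c x y

    *-mono-≤ : ∀ {a b c d} → a ≤ b → c ≤ d → a * c ≤ b * d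
    *-mono-≤ {a} {c = c} (x , refl) (y , refl) = a * y + x * (c + y) ,
      expand-* a c x y

    n≤n*n : ∀ a → a ≤ a * a
    n≤n*n a with zero? a
    ... | inj₁ refl = O≤
    ... | inj₂ (b , refl) = ≤-trans (m≤n+m (S b) (S b * b)) (≤-reflexive (sym (*S (S b) b)))

  opaque
    strongInd : {P : C → Set ℓ} → Def {1} (λ ρ → P (ρ zero)) →
                (∀ n → (∀ u → u < n → P u) → P n) → ∀ n → P n
    strongInd {P} d step n = ind {λ n → ∀ u → u < n → P u}
      (dAll (dImp (fVar <̇ fVar) (dRen (λ _ → zero) d)))
      (λ u h → ⊥-elim (n≮0 h)) up (S n) n n<Sn
      where
      up : ∀ a → (∀ u → u < a → P u) → ∀ u → u < S a → P u
      up a ih u h with <S⇒<∨≡ h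
      ... | inj₁ k = ih u k
      ... | inj₂ refl = step a ih

  Least : (C → Set ℓ) → C → Set ℓ
  Least P m = P m × ∀ u → u < m → ¬ P u

  opaque
    least : {P : C → Set ℓ} → Def {1} (λ ρ → P (ρ zero)) → Σ C P → Σ C (Least P)
    least {P} d (a , p) = dne λ no → strongInd {λ n → ¬ P n} (dNot d)
      (λ n h q → no (n , q , h)) a p

    Least-unique : ∀ {P : C → Set ℓ} {a b} → Least P a → Least P b → a ≡ b
    Least-unique {a = a} {b} (p , h) (q , k) with a ≤? b
    ... | inj₂ l = ⊥-elim (h b l q)
    ... | inj₁ l with ≤⇒<∨≡ l
    ...   | inj₁ m = ⊥-elim (k a m p)
    ...   | inj₂ e = e

  -- A polynomial pairing function; unlike Cantor's it is a term of the language.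

  opaque
    J : C → C → C
    J a b = (a + b) * (a + b) + b

    J≡ : ∀ a b → J a b ≡ (a + b) * (a + b) + b
    J≡ a b = refl

  opaque
    unfolding J
    fJ : ∀ {n} {f g : Fun n} → DF f → DF g → DF (λ ρ → J (f ρ) (g ρ))
    fJ d e = (d ⊕ e) ⊛ (d ⊕ e) ⊕ e

  opaque
    unfolding J
    -- Pairs with sum `s` take values from `s * s` to `s * s + s`, all below the square of `S s`. So
    -- the value determines the sum, then by cancellation the second component, then the first.
    J-inj : ∀ {a b c d} → J a b ≡ J c d → a ≡ c × b ≡ d
    J-inj {a} {b} {c} {d} h = a≡c , b≡d
      where
      lem : ∀ {a b c d} → a + b < c + d → J a b < J c d
      lem {a} {b} {c} {d} l = ≤-trans (≤-trans
          (s≤s (+-mono-≤ (≤-refl {(a + b) * (a + b)}) (m≤n+m b a)))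
          (≤-trans (a + b , sq (a + b)) (*-mono-≤ l l)))
        (m≤m+n _ d)
        where
        sq : ∀ x → S (x * x + x) + x ≡ S x * S x
        sq x = trans (cong (_+ x) (S≡ _)) (trans
          (square-suc x)
          (sym (cong₂ _*_ (S≡ x) (S≡ x))))
      sums : a + b ≡ c + d
      sums with (a + b) ≤? (c + d)
      ... | inj₂ l = ⊥-elim (<-irrefl (subst (J c d <_) h (lem {c} {d} {a} {b} l)))
      ... | inj₁ l with ≤⇒<∨≡ l
      ...   | inj₁ m = ⊥-elim (<-irrefl (subst (_< J c d) h (lem {a} {b} {c} {d} m)))
      ...   | inj₂ e = e
      b≡d : b ≡ d
      b≡d = +-cancelˡ ((a + b) * (a + b)) (trans h (cong (λ s → s * s + d) (sym sums)))
      a≡c : a ≡ c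
      a≡c = +-cancelˡ b (trans (+-comm b a) (trans sums (trans (cong (c +_) (sym b≡d)) (+-comm c b))))

  opaque
    unfolding J
    ≤J₁ : ∀ a b → a ≤ J a b
    ≤J₁ a b = ≤-trans (m≤m+n a b) (≤-trans (n≤n*n _) (m≤m+n _ b))

    ≤J₂ : ∀ a b → b ≤ J a b
    ≤J₂ a b = m≤n+m b _

    -- The tag has to be positive because `J O O` is `O`. This strict descent is what allows names
    -- to be evaluated by recursion on their codes.
    <J₂ : ∀ t a → a < J (S t) a
    <J₂ t a = ≤-trans (s≤s (≤-refl {a})) (≤-trans (≤-reflexive (cong S (sym (+-identityˡ a))))
      (≤-trans (≤-reflexive (sym (+-sucˡ O a))) (+-mono-≤ (≤-trans (≤-trans (s≤s O≤) (m≤m+n (S t) a)) (n≤n*n _)) ≤-refl)))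

    J-monoʳ-< : ∀ a {b c} → b < c → J a b < J a c
    J-monoʳ-< a {b} {c} l = ≤-trans (≤-reflexive (sym (+S _ b)))
      (+-mono-≤ (*-mono-≤ k k) l)
      where
      k : a + b ≤ a + c
      k = +-mono-≤ (≤-refl {a}) (<⇒≤ l)

  -- p belongs to the set coded by a and b when 1 + (p + 1) b divides a.

  modulus : C → C → C
  modulus b p = S (S p * b)

  Mem : C → C → C → Set ℓ
  Mem a b p = Σ C λ q → modulus b p * q ≡ a

  opaque
    dMem : ∀ {n} {f g h : Fun n} → DF f → DF g → DF h → Def (λ ρ → Mem (f ρ) (g ρ) (h ρ))
    dMem d e p = dEx (fSuc (fSuc (weaken p) ⊛ weaken e) ⊛ fVar ≐ weaken d)

  -- `b` plays the part of a factorial: it is divisible by 1, ..., `n`, hence by the difference of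
  -- any two distinct indices below `n`.
  Base : C → C → Set ℓ
  Base n b = ¬ b ≡ O × (∀ j → j < n → Σ C λ q → S j * q ≡ b)

  opaque
    base : ∀ n → Σ C (Base n)
    base = ind (dEx (dAnd (dNot (fVar ≐ fCst)) (dAll (dImp (fVar <̇ fVar) (dEx (fSuc fVar ⊛ fVar ≐ fVar))))))
      (S O , S≢0 O , λ j h → ⊥-elim (n≮0 h))
      λ n (b , nz , f) → b * S n , *≢0 nz (S≢0 n) , λ j h → step n b f j (<S⇒<∨≡ h)
      where
      step : ∀ n b → (∀ j → j < n → Σ C λ q → S j * q ≡ b) →
             ∀ j → j < n ⊎ j ≡ n → Σ C λ q → S j * q ≡ b * S n
      step n b f j (inj₁ l) = proj₁ (f j l) * S n , trans (sym (*-assoc (S j) _ (S n))) (cong (_* S n) (proj₂ (f j l)))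
      step n b f j (inj₂ refl) = b , *-comm (S n) b

  -- The product of all the moduli is one such `m`. It depends on `n` and `b` only and bounds the
  -- least codes of all sets at once.
  CommonMultiple : C → C → C → Set ℓ
  CommonMultiple n b m = ¬ m ≡ O × (∀ i → i < n → Mem m b i)

  opaque
    commonMultiple : ∀ n b → Σ C (CommonMultiple n b)
    commonMultiple n b = ind {λ n → Σ C (CommonMultiple n b)}
      (dEx (dAnd (dNot (fVar ≐ fCst)) (dAll (dImp (fVar <̇ fVar) (dMem fVar fCst fVar)))))
      (S O , S≢0 O , λ j h → ⊥-elim (n≮0 h))
      (λ n (m , nz , f) → m * modulus b n , *≢0 nz (S≢0 _) , λ j h → step n m f j (<S⇒<∨≡ h)) n
      where
      step : ∀ n m → (∀ i → i < n → Mem m b i) → ∀ i → i < n ⊎ i ≡ n → Mem (m * modulus b n) b i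
      step n m f i (inj₁ l) = proj₁ (f i l) * modulus b n ,
        trans (sym (*-assoc (modulus b i) _ _)) (cong (_* modulus b n) (proj₂ (f i l)))
      step n m f i (inj₂ refl) = m , *-comm _ m

  opaque
    -- Subtraction in disguise: `a` is `d * (y - x)` if `x` is at most `y`. Otherwise cancelling
    -- `d * y` leaves a sum equal to `O`, which forces `a` to be `O`, with quotient `O`.
    divides-difference : ∀ d x y a → a + d * x ≡ d * y → Σ C λ q → d * q ≡ a
    divides-difference d x y a h with x ≤? y
    ... | inj₁ (z , refl) = z , +-cancelˡ (d * x) (trans (sym (*-distribˡ-+ d x z)) (trans (sym h) (+-comm a _)))
    ... | inj₂ (z , refl) = O , trans (*0 d) (sym (proj₁ (+≡0 {a} {d * S z} (+-cancelˡ (d * y)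
        (trans (collect d y (S z) a)
        (trans (cong (λ t → a + d * t) (trans (+S y z) (sym (+-sucˡ y z)))) (trans h (sym (+0 _)))))))))

  opaque
    -- If i ≠ j, the moduli at i and j have the combination ±(i - j), which divides b,
    -- and b is invertible modulo the modulus at j; hence the moduli are coprime.
    coprime : ∀ {n b} → Base n b → ∀ i j a → i < n → j < n → ¬ i ≡ j →
              Mem (modulus b i * a) b j → Mem a b j
    coprime {n} {b} (_ , H) i j a i<n j<n i≢j (r , hr) with i ≤? j
    ... | inj₁ l with ≤⇒<∨≡ l
    ...   | inj₂ e = ⊥-elim (i≢j e)
    ...   | inj₁ (z , eq) with H z (≤∧<⇒< (≤-trans (m≤n+m z (S i)) (≤-reflexive eq)) j<n)
    -- Here `S z` is `j - i` and `q` its cofactor in `b`. The factor `S j * q` in the combination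
    -- turns this difference into `S j * b`, the modulus at `j` less one.
    ...     | q , refl = divides-difference (modulus b j) (S j * q * S j * r) (a + S j * q * S i * a) a
        (trans (trans (pull₁ a (S j) q (modulus b j) r) (cong (λ w → a + S j * q * S j * w) hr)) (subst
          (λ jj → a + jj * q * jj * (modulus b i * a) ≡ S (jj * b) * (a + jj * q * S i * a)) Sj≡
          (trans (cong (λ w → a + (S i + S z) * q * (S i + S z) * (w * a)) (S≡ (S i * b)))
          (trans (combination₁ (S i) (S z) q a)
          (cong (_* (a + (S i + S z) * q * S i * a)) (sym (S≡ ((S i + S z) * b))))))))
      where
      Sj≡ : S i + S z ≡ S j
      Sj≡ = trans (+S (S i) z) (cong S eq)
    coprime {n} {b} (_ , H) i j a i<n j<n i≢j (r , hr) | inj₂ (z , eq)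
        with H z (≤∧<⇒< (≤-trans (m≤n+m z (S j)) (≤-reflexive eq)) i<n)
    ... | q , refl = divides-difference (modulus b j) (S j * q * S i * a) (a + S j * q * S j * r) a
        (trans (subst (λ ii → a + modulus b j * (S j * q * ii * a) ≡ modulus b j * a + S j * q * S j * (S (ii * b) * a)) Si≡
          (trans (cong (λ w → a + w * (S j * q * (S j + S z) * a)) (S≡ (S j * b)))
          (trans (combination₂ (S j) (S z) q a)
          (sym (cong₂ (λ w v → w * a + S j * q * S j * (v * a)) (S≡ (S j * b)) (S≡ ((S j + S z) * b)))))))
        (trans (cong (λ w → modulus b j * a + S j * q * S j * w) (sym hr))
          (pull₂ a (S j) q (modulus b j) r)))
      where
      Si≡ : S j + S z ≡ S i
      Si≡ = trans (+S (S j) z) (cong S eq)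

  opaque
    -- The code is the least nonzero number divisible by the moduli at all elements of `X`. If the
    -- modulus at some `i` outside `X` divided it as well, the quotient would by coprimality still
    -- be divisible by the others and be smaller. Minimality also gives the bound `m`, which does
    -- not depend on `X`; the descent to an initial segment rests on this.
    codeSet : ∀ {X : C → Set ℓ} → Def {1} (λ ρ → X (ρ zero)) → ∀ {n b m} → Base n b → CommonMultiple n b m →
              Σ C λ a → a ≤ m × (∀ i → i < n → Mem a b i ⟺ X i)
    codeSet {X} d {n} {b} {m} B (m≢0 , mm) = a , a≤m , λ i i<n → (λ h → dne (exact i i<n h)) , proj₂ aP i i<n
      where
      P : C → Set ℓ
      P a = ¬ a ≡ O × (∀ i → i < n → X i → Mem a b i)
      lst : Σ C (Least P)
      lst = least (dAnd (dNot (fVar ≐ fCst)) (dAll (dImp (fVar <̇ fCst) (dImp (dRen (λ _ → zero) d) (dMem fVar fCst fVar)))))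
        (m , m≢0 , λ i h _ → mm i h)
      a : C
      a = proj₁ lst
      aP : P a
      aP = proj₁ (proj₂ lst)
      a≤m : a ≤ m
      a≤m with a ≤? m
      ... | inj₁ l = l
      ... | inj₂ l = ⊥-elim (proj₂ (proj₂ lst) m l (m≢0 , λ i h _ → mm i h))
      exact : ∀ i → i < n → Mem a b i → ¬ ¬ X i
      exact i i<n (a' , eq) nX = proj₂ (proj₂ lst) a' a'<a (a'≢0 , mems)
        where
        a'≢0 : ¬ a' ≡ O
        a'≢0 refl = proj₁ aP (trans (sym eq) (*0 _))
        a'<a : a' < a
        a'<a with zero? ((S i * b) * a')
        ... | inj₁ z = ⊥-elim (*≢0 (*≢0 (S≢0 i) (proj₁ B)) a'≢0 z)
        ... | inj₂ (w , e) = w , trans (+-sucˡ a' w) (trans (sym (+S a' w)) (trans (cong (a' +_) (sym e))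
                (trans (+-comm a' _) (trans (sym (*-sucˡ (S i * b) a')) eq))))
        mems : ∀ j → j < n → X j → Mem a' b j
        mems j j<n x = coprime B i j a' i<n j<n (λ { refl → nX x }) (subst (λ w → Mem w b j) (sym eq) (proj₂ aP j j<n x))

-- Definable minimisation and coded sequences

module Sequences {ℓ} (M : Structure ℓ) (A : Arith M) where
  open Arithmetic M A

  private
    skip : ∀ {n} → Fin (suc n) → Fin (suc (suc n))
    skip zero    = zero
    skip (suc i) = suc (suc i)

  opaque
    dLeast : ∀ {n} {P : (Fin n → C) → C → Set ℓ} → Def {suc n} (λ ρ → P (λ i → ρ (suc i)) (ρ zero)) →
             Def {suc n} (λ ρ → Least (P (λ i → ρ (suc i))) (ρ zero))
    dLeast d = dAnd d (dAll (dImp (fVar <̇ fVar) (dNot (dRen skip d))))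

  -- Zero if P has no witness.
  opaque
    μ : (P : C → Set ℓ) → Def {1} (λ ρ → P (ρ zero)) → C
    μ P d with em {Σ C P}
    ... | yes s = proj₁ (least d s)
    ... | no _  = O

    μ-least : ∀ {P} (d : Def {1} (λ ρ → P (ρ zero))) → Σ C P → Least P (μ P d)
    μ-least {P} d s with em {Σ C P}
    ... | yes s' = proj₂ (least d s')
    ... | no n   = ⊥-elim (n s)

    μ-zero : ∀ {P} (d : Def {1} (λ ρ → P (ρ zero))) → ¬ Σ C P → μ P d ≡ O
    μ-zero {P} d n with em {Σ C P}
    ... | yes s = ⊥-elim (n s)
    ... | no _  = refl

  opaque
    fμ : ∀ {n} {P : (Fin n → C) → C → Set ℓ} {d : ∀ ρ → Def {1} (λ ρ' → P ρ (ρ' zero))} →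
         Def {suc n} (λ ρ → P (λ i → ρ (suc i)) (ρ zero)) → DF (λ ρ → μ (P ρ) (d ρ))
    fμ {n} {P} {d} e = df (dIff graph⟺
        (dOr (dLeast {P = P} e) (dAnd (dNot (dEx {Q = λ ρ a → P (λ i → ρ (suc i)) a} (dRen skip e))) (fVar ≐ fCst))))
      where
      graph⟺ : ∀ (ρ : Fin (suc n) → C) →
        (Least (P (λ i → ρ (suc i))) (ρ zero) ⊎ (¬ Σ C (P (λ i → ρ (suc i))) × ρ zero ≡ O)) ⟺
        (ρ zero ≡ μ (P (λ i → ρ (suc i))) (d (λ i → ρ (suc i))))
      proj₁ (graph⟺ ρ) (inj₁ l) = Least-unique l (μ-least (d _) (_ , proj₁ l))
      proj₁ (graph⟺ ρ) (inj₂ (n , e)) = trans e (sym (μ-zero (d _) n))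
      proj₂ (graph⟺ ρ) e with em {Σ C (P (λ i → ρ (suc i)))}
      ... | yes s = inj₁ (subst (Least _) (sym e) (μ-least (d _) s))
      ... | no n = inj₂ (n , trans e (μ-zero (d _) n))

  -- A sequence is coded by a finite set: its value at c is the least v such that J c v is in the set.
  Val : C → C → C → C → Set ℓ
  Val a b c = Least (λ v → Mem a b (J c v))

  opaque
    bounded-image : ∀ {w : C → C} → DF {1} (λ ρ → w (ρ zero)) → ∀ n → Σ C λ B → ∀ c → c < n → w c < B
    bounded-image {w} d = ind
      (dEx (dAll (dImp (fVar <̇ fVar) (fVar₀ <̇ fVar))))
      (O , λ c h → ⊥-elim (n≮0 h))
      λ n (B , f) → B + S (w n) , λ c h → step n B f c (<S⇒<∨≡ h)
      where
      fVar₀ : DF {3} (λ ρ → w (ρ zero))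
      fVar₀ = df (dRen (λ { zero → zero ; (suc _) → suc zero }) (graph d))
      step : ∀ n B → (∀ c → c < n → w c < B) → ∀ c → c < n ⊎ c ≡ n → w c < B + S (w n)
      step n B f c (inj₁ l) = ≤-trans (f c l) (m≤m+n B _)
      step n B f c (inj₂ refl) = m≤n+m _ B

    -- The set coded is the graph of `w` below `n`. A smaller candidate `J c v` still lies below the
    -- bound `B` up to which the code is exact, so by injectivity of `J` it is not in the set, and
    -- the least value read off at `c` is `w c`.
    codeSequence : ∀ {w : C → C} → DF {1} (λ ρ → w (ρ zero)) → ∀ n →
                   Σ C λ a → Σ C λ b → ∀ c → c < n → Val a b c (w c)
    codeSequence {w} d n = proj₁ code , b , λ c h →
        proj₂ (proj₂ (proj₂ code) (J c (w c)) (pairs c h)) (c , h , refl) , λ v l m → below c h v l m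
      where
      f2 : ∀ {m} {i : Fin m} → DF {m} (λ ρ → w (ρ i))
      f2 {i = i} = df (dRen (λ { zero → zero ; (suc _) → suc i }) (graph d))
      X : C → Set ℓ
      X p = Σ C λ c → c < n × p ≡ J c (w c)
      dX : Def {1} (λ ρ → X (ρ zero))
      dX = dEx (dAnd (fVar <̇ fCst) (fVar ≐ fJ fVar f2))
      B : Σ C λ B → ∀ c → c < n → J c (w c) < B
      B = bounded-image (fJ fVar f2) n
      b : C
      b = proj₁ (base (proj₁ B))
      code : Σ C λ a → a ≤ proj₁ (commonMultiple (proj₁ B) b) × (∀ p → p < proj₁ B → Mem a b p ⟺ X p)
      code = codeSet dX (proj₂ (base (proj₁ B))) (proj₂ (commonMultiple (proj₁ B) b))
      pairs : ∀ c → c < n → J c (w c) < proj₁ B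
      pairs = proj₂ B
      below : ∀ c → c < n → ∀ v → v < w c → ¬ Mem (proj₁ code) b (J c v)
      below c h v l m = collide (proj₁ (proj₂ (proj₂ code) (J c v) (<-trans (J-monoʳ-< c l) (pairs c h))) m)
        where
        collide : X (J c v) → ⊥
        collide (c' , _ , e) with J-inj e
        ... | refl , refl = <-irrefl l

-- Semantics of formulas and definability in models of PA

module Semantics {ℓ} (M : Structure ℓ) where

  evalT-ext : ∀ {n} {ρ ρ' : Fin n → Carrier M} → (∀ i → ρ i ≡ ρ' i) → ∀ t → evalT M ρ t ≡ evalT M ρ' t
  evalT-ext h (var i)  = h i
  evalT-ext h `0       = refl
  evalT-ext h (`S t)   = cong (sucᴹ M) (evalT-ext h t)
  evalT-ext h (t `+ s) = cong₂ (_+ᴹ_ M) (evalT-ext h t) (evalT-ext h s)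
  evalT-ext h (t `* s) = cong₂ (_*ᴹ_ M) (evalT-ext h t) (evalT-ext h s)

  evalT-ren : ∀ {n m} {ρ : Fin m → Carrier M} (r : Fin n → Fin m) t → evalT M ρ (renT r t) ≡ evalT M (λ i → ρ (r i)) t
  evalT-ren r (var i)  = refl
  evalT-ren r `0       = refl
  evalT-ren r (`S t)   = cong (sucᴹ M) (evalT-ren r t)
  evalT-ren r (t `+ s) = cong₂ (_+ᴹ_ M) (evalT-ren r t) (evalT-ren r s)
  evalT-ren r (t `* s) = cong₂ (_*ᴹ_ M) (evalT-ren r t) (evalT-ren r s)

  evalT-sub : ∀ {n m} {ρ : Fin m → Carrier M} (σ : Fin n → Term m) t →
              evalT M ρ (subT σ t) ≡ evalT M (λ i → evalT M ρ (σ i)) t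
  evalT-sub σ (var i)  = refl
  evalT-sub σ `0       = refl
  evalT-sub σ (`S t)   = cong (sucᴹ M) (evalT-sub σ t)
  evalT-sub σ (t `+ s) = cong₂ (_+ᴹ_ M) (evalT-sub σ t) (evalT-sub σ s)
  evalT-sub σ (t `* s) = cong₂ (_*ᴹ_ M) (evalT-sub σ t) (evalT-sub σ s)

  cons-ext : ∀ {n} {ρ ρ' : Fin n → Carrier M} a → (∀ i → ρ i ≡ ρ' i) → ∀ i → cons M a ρ i ≡ cons M a ρ' i
  cons-ext a h zero    = refl
  cons-ext a h (suc i) = h i

  Sat-sub : ∀ {n m} {ρ : Fin m → Carrier M} {ρ' : Fin n → Carrier M} (σ : Fin n → Term m) →
            (∀ i → evalT M ρ (σ i) ≡ ρ' i) → ∀ φ → Sat M ρ (subF σ φ) ⟺ Sat M ρ' φ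
  Sat-sub σ h `⊥       = (λ x → x) , λ x → x
  Sat-sub σ h (t `≐ s) = (λ e → trans (sym (lem t)) (trans e (lem s))) , λ e → trans (lem t) (trans e (sym (lem s)))
    where lem = λ t → trans (evalT-sub σ t) (evalT-ext h t)
  Sat-sub σ h (φ `⇒ ψ) = (λ f x → proj₁ (Sat-sub σ h ψ) (f (proj₂ (Sat-sub σ h φ) x))) ,
                         λ f x → proj₂ (Sat-sub σ h ψ) (f (proj₁ (Sat-sub σ h φ) x))
  Sat-sub {ρ = ρ} {ρ'} σ h (`∀ φ) =
      (λ f a → proj₁ (Sat-sub (extS σ) (h' a) φ) (f a)) , λ f a → proj₂ (Sat-sub (extS σ) (h' a) φ) (f a)
    where
    h' : ∀ a i → evalT M (cons M a ρ) (extS σ i) ≡ cons M a ρ' i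
    h' a zero    = refl
    h' a (suc i) = trans (evalT-ren suc (σ i)) (h i)

  Sat-ext : ∀ {n} {ρ ρ' : Fin n → Carrier M} → (∀ i → ρ i ≡ ρ' i) → ∀ φ → Sat M ρ φ → Sat M ρ' φ
  Sat-ext h `⊥ x = x
  Sat-ext h (t `≐ s) e = trans (sym (evalT-ext h t)) (trans e (evalT-ext h s))
  Sat-ext h (φ `⇒ ψ) f x = Sat-ext h ψ (f (Sat-ext (λ i → sym (h i)) φ x))
  Sat-ext h (`∀ φ) f a = Sat-ext (cons-ext a h) φ (f a)

  ∀*-elim : ∀ {n} (φ : Formula n) → M ⊨ ∀* φ → ∀ ρ → Sat M ρ φ
  ∀*-elim {zero}  φ s ρ = Sat-ext (λ ()) φ s
  ∀*-elim {suc n} φ s ρ = Sat-ext (λ { zero → refl ; (suc i) → refl }) φ (∀*-elim (`∀ φ) s (λ i → ρ (suc i)) (ρ zero))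

join : ∀ {a} {A : Set a} {n p} → (Fin n → A) → (Fin p → A) → Fin (n ℕ.+ p) → A
join {n = zero}  ρ c i       = c i
join {n = suc n} ρ c zero    = ρ zero
join {n = suc n} ρ c (suc i) = join (λ i → ρ (suc i)) c i

join-↑ˡ : ∀ {a} {A : Set a} {n p} (ρ : Fin n → A) (c : Fin p → A) i → join ρ c (i ↑ˡ p) ≡ ρ i
join-↑ˡ ρ c zero    = refl
join-↑ˡ ρ c (suc i) = join-↑ˡ (λ i → ρ (suc i)) c i

join-↑ʳ : ∀ {a} {A : Set a} {n p} (ρ : Fin n → A) (c : Fin p → A) j → join ρ c (n ↑ʳ j) ≡ c j
join-↑ʳ {n = zero}  ρ c j = refl
join-↑ʳ {n = suc n} ρ c j = join-↑ʳ (λ i → ρ (suc i)) c j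

join-map : ∀ {a b} {A : Set a} {B : Set b} (f : A → B) {n p} {ρ : Fin n → A} {c : Fin p → A} {ρ' : Fin n → B} {c' : Fin p → B} →
           (∀ i → f (ρ i) ≡ ρ' i) → (∀ j → f (c j) ≡ c' j) → ∀ k → f (join ρ c k) ≡ join ρ' c' k
join-map f {n = zero}  g h k       = h k
join-map f {n = suc n} g h zero    = g zero
join-map f {n = suc n} g h (suc k) = join-map f (λ i → g (suc i)) h k

module Definability {ℓ} (M : Structure ℓ) where
  open Semantics M

  record Definable {n} (P : (Fin n → Carrier M) → Set ℓ) : Set ℓ where
    constructor definable
    field
      {arity} : ℕ
      params  : Fin arity → Carrier M
      formula : Formula (n ℕ.+ arity)
      correct : ∀ ρ → P ρ ⟺ Sat M (join ρ params) formula
  open Definable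

  reindex : ∀ {n p m q} {ρ : Fin n → Carrier M} {c : Fin p → Carrier M} {ρ' : Fin m → Carrier M} {c' : Fin q → Carrier M}
            (f : Fin n → Fin (m ℕ.+ q)) (g : Fin p → Fin (m ℕ.+ q)) →
            (∀ i → join ρ' c' (f i) ≡ ρ i) → (∀ j → join ρ' c' (g j) ≡ c j) → ∀ φ →
            Sat M (join ρ' c') (subF (λ k → var (join f g k)) φ) ⟺ Sat M (join ρ c) φ
  reindex {ρ' = ρ'} {c'} f g hf hg = Sat-sub _ (join-map (join ρ' c') hf hg)

  ren : ∀ {n m} {P : (Fin n → Carrier M) → Set ℓ} (r : Fin n → Fin m) → Definable P → Definable (λ ρ → P (λ i → ρ (r i)))
  ren {n} {m} r (definable {p} c φ h) = definable c (subF (λ k → var (join (λ i → r i ↑ˡ p) (λ j → m ↑ʳ j) k)) φ)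
    λ ρ → let e = reindex {ρ = λ i → ρ (r i)} {c = c} {ρ' = ρ} {c' = c} (λ i → r i ↑ˡ p) (λ j → m ↑ʳ j) (λ i → join-↑ˡ ρ c (r i)) (join-↑ʳ ρ c) φ
          in (λ x → proj₂ e (proj₁ (h _) x)) , λ y → proj₂ (h _) (proj₁ e y)

  imp : ∀ {n} {P Q : (Fin n → Carrier M) → Set ℓ} → Definable P → Definable Q → Definable (λ ρ → P ρ → Q ρ)
  imp {n} (definable {p} c φ h) (definable {q} d ψ k) =
    definable (join c d)
      (subF (λ k → var (join {n = n} {p} (λ i → i ↑ˡ (p ℕ.+ q)) (λ j → n ↑ʳ (j ↑ˡ q)) k)) φ `⇒
       subF (λ k → var (join {n = n} {q} (λ i → i ↑ˡ (p ℕ.+ q)) (λ j → n ↑ʳ (p ↑ʳ j)) k)) ψ)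
      λ ρ → let
          e₁ = reindex {n = n} {p} {ρ = ρ} {c = c} {ρ' = ρ} {c' = join c d} (λ i → i ↑ˡ (p ℕ.+ q)) (λ j → n ↑ʳ (j ↑ˡ q)) (join-↑ˡ ρ (join c d))
                 (λ j → trans (join-↑ʳ ρ (join c d) (j ↑ˡ q)) (join-↑ˡ c d j)) φ
          e₂ = reindex {n = n} {q} {ρ = ρ} {c = d} {ρ' = ρ} {c' = join c d} (λ i → i ↑ˡ (p ℕ.+ q)) (λ j → n ↑ʳ (p ↑ʳ j)) (join-↑ˡ ρ (join c d))
                 (λ j → trans (join-↑ʳ ρ (join c d) (p ↑ʳ j)) (join-↑ʳ c d j)) ψ
        in (λ f x → proj₂ e₂ (proj₁ (k ρ) (f (proj₂ (h ρ) (proj₁ e₁ x))))) ,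
           λ f x → proj₂ (k ρ) (proj₁ e₂ (f (proj₂ e₁ (proj₁ (h ρ) x))))

  uni : ∀ {n} {Q : (Fin n → Carrier M) → Carrier M → Set ℓ} →
        Definable {suc n} (λ ρ → Q (λ i → ρ (suc i)) (ρ zero)) → Definable (λ ρ → ∀ a → Q ρ a)
  uni {n} {Q} (definable {p} c φ h) = definable c (`∀ φ)
    λ ρ → (λ f a → Sat-ext (eq ρ a) φ (proj₁ (h (cons M a ρ)) (f a))) ,
          λ f a → proj₂ (h (cons M a ρ)) (Sat-ext (λ i → sym (eq ρ a i)) φ (f a))
    where
    eq : ∀ ρ a (i : Fin (suc n ℕ.+ p)) → join {n = suc n} (cons M a ρ) c i ≡ cons M a (join ρ c) i
    eq ρ a zero    = refl
    eq ρ a (suc i) = refl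

  iff : ∀ {n} {P Q : (Fin n → Carrier M) → Set ℓ} → (∀ ρ → P ρ ⟺ Q ρ) → Definable P → Definable Q
  iff g (definable c φ h) = definable c φ λ ρ →
    (λ q → proj₁ (h ρ) (proj₂ (g ρ) q)) , λ s → proj₁ (g ρ) (proj₂ (h ρ) s)

  equation : ∀ {n} (t s : Term n) → Definable (λ ρ → evalT M ρ t ≡ evalT M ρ s)
  equation {n} t s = definable {arity = 0} (λ ()) (subF (λ i → var (i ↑ˡ 0)) (t `≐ s)) λ ρ →
    let e = Sat-sub {ρ = join ρ (λ ())} {ρ} (λ i → var (i ↑ˡ 0)) (join-↑ˡ ρ (λ ())) (t `≐ s) in proj₂ e , proj₁ e

  satisfaction : ∀ {n} (φ : Formula n) → Definable (λ ρ → Sat M ρ φ)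
  satisfaction φ = definable {arity = 0} (λ ()) (subF (λ i → var (i ↑ˡ 0)) φ) λ ρ →
    let e = Sat-sub {ρ = join ρ (λ ())} {ρ} (λ i → var (i ↑ˡ 0)) (join-↑ˡ ρ (λ ())) φ in proj₂ e , proj₁ e

  constant : ∀ {n} (i : Fin n) c → Definable (λ ρ → ρ i ≡ c)
  constant {n} i c = definable {arity = 1} (λ _ → c) (var (i ↑ˡ 1) `≐ var (n ↑ʳ zero)) λ ρ →
    (λ e → trans (join-↑ˡ ρ _ i) (trans e (sym (join-↑ʳ ρ _ zero)))) ,
    λ e → trans (sym (join-↑ˡ ρ _ i)) (trans e (join-↑ʳ ρ _ zero))

  arith : ExcludedMiddle ℓ → (∀ σ → PA σ → M ⊨ σ) → Arith M
  arith em pa = record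
    { em = em ; Def = Definable ; dIff = iff ; dRen = ren
    ; d⊥ = definable {arity = 0} (λ ()) `⊥ λ ρ → (λ x → x) , λ x → x
    ; dImp = imp ; dAll = uni
    ; dVar = λ i j → equation (var i) (var j)
    ; dCst = constant
    ; dSuc = λ i j → equation (var i) (`S (var j))
    ; dAdd = λ i j k → equation (var i) (var j `+ var k)
    ; dMul = λ i j k → equation (var i) (var j `* var k)
    ; S≢0 = λ a e → lower (pa _ ax-S≢0 a e)
    ; Sinj = pa _ ax-Sinj
    ; +0 = pa _ ax-+0 ; +S = pa _ ax-+S ; *0 = pa _ ax-*0 ; *S = pa _ ax-*S
    ; ind = induction }
    where
    induction : {P : Carrier M → Set ℓ} → Definable {1} (λ ρ → P (ρ zero)) →
                P (zeroᴹ M) → (∀ a → P a → P (sucᴹ M a)) → ∀ a → P a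
    -- The parameters take the places of the variables closed off by `∀*`, so the axiom for the bare
    -- formula yields induction with parameters.
    induction {P} (definable {p} c φ h) z s a = from (∀*-elim _ (pa _ (ax-ind φ)) c
        (proj₂ (Sat-sub atZero at0 φ) (to z))
        (λ b x → proj₂ (Sat-sub atSucc (atS b) φ) (to (s b (from x)))) a)
      where
      at0 : ∀ i → evalT M c (atZero i) ≡ cons M (zeroᴹ M) c i
      at0 zero    = refl
      at0 (suc i) = refl
      atS : ∀ b i → evalT M (cons M b c) (atSucc i) ≡ cons M (sucᴹ M b) c i
      atS b zero    = refl
      atS b (suc i) = refl
      eq : ∀ b (i : Fin (suc p)) → join {n = 1} (λ _ → b) c i ≡ cons M b c i
      eq b zero    = refl
      eq b (suc i) = refl
      to : ∀ {b} → P b → Sat M (cons M b c) φ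
      to {b} x = Sat-ext (eq b) φ (proj₁ (h (λ _ → b)) x)
      from : ∀ {b} → Sat M (cons M b c) φ → P b
      from {b} x = proj₂ (h (λ _ → b)) (Sat-ext (λ i → sym (eq b i)) φ x)

-- The arguments are swapped since the axioms recurse on the second argument and the operations on
-- `ℕ` on the first; in this form the recursion equations hold by computation.
ℕˢ : Structure lzero
ℕˢ = record { Carrier = ℕ ; zeroᴹ = 0 ; sucᴹ = suc ; _+ᴹ_ = λ a b → b ℕ.+ a ; _*ᴹ_ = λ a b → b ℕ.* a }

-- As every predicate counts as definable, the coding lemmas apply to arbitrary functions on ℕ.
ℕ-arith : ExcludedMiddle lzero → Arith ℕˢ
ℕ-arith em = record
  { em = em ; Def = λ _ → ⊤ ; dIff = λ _ _ → tt ; dRen = λ _ _ → tt ; d⊥ = tt ; dImp = λ _ _ → tt ; dAll = λ _ → tt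
  ; dVar = λ _ _ → tt ; dCst = λ _ _ → tt ; dSuc = λ _ _ → tt ; dAdd = λ _ _ _ → tt ; dMul = λ _ _ _ → tt
  ; S≢0 = λ _ () ; Sinj = λ _ _ → ℕP.suc-injective
  ; +0 = λ _ → refl ; +S = λ _ _ → refl ; *0 = λ _ → refl ; *S = λ _ _ → refl
  ; ind = induction }
  where
  induction : {P : ℕ → Set} → ⊤ → P 0 → (∀ a → P a → P (suc a)) → ∀ a → P a
  induction d z s zero    = z
  induction d z s (suc a) = s a (induction d z s a)

-- Bounded formulas

-- `app` is a delayed substitution: semantically it composes environments, and it is carried out
-- only in the translation to formulas. Large bounded formulas can thus be assembled from named
-- pieces.
data Δ₀ : ℕ → Set where
  eq   : ∀ {n} → Term n → Term n → Δ₀ n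
  _∧̂_  : ∀ {n} → Δ₀ n → Δ₀ n → Δ₀ n
  neg  : ∀ {n} → Δ₀ n → Δ₀ n
  ball : ∀ {n} → Term n → Δ₀ (suc n) → Δ₀ n
  bex  : ∀ {n} → Term n → Δ₀ (suc n) → Δ₀ n
  app  : ∀ {n k} → Δ₀ k → (Fin k → Term n) → Δ₀ n

infixr 6 _∧̂_

_`<_ : ∀ {n} → Term n → Term n → Formula n
t `< s = `¬ (`∀ (`¬ ((`S (renT suc t) `+ var zero) `≐ renT suc s)))

toFormula : ∀ {n} → Δ₀ n → Formula n
toFormula (eq t s)   = t `≐ s
toFormula (φ ∧̂ ψ)    = `¬ (toFormula φ `⇒ `¬ (toFormula ψ))
toFormula (neg φ)    = `¬ (toFormula φ)
toFormula (ball t φ) = `∀ (var zero `< renT suc t `⇒ toFormula φ)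
toFormula (bex t φ)  = `¬ (`∀ (var zero `< renT suc t `⇒ `¬ (toFormula φ)))
toFormula (app φ σ)  = subF σ (toFormula φ)

module Bounded {ℓ} (M : Structure ℓ) (A : Arith M) where
  open Arithmetic M A
  open Semantics M

  ⟦_⟧ : ∀ {n} → Δ₀ n → (Fin n → C) → Set ℓ
  ⟦ eq t s ⟧ ρ   = evalT M ρ t ≡ evalT M ρ s
  ⟦ φ ∧̂ ψ ⟧ ρ    = ⟦ φ ⟧ ρ × ⟦ ψ ⟧ ρ
  ⟦ neg φ ⟧ ρ    = ¬ ⟦ φ ⟧ ρ
  ⟦ ball t φ ⟧ ρ = ∀ a → a < evalT M ρ t → ⟦ φ ⟧ (cons M a ρ)
  ⟦ bex t φ ⟧ ρ  = Σ C λ a → a < evalT M ρ t × ⟦ φ ⟧ (cons M a ρ)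
  ⟦ app φ σ ⟧ ρ  = ⟦ φ ⟧ (λ i → evalT M ρ (σ i))

  Sat-< : ∀ {n} {ρ : Fin n → C} (t s : Term n) → Sat M ρ (t `< s) ⟺ (evalT M ρ t < evalT M ρ s)
  Sat-< {ρ = ρ} t s =
    (λ f → dne λ n → lower (f λ z e → lift (n (z , trans (cong (λ x → S x + z) (sym (evalT-ren suc t))) (trans e (evalT-ren suc s)))))) ,
    λ { (z , e) f → f z (trans (cong (λ x → S x + z) (evalT-ren suc t)) (trans e (sym (evalT-ren suc s)))) }

  toFormula-correct : ∀ {n} (φ : Δ₀ n) ρ → Sat M ρ (toFormula φ) ⟺ ⟦ φ ⟧ ρ
  toFormula-correct (eq t s) ρ = (λ x → x) , λ x → x
  toFormula-correct (φ ∧̂ ψ) ρ =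
    (λ f → dne λ n → lower (f λ a b → lift (n (proj₁ (toFormula-correct φ ρ) a , proj₁ (toFormula-correct ψ ρ) b)))) ,
    λ { (a , b) f → f (proj₂ (toFormula-correct φ ρ) a) (proj₂ (toFormula-correct ψ ρ) b) }
  toFormula-correct (neg φ) ρ =
    (λ f a → lower (f (proj₂ (toFormula-correct φ ρ) a))) , λ f a → lift (f (proj₁ (toFormula-correct φ ρ) a))
  toFormula-correct (ball t φ) ρ =
    (λ f a l → proj₁ (toFormula-correct φ _) (f a (proj₂ (Sat-< (var zero) (renT suc t)) (subst (a <_) (sym (evalT-ren suc t)) l)))) ,
    λ f a l → proj₂ (toFormula-correct φ _) (f a (subst (a <_) (evalT-ren suc t) (proj₁ (Sat-< (var zero) (renT suc t)) l)))
  toFormula-correct (bex t φ) ρ =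
    (λ f → dne λ n → lower (f λ a l s → lift (n (a , subst (a <_) (evalT-ren suc t) (proj₁ (Sat-< (var zero) (renT suc t)) l) ,
                                                  proj₁ (toFormula-correct φ _) s)))) ,
    λ { (a , l , s) f → f a (proj₂ (Sat-< (var zero) (renT suc t)) (subst (a <_) (sym (evalT-ren suc t)) l)) (proj₂ (toFormula-correct φ _) s) }
  toFormula-correct (app φ σ) ρ =
    (λ s → proj₁ (toFormula-correct φ _) (proj₁ (Sat-sub σ (λ _ → refl) (toFormula φ)) s)) ,
    λ s → proj₂ (Sat-sub σ (λ _ → refl) (toFormula φ)) (proj₂ (toFormula-correct φ _) s)

  ⟦⟧-ext : ∀ {n} (φ : Δ₀ n) {ρ ρ' : Fin n → C} → (∀ i → ρ i ≡ ρ' i) → ⟦ φ ⟧ ρ → ⟦ φ ⟧ ρ'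
  ⟦⟧-ext φ h s = proj₁ (toFormula-correct φ _) (Sat-ext h (toFormula φ) (proj₂ (toFormula-correct φ _) s))

-- Numerals and absoluteness of bounded formulas

module Numerals {ℓ} (M : Structure ℓ) (A : Arith M) (em₀ : ExcludedMiddle lzero) where
  open Arithmetic M A
  open Bounded M A
  module N = Arithmetic ℕˢ (ℕ-arith em₀)
  module NB = Bounded ℕˢ (ℕ-arith em₀)

  num : ℕ → C
  num zero    = O
  num (suc k) = S (num k)

  opaque
    num-+ : ∀ a b → num (a N.+ b) ≡ num a + num b
    num-+ a zero    = sym (+0 _)
    num-+ a (suc b) = trans (cong S (num-+ a b)) (sym (+S _ _))

    num-* : ∀ a b → num (a N.* b) ≡ num a * num b
    num-* a zero    = sym (*0 _)
    num-* a (suc b) = trans (num-+ (a N.* b) a) (trans (cong (_+ num a) (num-* a b)) (sym (*S _ _)))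

    num-inj : ∀ {a b} → num a ≡ num b → a ≡ b
    num-inj {zero}  {zero}  e = refl
    num-inj {zero}  {suc b} e = ⊥-elim (S≢0 _ (sym e))
    num-inj {suc a} {zero}  e = ⊥-elim (S≢0 _ e)
    num-inj {suc a} {suc b} e = cong suc (num-inj (Sinj _ _ e))

    num-≤ : ∀ {a b} → a N.≤ b → num a ≤ num b
    num-≤ {a} (z , refl) = num z , sym (num-+ a z)

    num-below : ∀ k {a} → a < num k → Σ ℕ λ j → a ≡ num j × j N.< k
    num-below zero h = ⊥-elim (n≮0 h)
    num-below (suc k) h with <S⇒<∨≡ h
    ... | inj₂ e = k , e , N.n<Sn
    ... | inj₁ l with num-below k l
    ...   | j , e , l' = j , e , N.<-trans l' N.n<Sn

    num-≤⁻¹ : ∀ {a b} → num a ≤ num b → a N.≤ b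
    num-≤⁻¹ {a} {b} h with a N.≤? b
    ... | inj₁ l = l
    ... | inj₂ l = ⊥-elim (<-irrefl (≤-trans (num-≤ l) h))

    evalT-num : ∀ {n} {ρ : Fin n → ℕ} {ρ' : Fin n → C} → (∀ i → ρ' i ≡ num (ρ i)) → ∀ t → evalT M ρ' t ≡ num (evalT ℕˢ ρ t)
    evalT-num h (var i)  = h i
    evalT-num h `0       = refl
    evalT-num h (`S t)   = cong S (evalT-num h t)
    evalT-num {ρ = ρ} h (t `+ s) = trans (cong₂ _+_ (evalT-num h t) (evalT-num h s)) (sym (num-+ (evalT ℕˢ ρ t) (evalT ℕˢ ρ s)))
    evalT-num {ρ = ρ} h (t `* s) = trans (cong₂ _*_ (evalT-num h t) (evalT-num h s)) (sym (num-* (evalT ℕˢ ρ t) (evalT ℕˢ ρ s)))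

    cons-num : ∀ {n} {ρ : Fin n → ℕ} {ρ' : Fin n → C} {a k} → a ≡ num k → (∀ i → ρ' i ≡ num (ρ i)) →
               ∀ i → cons M a ρ' i ≡ num (cons ℕˢ k ρ i)
    cons-num e h zero    = e
    cons-num e h (suc i) = h i

    -- The standard numbers form an initial segment, so bounded quantifiers range over standard numbers only.
    absolute : ∀ {n} (φ : Δ₀ n) {ρ : Fin n → ℕ} {ρ' : Fin n → C} → (∀ i → ρ' i ≡ num (ρ i)) → NB.⟦ φ ⟧ ρ ⟺ ⟦ φ ⟧ ρ'
    absolute (eq t s) h =
      (λ e → trans (evalT-num h t) (trans (cong num e) (sym (evalT-num h s)))) ,
      λ e → num-inj (trans (sym (evalT-num h t)) (trans e (evalT-num h s)))
    absolute (φ ∧̂ ψ) h =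
      (λ { (a , b) → proj₁ (absolute φ h) a , proj₁ (absolute ψ h) b }) ,
      λ { (a , b) → proj₂ (absolute φ h) a , proj₂ (absolute ψ h) b }
    absolute (neg φ) h = (λ n a → n (proj₂ (absolute φ h) a)) , λ n a → n (proj₁ (absolute φ h) a)
    proj₁ (absolute (ball t φ) h) f a l with num-below _ (subst (a <_) (evalT-num h t) l)
    ... | k , e , l' = proj₁ (absolute φ (cons-num e h)) (f k l')
    proj₂ (absolute (ball t φ) h) f k l =
      proj₂ (absolute φ (cons-num refl h)) (f (num k) (subst (num k <_) (sym (evalT-num h t)) (num-≤ l)))
    proj₁ (absolute (bex t φ) h) (k , l , s) =
      num k , subst (num k <_) (sym (evalT-num h t)) (num-≤ l) , proj₁ (absolute φ (cons-num refl h)) s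
    proj₂ (absolute (bex t φ) h) (a , l , s) with num-below _ (subst (a <_) (evalT-num h t) l)
    ... | k , e , l' = k , l' , proj₂ (absolute φ (cons-num e h)) s
    absolute (app φ σ) h = absolute φ (λ i → evalT-num h (σ i))

-- In graphΔ, variable 0 bounds all quantifiers, variable 1 is the output and the others are the inputs.

bexs : ∀ m {n} → Fin n → Δ₀ (m ℕ.+ n) → Δ₀ n
bexs zero    w φ = φ
bexs (suc m) w φ = bexs m w (bex (var (m ↑ʳ w)) φ)

args : ∀ {k n} → Term k → Term k → (Fin n → Term k) → Fin (suc (suc n)) → Term k
args w y xs zero          = w
args w y xs (suc zero)    = y
args w y xs (suc (suc i)) = xs i

_◂_ : ∀ {k n} → Term k → (Fin n → Term k) → Fin (suc n) → Term k
(t ◂ ts) zero    = t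
(t ◂ ts) (suc i) = ts i
infixr 5 _◂_

∅ : ∀ {a} {A : Set a} → Fin 0 → A
∅ ()

`Jᵗ : ∀ {n} → Term n → Term n → Term n
`Jᵗ t s = ((t `+ s) `* (t `+ s)) `+ s

pattern #0 = var zero
pattern #1 = var (suc zero)
pattern #2 = var (suc (suc zero))
pattern #3 = var (suc (suc (suc zero)))
pattern #4 = var (suc (suc (suc (suc zero))))
pattern #5 = var (suc (suc (suc (suc (suc zero)))))
pattern #6 = var (suc (suc (suc (suc (suc (suc zero))))))
pattern #7 = var (suc (suc (suc (suc (suc (suc (suc zero)))))))

-- A modulus is positive, so a quotient of `a` is at most `a`, and the strict bound `S a` loses no
-- witness.
memΔ : Δ₀ 3
memΔ = bex (`S #0) (eq (`S (`S #3 `* #2) `* #0) #1)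

valΔ : Δ₀ 4
valΔ = app memΔ (#0 ◂ #1 ◂ `Jᵗ #2 #3 ◂ ∅) ∧̂
       ball #3 (neg (app memΔ (#1 ◂ #2 ◂ `Jᵗ #3 #0 ◂ ∅)))

mutual
  graphΔ : ∀ {n} → PR n → Δ₀ (suc (suc n))
  graphΔ zer              = eq #1 `0
  graphΔ succ             = eq #1 (`S #2)
  graphΔ (proj i)         = eq #1 (var (suc (suc i)))
  graphΔ (comp {n} {m} f gs) = bexs m zero
    (graphsΔ gs (var (m ↑ʳ zero)) (λ i → var (i ↑ˡ suc (suc n))) (λ i → var (m ↑ʳ suc (suc i))) ∧̂
     app (graphΔ f) (args (var (m ↑ʳ zero)) (var (m ↑ʳ suc zero)) (λ i → var (i ↑ˡ suc (suc n)))))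
  -- inside the two quantifiers: 0 = b, 1 = a, 2 = bound, 3 = output, 4 = recursion argument
  graphΔ (prec g h) = bex #0 (bex #1 (
    bex #2 (app valΔ (#2 ◂ #1 ◂ `0 ◂ #0 ◂ ∅) ∧̂
            app (graphΔ g) (args #3 #0 (λ i → var (suc (suc (suc (suc (suc (suc i)))))))))
    ∧̂ ball #4 (bex #3 (bex #4 (
         app valΔ (#4 ◂ #3 ◂ #2 ◂ #1 ◂ ∅) ∧̂ app valΔ (#4 ◂ #3 ◂ `S #2 ◂ #0 ◂ ∅) ∧̂
         app (graphΔ h) (args #5 #0 (#2 ◂ #1 ◂ λ i → var (suc (suc (suc (suc (suc (suc (suc (suc i)))))))))))))
    ∧̂ app valΔ (#1 ◂ #0 ◂ #4 ◂ #3 ◂ ∅)))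
  graphΔ (mu f) =
    ball #1 (bex #1 (app (graphΔ f) (args #2 (`S #0) (#1 ◂ λ i → var (suc (suc (suc (suc i)))))))) ∧̂
    app (graphΔ f) (args #0 `0 (#1 ◂ λ i → var (suc (suc i))))

  graphsΔ : ∀ {n m k} → Vec (PR n) m → Term k → (Fin m → Term k) → (Fin n → Term k) → Δ₀ k
  graphsΔ []       w ys xs = eq `0 `0
  graphsΔ (g ∷ gs) w ys xs = app (graphΔ g) (args w (ys zero) xs) ∧̂ graphsΔ gs w (λ i → ys (suc i)) xs

-- Representation of partial recursive functions

module Representation (em₀ : ExcludedMiddle lzero) where
  open Arithmetic ℕˢ (ℕ-arith em₀)
  open Sequences ℕˢ (ℕ-arith em₀)
  open Bounded ℕˢ (ℕ-arith em₀)
  open Semantics ℕˢ using (cons-ext)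

  opaque
    ℕ<⇒< : ∀ {a b} → a ℕ.< b → a < b
    ℕ<⇒< {a} {b} h = b ℕ.∸ suc a , ℕP.m∸n+n≡m h

    <⇒ℕ< : ∀ {a b} → a < b → a ℕ.< b
    <⇒ℕ< {a} (z , refl) = ℕP.m≤n+m (suc a) z

    memΔ-correct : ∀ {n} {ρ : Fin n → ℕ} (t s u : Term n) →
                   ⟦ app memΔ (t ◂ s ◂ u ◂ ∅) ⟧ ρ ⟺ Mem (evalT ℕˢ ρ t) (evalT ℕˢ ρ s) (evalT ℕˢ ρ u)
    memΔ-correct {ρ = ρ} t s u = (λ { (q , _ , e) → q , e }) ,
      λ { (q , e) → q , s≤s (≤-trans (≤-trans (m≤n+m q (S (evalT ℕˢ ρ u) * evalT ℕˢ ρ s * q))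
                     (≤-reflexive (sym (*-sucˡ (S (evalT ℕˢ ρ u) * evalT ℕˢ ρ s) q)))) (≤-reflexive e)) , e }

    valΔ-correct : ∀ {n} {ρ : Fin n → ℕ} (t s u v : Term n) →
                   ⟦ app valΔ (t ◂ s ◂ u ◂ v ◂ ∅) ⟧ ρ ⟺ Val (evalT ℕˢ ρ t) (evalT ℕˢ ρ s) (evalT ℕˢ ρ u) (evalT ℕˢ ρ v)
    valΔ-correct {ρ = ρ} t s u v =
      (λ { (m , f) → proj₁ outer m , λ x l n → f x l (proj₂ (inner x) n) }) ,
      λ { (m , f) → proj₂ outer m , λ x l n → f x l (proj₁ (inner x) n) }
      where
      ρ' : Fin 4 → ℕ
      ρ' i = evalT ℕˢ ρ ((t ◂ s ◂ u ◂ v ◂ ∅) i)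
      outer : ⟦ app memΔ (#0 ◂ #1 ◂ `Jᵗ #2 #3 ◂ ∅) ⟧ ρ' ⟺ Mem (ρ' zero) (ρ' (suc zero)) (J (ρ' (suc (suc zero))) (ρ' (suc (suc (suc zero)))))
      outer = subst (λ p → ⟦ app memΔ (#0 ◂ #1 ◂ `Jᵗ #2 #3 ◂ ∅) ⟧ ρ' ⟺ Mem (ρ' zero) (ρ' (suc zero)) p)
        (sym (J≡ (ρ' (suc (suc zero))) (ρ' (suc (suc (suc zero)))))) (memΔ-correct {ρ = ρ'} #0 #1 (`Jᵗ #2 #3))
      inner : ∀ x → ⟦ app memΔ (#1 ◂ #2 ◂ `Jᵗ #3 #0 ◂ ∅) ⟧ (cons ℕˢ x ρ') ⟺ Mem (ρ' zero) (ρ' (suc zero)) (J (ρ' (suc (suc zero))) x)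
      inner x = subst (λ p → ⟦ app memΔ (#1 ◂ #2 ◂ `Jᵗ #3 #0 ◂ ∅) ⟧ (cons ℕˢ x ρ') ⟺ Mem (ρ' zero) (ρ' (suc zero)) p)
        (sym (J≡ (ρ' (suc (suc zero))) x)) (memΔ-correct {ρ = cons ℕˢ x ρ'} #1 #2 (`Jᵗ #3 #0))

    bexs-correct : ∀ m {n} (w : Fin n) φ ρ → ⟦ bexs m w φ ⟧ ρ ⟺ (Σ (Fin m → ℕ) λ ys → (∀ i → ys i < ρ w) × ⟦ φ ⟧ (join ys ρ))
    bexs-correct zero w φ ρ = (λ s → (λ ()) , (λ ()) , s) , λ { (ys , _ , s) → ⟦⟧-ext φ (λ i → refl) s }
    proj₁ (bexs-correct (suc m) w φ ρ) s with proj₁ (bexs-correct m w _ ρ) s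
    ... | ys , h , a , l , t = cons ℕˢ a ys , (λ { zero → subst (a <_) (join-↑ʳ ys ρ w) l ; (suc i) → h i }) ,
          ⟦⟧-ext φ (λ { zero → refl ; (suc i) → refl }) t
    proj₂ (bexs-correct (suc m) w φ ρ) (ys , h , t) = proj₂ (bexs-correct m w _ ρ)
      ((λ i → ys (suc i)) , (λ i → h (suc i)) , ys zero , subst (ys zero <_) (sym (join-↑ʳ (λ i → ys (suc i)) ρ w)) (h zero) ,
       ⟦⟧-ext φ (λ { zero → refl ; (suc i) → refl }) t)

  inputs : ∀ {n} → (Fin (suc (suc n)) → ℕ) → Vec ℕ n
  inputs ρ = tabulate λ i → ρ (suc (suc i))

  mutual
    graphΔ-sound : ∀ {n} (f : PR n) ρ → ⟦ graphΔ f ⟧ ρ → f [ inputs ρ ]⇓ ρ (suc zero)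
    graphΔ-sound zer ρ s = subst (zer [ inputs ρ ]⇓_) (sym s) ev-zer
    graphΔ-sound succ ρ s = subst (succ [ inputs ρ ]⇓_) (sym s) ev-succ
    graphΔ-sound (proj i) ρ s = subst (proj i [ inputs ρ ]⇓_)
      (trans (lookup∘tabulate (λ i → ρ (suc (suc i))) i) (sym s)) (ev-proj i)
    graphΔ-sound (comp {n} {m} f gs) ρ s with proj₁ (bexs-correct m zero _ ρ) s
    ... | ys , _ , t , u = ev-comp {ys = tabulate (λ i → join ys ρ (i ↑ˡ suc (suc n)))}
      (subst (λ xs → gs [ xs ]⇓* tabulate (λ i → join ys ρ (i ↑ˡ suc (suc n))))
         (tabulate-cong (λ i → join-↑ʳ ys ρ (suc (suc i)))) (graphsΔ-sound gs _ _ _ _ t))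
      (subst (f [ tabulate (λ i → join ys ρ (i ↑ˡ suc (suc n))) ]⇓_) (join-↑ʳ ys ρ (suc zero)) (graphΔ-sound f _ u))
    graphΔ-sound (prec g h) ρ (a , _ , b , _ , (r , _ , v₀' , s₀) , step , vy) =
      proj₁ (go (ρ (suc (suc zero))) ≤-refl) _ (proj₁ (valΔ-correct {ρ = ρ₂} #1 #0 #4 #3) vy)
      where
      ρ₂ = cons ℕˢ b (cons ℕˢ a ρ)
      v₀ : Val a b 0 r
      v₀ = proj₁ (valΔ-correct {ρ = cons ℕˢ r ρ₂} #2 #1 `0 #0) v₀'
      xs = tabulate λ i → ρ (suc (suc (suc i)))
      -- The code has at most one value at each index, so the values supplied separately by the
      -- individual steps fit together into one computation.
      go : ∀ i → i ≤ ρ (suc (suc zero)) → (∀ v → Val a b i v → prec g h [ i ∷ xs ]⇓ v) × Σ ℕ (Val a b i)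
      go zero l = (λ v p → subst (prec g h [ 0 ∷ xs ]⇓_) (Least-unique v₀ p) (ev-rec0 (graphΔ-sound g _ s₀)))
                  , r , v₀
      go (suc i) l with step i l
      ... | r , _ , r' , _ , p , p' , t =
        (λ v q → subst (prec g h [ suc i ∷ xs ]⇓_) (Least-unique val' q)
                   (ev-recS (proj₁ (go i (<⇒≤ l)) r (proj₁ (valΔ-correct {ρ = ρ₅} #4 #3 #2 #1) p)) (graphΔ-sound h _ t))) ,
        r' , val'
        where
        ρ₅ = cons ℕˢ r' (cons ℕˢ r (cons ℕˢ i ρ₂))
        val' : Val a b (suc i) r'
        val' = proj₁ (valΔ-correct {ρ = ρ₅} #4 #3 (`S #2) #0) p'
    graphΔ-sound (mu f) ρ (below , s) = ev-mu (graphΔ-sound f _ s) λ z l → witness z (below z (ℕ<⇒< l))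
      where
      witness : ∀ z → Σ ℕ (λ k → k < ρ zero × ⟦ graphΔ f ⟧ _) → Σ ℕ (λ k → f [ z ∷ inputs ρ ]⇓ suc k)
      witness z (k , _ , t) = k , graphΔ-sound f _ t

    graphsΔ-sound : ∀ {n m k} (gs : Vec (PR n) m) w ys xs (ρ : Fin k → ℕ) → ⟦ graphsΔ gs w ys xs ⟧ ρ →
                    gs [ tabulate (λ i → evalT ℕˢ ρ (xs i)) ]⇓* tabulate (λ i → evalT ℕˢ ρ (ys i))
    graphsΔ-sound [] w ys xs ρ s = ev-[]
    graphsΔ-sound (g ∷ gs) w ys xs ρ (s , t) = ev-∷ (graphΔ-sound g _ s) (graphsΔ-sound gs w (λ i → ys (suc i)) xs ρ t)

  Holds : ∀ {n} → PR n → Vec ℕ n → ℕ → ℕ → Set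
  Holds f xs y w = ⟦ graphΔ f ⟧ (cons ℕˢ w (cons ℕˢ y (lookup xs)))

  -- Different subcomputations come with different bounds on their witnesses. Truth for all
  -- sufficiently large bounds is closed under conjunction and bounded families, and so takes the
  -- place of monotonicity in the bound.
  Eventually : (ℕ → Set) → Set
  Eventually P = Σ ℕ λ w₀ → ∀ w → w₀ ≤ w → P w

  opaque
    eventually-× : ∀ {P Q} → Eventually P → Eventually Q → Eventually (λ w → P w × Q w)
    eventually-× (w , f) (v , g) = w + v , λ u l → f u (≤-trans (m≤m+n w v) l) , g u (≤-trans (m≤n+m v w) l)

    eventually-map : ∀ {P Q : ℕ → Set} → (∀ w → P w → Q w) → Eventually P → Eventually Q
    eventually-map h (w , f) = w , λ u l → h u (f u l)

    eventually-< : ∀ a → Eventually (a <_)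
    eventually-< a = S a , λ w l → l

    eventually-all : ∀ {P : ℕ → ℕ → Set} n → (∀ z → z < n → Eventually (P z)) → Eventually (λ w → ∀ z → z < n → P z w)
    eventually-all zero h = 0 , λ w _ z l → ⊥-elim (n≮0 l)
    eventually-all {P} (suc n) h =
      eventually-map (λ w p z l → either (proj₁ p) (proj₂ p) z (<S⇒<∨≡ l))
        (eventually-× (eventually-all n (λ z l → h z (<-trans l n<Sn))) (h n n<Sn))
      where
      either : ∀ {w} → (∀ z → z < n → P z w) → P n w → ∀ z → z < n ⊎ z ≡ n → P z w
      either f p z (inj₁ l) = f z l
      either f p z (inj₂ refl) = p

    eventually-Fin : ∀ {m} {P : Fin m → ℕ → Set} → (∀ i → Eventually (P i)) → Eventually (λ w → ∀ i → P i w)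
    eventually-Fin {zero}  h = 0 , λ w _ ()
    eventually-Fin {suc m} h = eventually-map (λ w p → λ { zero → proj₁ p ; (suc i) → proj₂ p i })
      (eventually-× (h zero) (eventually-Fin (λ i → h (suc i))))

  Values : ∀ {n} → PR n → PR (suc (suc n)) → Vec ℕ n → (ℕ → ℕ) → ℕ → ℕ → Set
  Values g h xs r y w = Holds g xs (r 0) w × (∀ i → i < y → Holds h (i ∷ r i ∷ xs) (r (suc i)) w)

  opaque
    prec-complete : ∀ {n} (g : PR n) h xs r y → Eventually (Values g h xs r y) →
                    Eventually (Holds (prec g h) (y ∷ xs) (r y))
    prec-complete {n} g h xs r y ev = eventually-map use (eventually-× ev
        (eventually-× (eventually-< a) (eventually-× (eventually-< b) (eventually-all (suc y) (λ i _ → eventually-< (r i))))))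
      where
      code : Σ ℕ λ a → Σ ℕ λ b → ∀ c → c < suc y → Val a b c (r c)
      code = codeSequence {r} _ (suc y)
      a b : ℕ
      a = proj₁ code
      b = proj₁ (proj₂ code)
      val : ∀ c → c < suc y → Val a b c (r c)
      val = proj₂ (proj₂ code)
      use : ∀ w → Values g h xs r y w × a < w × b < w × (∀ i → i < suc y → r i < w) → Holds (prec g h) (y ∷ xs) (r y) w
      use w ((hg , hh) , a<w , b<w , r<w) = a , a<w , b , b<w ,
        (r 0 , r<w 0 (s≤s O≤) , proj₂ (valΔ-correct {ρ = cons ℕˢ (r 0) ρ₂} #2 #1 `0 #0) (val 0 (s≤s O≤)) ,
         ⟦⟧-ext (graphΔ g) (λ { zero → refl ; (suc zero) → refl ; (suc (suc i)) → refl }) hg) ,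
        (λ i l → r i , r<w i (<-trans l n<Sn) , r (suc i) , r<w (suc i) (s≤s l) ,
          proj₂ (valΔ-correct {ρ = ρ₅ i} #4 #3 #2 #1) (val i (<-trans l n<Sn)) ,
          proj₂ (valΔ-correct {ρ = ρ₅ i} #4 #3 (`S #2) #0) (val (suc i) (s≤s l)) ,
          ⟦⟧-ext (graphΔ h) (λ { zero → refl ; (suc zero) → refl ; (suc (suc zero)) → refl ;
                                 (suc (suc (suc zero))) → refl ; (suc (suc (suc (suc i)))) → refl }) (hh i l)) ,
        proj₂ (valΔ-correct {ρ = ρ₂} #1 #0 #4 #3) (val y n<Sn)
        where
        ρ₂ : Fin (5 ℕ.+ n) → ℕ
        ρ₂ = cons ℕˢ b (cons ℕˢ a (cons ℕˢ w (cons ℕˢ (r y) (lookup (y ∷ xs)))))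
        ρ₅ : ℕ → Fin (8 ℕ.+ n) → ℕ
        ρ₅ = λ i → cons ℕˢ (r (suc i)) (cons ℕˢ (r i) (cons ℕˢ i ρ₂))

  mutual
    graphΔ-complete : ∀ {n} {f : PR n} {xs y} → f [ xs ]⇓ y → Eventually (Holds f xs y)
    graphΔ-complete ev-zer = 0 , λ _ _ → refl
    graphΔ-complete ev-succ = 0 , λ _ _ → refl
    graphΔ-complete (ev-proj i) = 0 , λ _ _ → refl
    graphΔ-complete {n} {comp {m = m} f gs} {xs} {z} (ev-comp {ys = ys} ds d) = eventually-map use
        (eventually-× (eventually-Fin (λ i → eventually-< (lookup ys i))) (eventually-×
           (graphsΔ-complete ds (λ w → join (lookup ys) (cons ℕˢ w (cons ℕˢ z (lookup xs)))) _ _ _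
             (λ w → join-↑ʳ (lookup ys) (cons ℕˢ w (cons ℕˢ z (lookup xs))) zero)
             (λ w i → join-↑ˡ (lookup ys) (cons ℕˢ w (cons ℕˢ z (lookup xs))) i)
             (λ w i → join-↑ʳ (lookup ys) (cons ℕˢ w (cons ℕˢ z (lookup xs))) (suc (suc i))))
           (graphΔ-complete d)))
      where
      use : ∀ w → (∀ i → lookup ys i < w) × ⟦ graphsΔ gs _ _ _ ⟧ _ × Holds f ys z w → Holds (comp f gs) xs z w
      use w (h , s , t) = proj₂ (bexs-correct m zero _ _) (lookup ys , h , s ,
        ⟦⟧-ext (graphΔ f) (λ { zero → sym (join-↑ʳ (lookup ys) (cons ℕˢ w (cons ℕˢ z (lookup xs))) zero)
                             ; (suc zero) → sym (join-↑ʳ (lookup ys) (cons ℕˢ w (cons ℕˢ z (lookup xs))) (suc zero))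
                             ; (suc (suc i)) → sym (join-↑ˡ (lookup ys) (cons ℕˢ w (cons ℕˢ z (lookup xs))) i) }) t)
    graphΔ-complete {f = prec g h} (ev-rec0 d) with recursion-values {g = g} {h} (ev-rec0 d)
    ... | r , refl , ev = prec-complete g h _ r _ ev
    graphΔ-complete {f = prec g h} (ev-recS d e) with recursion-values (ev-recS d e)
    ... | r , refl , ev = prec-complete g h _ r _ ev
    graphΔ-complete {f = mu f} {xs} {y} (ev-mu d below) = eventually-map use
        (eventually-× (graphΔ-complete d) (eventually-all {λ z w → Σ ℕ λ k → k < w × Holds f (z ∷ xs) (suc k) w} y
          (λ z l → search z (below z (<⇒ℕ< l)))))
      where
      search : ∀ z → Σ ℕ (λ k → f [ z ∷ xs ]⇓ suc k) → Eventually (λ w → Σ ℕ λ k → k < w × Holds f (z ∷ xs) (suc k) w)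
      search z (k , d) = eventually-map (λ w p → k , p) (eventually-× (eventually-< k) (graphΔ-complete d))
      use : ∀ w → Holds f (y ∷ xs) 0 w × (∀ z → z < y → Σ ℕ λ k → k < w × Holds f (z ∷ xs) (suc k) w) → Holds (mu f) xs y w
      use w (s , b) = (λ z l → proj₁ (b z l) , proj₁ (proj₂ (b z l)) ,
          ⟦⟧-ext (graphΔ f) (λ { zero → refl ; (suc zero) → refl ; (suc (suc zero)) → refl ; (suc (suc (suc i))) → refl }) (proj₂ (proj₂ (b z l)))) ,
        ⟦⟧-ext (graphΔ f) (λ { zero → refl ; (suc zero) → refl ; (suc (suc zero)) → refl ; (suc (suc (suc i))) → refl }) s

    -- A derivation shows the intermediate values only nested inside one another. Collected into a
    -- function they can be coded as a sequence; beyond `y` the function is arbitrary.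
    recursion-values : ∀ {n} {g : PR n} {h xs y z} → prec g h [ y ∷ xs ]⇓ z →
                       Σ (ℕ → ℕ) λ r → z ≡ r y × Eventually (Values g h xs r y)
    recursion-values {z = z} (ev-rec0 d) = (λ _ → z) , refl ,
      eventually-map (λ w s → s , λ i l → ⊥-elim (n≮0 l)) (graphΔ-complete d)
    recursion-values {g = g} {h} {xs} {suc y} {z} (ev-recS d e) with recursion-values d
    ... | r , refl , ev = r' , sym (r'-new y refl) , eventually-map use (eventually-× ev (graphΔ-complete e))
      where
      extend : ∀ {i} → Dec (i ≡ suc y) → ℕ → ℕ
      extend (yes _) v = z
      extend (no _)  v = v
      r' : ℕ → ℕ
      r' i = extend (i ℕP.≟ suc y) (r i)
      r'-new : ∀ y' → y' ≡ y → r' (suc y') ≡ z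
      r'-new y' refl with suc y ℕP.≟ suc y
      ... | yes _ = refl
      ... | no n  = ⊥-elim (n refl)
      r'-old : ∀ i → i < suc y → r' i ≡ r i
      r'-old i l with i ℕP.≟ suc y
      ... | yes refl = ⊥-elim (<-irrefl l)
      ... | no _     = refl
      use : ∀ w → Values g h xs r y w × Holds h (y ∷ r y ∷ xs) z w → Values g h xs r' (suc y) w
      use w ((hg , hh) , t) = subst (λ v → Holds g xs v w) (sym (r'-old 0 (s≤s O≤))) hg , λ i l → step i l (<S⇒<∨≡ l)
        where
        step : ∀ i → i < suc y → i < y ⊎ i ≡ y → Holds h (i ∷ r' i ∷ xs) (r' (suc i)) w
        step i l (inj₁ m) = subst₂ (λ u v → Holds h (i ∷ u ∷ xs) v w) (sym (r'-old i l)) (sym (r'-old (suc i) (s≤s m))) (hh i m)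
        step i l (inj₂ refl) = subst₂ (λ u v → Holds h (i ∷ u ∷ xs) v w) (sym (r'-old i l)) (sym (r'-new i refl)) t

    graphsΔ-complete : ∀ {n m k} {gs : Vec (PR n) m} {xs ys} → gs [ xs ]⇓* ys →
      (ρ : ℕ → Fin k → ℕ) (w : Term k) (os : Fin m → Term k) (is : Fin n → Term k) →
      (∀ u → evalT ℕˢ (ρ u) w ≡ u) → (∀ u i → evalT ℕˢ (ρ u) (os i) ≡ lookup ys i) →
      (∀ u i → evalT ℕˢ (ρ u) (is i) ≡ lookup xs i) → Eventually (λ u → ⟦ graphsΔ gs w os is ⟧ (ρ u))
    graphsΔ-complete ev-[] ρ w os is hw ho hi = 0 , λ _ _ → refl
    graphsΔ-complete (ev-∷ {g = g} d ds) ρ w os is hw ho hi = eventually-map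
      (λ u p → ⟦⟧-ext (graphΔ g) (λ { zero → sym (hw u) ; (suc zero) → sym (ho u zero) ; (suc (suc i)) → sym (hi u i) }) (proj₁ p) , proj₂ p)
      (eventually-× (graphΔ-complete d) (graphsΔ-complete ds ρ w (λ i → os (suc i)) is hw (λ u i → ho u (suc i)) hi))

  -- The free variables are the input and one bound for the whole computation and its output, so
  -- halting becomes a single existential quantifier in front of a bounded formula.
  haltΔ : PR 1 → Δ₀ 2
  haltΔ e = bex #1 (app (graphΔ e) (args #2 #0 (#1 ◂ ∅)))

  opaque
    haltΔ-correct : ∀ e x → Σ ℕ (λ y → e [ x ∷ [] ]⇓ y) ⟺ Σ ℕ (λ w → ⟦ haltΔ e ⟧ (cons ℕˢ x (cons ℕˢ w (λ ()))))
    proj₁ (haltΔ-correct e x) (y , d) with eventually-× (graphΔ-complete d) (eventually-< y)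
    ... | w , f = w , y , proj₂ (f w ≤-refl) ,
          ⟦⟧-ext (graphΔ e) (λ { zero → refl ; (suc zero) → refl ; (suc (suc zero)) → refl }) (proj₁ (f w ≤-refl))
    proj₂ (haltΔ-correct e x) (w , y , _ , s) = y , graphΔ-sound e _ s

-- Conditions on approximations

-- Pairing is kept as a constructor since its defining term mentions its arguments three times.
data CTerm (n : ℕ) : Set where
  var       : Fin n → CTerm n
  `0        : CTerm n
  `S        : CTerm n → CTerm n
  _`+_ _`*_ : CTerm n → CTerm n → CTerm n
  `J        : CTerm n → CTerm n → CTerm n

data QF (n : ℕ) : Set where
  _≈̂_  : CTerm n → CTerm n → QF n
  mem  : CTerm n → QF n
  ⊥̂    : QF n
  _⇒̂_  : QF n → QF n → QF n
  _&_  : QF n → QF n → QF n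

-- mem refers to the set that is to be approximated.  The predicates small and axiom depend on a bound k
-- and occur only as hypotheses, so that a clause gets weaker when k decreases.
data Clause (n : ℕ) : Set where
  ⟨_⟩     : QF n → Clause n
  _&&_    : Clause n → Clause n → Clause n
  small_▷_ : CTerm n → Clause n → Clause n
  axiom_▷_ : CTerm n → Clause n → Clause n

infix  7 _≈̂_
infixr 5 _⇒̂_
infixr 6 _&_
infixr 3 _&&_
infixr 4 small_▷_ axiom_▷_

numeral : ∀ {n} → ℕ → CTerm n
numeral zero    = `0
numeral (suc k) = `S (numeral k)

module Conditions {ℓ} (M : Structure ℓ) (A : Arith M) where
  open Arithmetic M A

  evalC : ∀ {n} → (Fin n → C) → CTerm n → C
  evalC ρ (var i)  = ρ i
  evalC ρ `0       = O
  evalC ρ (`S t)   = S (evalC ρ t)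
  evalC ρ (t `+ s) = evalC ρ t + evalC ρ s
  evalC ρ (t `* s) = evalC ρ t * evalC ρ s
  evalC ρ (`J t s) = J (evalC ρ t) (evalC ρ s)

  QSat : ∀ {n} → QF n → (C → Set ℓ) → (Fin n → C) → Set ℓ
  QSat (t ≈̂ s) X ρ = evalC ρ t ≡ evalC ρ s
  QSat (mem t) X ρ = X (evalC ρ t)
  QSat ⊥̂       X ρ = Lift ℓ ⊥
  QSat (p ⇒̂ q) X ρ = QSat p X ρ → QSat q X ρ
  QSat (p & q) X ρ = QSat p X ρ × QSat q X ρ

  -- The guard puts every position at which the set is queried below `m`, so a guarded instance
  -- depends only on the part of the set below `m`. Equations and the tests `small` and `axiom`
  -- query nothing and remain unguarded.
  QGuard : ∀ {n} → QF n → C → (Fin n → C) → Set ℓ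
  QGuard (t ≈̂ s) m ρ = Lift ℓ ⊤
  QGuard (mem t) m ρ = evalC ρ t < m
  QGuard ⊥̂       m ρ = Lift ℓ ⊤
  QGuard (p ⇒̂ q) m ρ = QGuard p m ρ × QGuard q m ρ
  QGuard (p & q) m ρ = QGuard p m ρ × QGuard q m ρ

  CSat : ∀ {n} → Clause n → (B Ax X : C → Set ℓ) → (Fin n → C) → Set ℓ
  CSat ⟨ q ⟩         B Ax X ρ = QSat q X ρ
  CSat (c && d)      B Ax X ρ = CSat c B Ax X ρ × CSat d B Ax X ρ
  CSat (small t ▷ c) B Ax X ρ = B (evalC ρ t) → CSat c B Ax X ρ
  CSat (axiom t ▷ c) B Ax X ρ = Ax (evalC ρ t) → CSat c B Ax X ρ

  CGuard : ∀ {n} → Clause n → C → (Fin n → C) → Set ℓ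
  CGuard ⟨ q ⟩         m ρ = QGuard q m ρ
  CGuard (c && d)      m ρ = CGuard c m ρ × CGuard d m ρ
  CGuard (small t ▷ c) m ρ = CGuard c m ρ
  CGuard (axiom t ▷ c) m ρ = CGuard c m ρ

  Good : ∀ {n} → Clause n → (B Ax : C → Set ℓ) → C → (C → Set ℓ) → Set ℓ
  Good c B Ax m X = ∀ ρ → CGuard c m ρ → CSat c B Ax X ρ

  opaque
    QGuard-mono : ∀ {n} (q : QF n) {m m' ρ} → m ≤ m' → QGuard q m ρ → QGuard q m' ρ
    QGuard-mono (t ≈̂ s) l g = g
    QGuard-mono (mem t) l g = ≤-trans g l
    QGuard-mono ⊥̂       l g = g
    QGuard-mono (p ⇒̂ q) l (g , h) = QGuard-mono p l g , QGuard-mono q l h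
    QGuard-mono (p & q) l (g , h) = QGuard-mono p l g , QGuard-mono q l h

    CGuard-mono : ∀ {n} (c : Clause n) {m m' ρ} → m ≤ m' → CGuard c m ρ → CGuard c m' ρ
    CGuard-mono ⟨ q ⟩         l g = QGuard-mono q l g
    CGuard-mono (c && d)      l (g , h) = CGuard-mono c l g , CGuard-mono d l h
    CGuard-mono (small t ▷ c) l g = CGuard-mono c l g
    CGuard-mono (axiom t ▷ c) l g = CGuard-mono c l g

    QGuard-exists : ∀ {n} (q : QF n) ρ → Σ C λ m → QGuard q m ρ
    QGuard-exists (t ≈̂ s) ρ = O , lift tt
    QGuard-exists (mem t) ρ = _ , n<Sn
    QGuard-exists ⊥̂       ρ = O , lift tt
    QGuard-exists (p ⇒̂ q) ρ with QGuard-exists p ρ | QGuard-exists q ρ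
    ... | m , g | m' , h = m + m' , QGuard-mono p (m≤m+n m m') g , QGuard-mono q (m≤n+m m' m) h
    QGuard-exists (p & q) ρ with QGuard-exists p ρ | QGuard-exists q ρ
    ... | m , g | m' , h = m + m' , QGuard-mono p (m≤m+n m m') g , QGuard-mono q (m≤n+m m' m) h

    CGuard-exists : ∀ {n} (c : Clause n) ρ → Σ C λ m → CGuard c m ρ
    CGuard-exists ⟨ q ⟩         ρ = QGuard-exists q ρ
    CGuard-exists (c && d)      ρ with CGuard-exists c ρ | CGuard-exists d ρ
    ... | m , g | m' , h = m + m' , CGuard-mono c (m≤m+n m m') g , CGuard-mono d (m≤n+m m' m) h
    CGuard-exists (small t ▷ c) ρ = CGuard-exists c ρ
    CGuard-exists (axiom t ▷ c) ρ = CGuard-exists c ρ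

    QSat-agree : ∀ {n} (q : QF n) {m X Y ρ} → (∀ p → p < m → X p ⟺ Y p) → QGuard q m ρ → QSat q X ρ ⟺ QSat q Y ρ
    QSat-agree (t ≈̂ s) h g = (λ x → x) , λ x → x
    QSat-agree (mem t) h g = h _ g
    QSat-agree ⊥̂       h g = (λ x → x) , λ x → x
    QSat-agree (p ⇒̂ q) h (g , g') =
      (λ f x → proj₁ (QSat-agree q h g') (f (proj₂ (QSat-agree p h g) x))) ,
      λ f x → proj₂ (QSat-agree q h g') (f (proj₁ (QSat-agree p h g) x))
    QSat-agree (p & q) h (g , g') =
      (λ { (x , y) → proj₁ (QSat-agree p h g) x , proj₁ (QSat-agree q h g') y }) ,
      λ { (x , y) → proj₂ (QSat-agree p h g) x , proj₂ (QSat-agree q h g') y }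

    CSat-agree : ∀ {n} (c : Clause n) {m X Y B B' Ax Ax' ρ} → (∀ p → p < m → X p ⟺ Y p) →
                 (∀ x → B' x → B x) → (∀ x → Ax' x → Ax x) →
                 CGuard c m ρ → CSat c B Ax X ρ → CSat c B' Ax' Y ρ
    CSat-agree ⟨ q ⟩         h b a g s = proj₁ (QSat-agree q h g) s
    CSat-agree (c && d)      h b a (g , g') (s , s') = CSat-agree c h b a g s , CSat-agree d h b a g' s'
    CSat-agree (small t ▷ c) h b a g s x = CSat-agree c h b a g (s (b _ x))
    CSat-agree (axiom t ▷ c) h b a g s x = CSat-agree c h b a g (s (a _ x))

    Good-restrict : ∀ {n} (c : Clause n) {m m' X Y B B' Ax Ax'} → m' ≤ m → (∀ p → p < m' → X p ⟺ Y p) →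
                    (∀ x → B' x → B x) → (∀ x → Ax' x → Ax x) → Good c B Ax m X → Good c B' Ax' m' Y
    Good-restrict c l h b a G ρ g = CSat-agree c h b a g (G ρ (CGuard-mono c l g))

-- Translation of the conditions into formulas

infixr 7 _∧ᶠ_

∃̂ : ∀ {n} → Formula (suc n) → Formula n
∃̂ φ = `¬ (`∀ (`¬ φ))

_∧ᶠ_ : ∀ {n} → Formula n → Formula n → Formula n
φ ∧ᶠ ψ = `¬ (φ `⇒ `¬ ψ)

∀ⁿ : ∀ n {m} → Formula (n ℕ.+ m) → Formula m
∀ⁿ zero    φ = φ
∀ⁿ (suc n) φ = ∀ⁿ n (`∀ φ)

memᶠ : ∀ {n} → Term n → Term n → Term n → Formula n
memᶠ a b p = ∃̂ ((`S (`S (renT suc p) `* renT suc b) `* var zero) `≐ renT suc a)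

-- Bounding the halting witness by `k` as well makes the test a bounded formula, hence absolute
-- between a model and the standard numbers when `k` and the code are standard.
axΔ : Δ₀ 2 → Δ₀ 2
axΔ halt = bex #0 (app halt (#2 ◂ #0 ◂ ∅))

toTerm : ∀ {n} → CTerm n → Term n
toTerm (var i)  = var i
toTerm `0       = `0
toTerm (`S t)   = `S (toTerm t)
toTerm (t `+ s) = toTerm t `+ toTerm s
toTerm (t `* s) = toTerm t `* toTerm s
toTerm (`J t s) = `Jᵗ (toTerm t) (toTerm s)

-- The additional free variables of the translations are b, a, m, k, in this order.
module Translation (halt : Δ₀ 2) where

  bᵗ aᵗ mᵗ kᵗ : ∀ n → Term (n ℕ.+ 4)
  bᵗ n = var (n ↑ʳ zero)
  aᵗ n = var (n ↑ʳ suc zero)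
  mᵗ n = var (n ↑ʳ suc (suc zero))
  kᵗ n = var (n ↑ʳ suc (suc (suc zero)))

  inner : ∀ {n} → CTerm n → Term (n ℕ.+ 4)
  inner t = renT (_↑ˡ 4) (toTerm t)

  qf : ∀ {n} → QF n → Formula (n ℕ.+ 4)
  qf (t ≈̂ s) = inner t `≐ inner s
  qf {n} (mem t) = memᶠ (aᵗ n) (bᵗ n) (inner t)
  qf ⊥̂       = `⊥
  qf (p ⇒̂ q) = qf p `⇒ qf q
  qf (p & q) = qf p ∧ᶠ qf q

  qguard : ∀ {n} → QF n → Formula (n ℕ.+ 4)
  qguard (t ≈̂ s) = `⊥ `⇒ `⊥
  qguard {n} (mem t) = inner t `< mᵗ n
  qguard ⊥̂       = `⊥ `⇒ `⊥
  qguard (p ⇒̂ q) = qguard p ∧ᶠ qguard q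
  qguard (p & q) = qguard p ∧ᶠ qguard q

  clause : ∀ {n} → Clause n → Formula (n ℕ.+ 4)
  clause ⟨ q ⟩         = qf q
  clause (c && d)      = clause c ∧ᶠ clause d
  clause {n} (small t ▷ c) = inner t `< kᵗ n `⇒ clause c
  clause {n} (axiom t ▷ c) = inner t `< kᵗ n ∧ᶠ subF (kᵗ n ◂ inner t ◂ ∅) (toFormula (axΔ halt)) `⇒ clause c

  cguard : ∀ {n} → Clause n → Formula (n ℕ.+ 4)
  cguard ⟨ q ⟩         = qguard q
  cguard (c && d)      = cguard c ∧ᶠ cguard d
  cguard (small t ▷ c) = cguard c
  cguard (axiom t ▷ c) = cguard c

  goodᶠ : ∀ {n} → Clause n → Formula 4
  goodᶠ {n} c = ∀ⁿ n (cguard c `⇒ clause c)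

  approximableᶠ : ∀ {n} → Clause n → Formula 1
  approximableᶠ c = `∀ (∃̂ (∃̂ (goodᶠ c)))

module TranslationCorrect {ℓ} (M : Structure ℓ) (A : Arith M) (halt : Δ₀ 2) where
  open Arithmetic M A
  open Conditions M A
  open Bounded M A
  open Semantics M
  open Translation halt

  Small : C → C → Set ℓ
  Small k x = x < k

  IsAxiom : C → C → Set ℓ
  IsAxiom k x = x < k × ⟦ axΔ halt ⟧ (cons M k (cons M x ∅))

  opaque
    Sat-∃ : ∀ {n} {ρ : Fin n → C} (φ : Formula (suc n)) → Sat M ρ (∃̂ φ) ⟺ (Σ C λ a → Sat M (cons M a ρ) φ)
    Sat-∃ φ = (λ f → dne λ n → lower (f λ a s → lift (n (a , s)))) , λ { (a , s) f → f a s }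

    Sat-∧ : ∀ {n} {ρ : Fin n → C} (φ ψ : Formula n) → Sat M ρ (φ ∧ᶠ ψ) ⟺ (Sat M ρ φ × Sat M ρ ψ)
    Sat-∧ φ ψ = (λ f → dne λ n → lower (f λ x y → lift (n (x , y)))) , λ { (x , y) f → f x y }

    Sat-∀ⁿ : ∀ n {m} (φ : Formula (n ℕ.+ m)) c → Sat M c (∀ⁿ n φ) ⟺ (∀ ρ → Sat M (join ρ c) φ)
    Sat-∀ⁿ zero φ c = (λ s ρ → s) , λ f → f ∅
    Sat-∀ⁿ (suc n) φ c =
      (λ s ρ → Sat-ext (λ { zero → refl ; (suc i) → refl }) φ (proj₁ (Sat-∀ⁿ n (`∀ φ) c) s (λ i → ρ (suc i)) (ρ zero))) ,
      λ f → proj₂ (Sat-∀ⁿ n (`∀ φ) c) λ ρ a → Sat-ext (λ { zero → refl ; (suc i) → refl }) φ (f (cons M a ρ))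

    Sat-mem : ∀ {n} {ρ : Fin n → C} (a b p : Term n) → Sat M ρ (memᶠ a b p) ⟺ Mem (evalT M ρ a) (evalT M ρ b) (evalT M ρ p)
    Sat-mem {n} {ρ} a b p =
      (λ s → let (q , e) = proj₁ (Sat-∃ {ρ = ρ} body) s in q , trans (sym (lhs q)) (trans e (rhs q))) ,
      λ { (q , e) → proj₂ (Sat-∃ {ρ = ρ} body) (q , trans (lhs q) (trans e (sym (rhs q)))) }
      where
      body : Formula (suc n)
      body = (`S (`S (renT suc p) `* renT suc b) `* var zero) `≐ renT suc a
      lhs : ∀ q → evalT M (cons M q ρ) (`S (`S (renT suc p) `* renT suc b) `* var zero) ≡ S (S (evalT M ρ p) * evalT M ρ b) * q
      lhs q = cong₂ (λ u v → S (S u * v) * q) (evalT-ren {ρ = cons M q ρ} suc p) (evalT-ren {ρ = cons M q ρ} suc b)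
      rhs : ∀ q → evalT M (cons M q ρ) (renT suc a) ≡ evalT M ρ a
      rhs q = evalT-ren {ρ = cons M q ρ} suc a

    evalT-toTerm : ∀ {n} (ρ : Fin n → C) t → evalT M ρ (toTerm t) ≡ evalC ρ t
    evalT-toTerm ρ (var i)  = refl
    evalT-toTerm ρ `0       = refl
    evalT-toTerm ρ (`S t)   = cong S (evalT-toTerm ρ t)
    evalT-toTerm ρ (t `+ s) = cong₂ _+_ (evalT-toTerm ρ t) (evalT-toTerm ρ s)
    evalT-toTerm ρ (t `* s) = cong₂ _*_ (evalT-toTerm ρ t) (evalT-toTerm ρ s)
    evalT-toTerm ρ (`J t s) = trans (sym (J≡ _ _)) (cong₂ J (evalT-toTerm ρ t) (evalT-toTerm ρ s))

  module _ (b a m k : C) where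
    γ : Fin 4 → C
    γ = cons M b (cons M a (cons M m (cons M k ∅)))

    eval-inner : ∀ {n} (ρ : Fin n → C) t → evalT M (join ρ γ) (inner t) ≡ evalC ρ t
    eval-inner ρ t = trans (evalT-ren (_↑ˡ 4) (toTerm t)) (trans (evalT-ext (join-↑ˡ ρ γ) (toTerm t)) (evalT-toTerm ρ t))

    qf-correct : ∀ {n} (q : QF n) ρ → Sat M (join ρ γ) (qf q) ⟺ QSat q (Mem a b) ρ
    qf-correct (t ≈̂ s) ρ = (λ e → trans (sym (eval-inner ρ t)) (trans e (eval-inner ρ s))) ,
                           λ e → trans (eval-inner ρ t) (trans e (sym (eval-inner ρ s)))
    qf-correct {n} (mem t) ρ = subst₂ (λ x y → Sat M (join ρ γ) (memᶠ (aᵗ n) (bᵗ n) (inner t)) ⟺ Mem x y (evalC ρ t))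
      (join-↑ʳ ρ γ (suc zero)) (join-↑ʳ ρ γ zero)
      (subst (λ z → Sat M (join ρ γ) (memᶠ (aᵗ n) (bᵗ n) (inner t)) ⟺ Mem (evalT M (join ρ γ) (aᵗ n)) (evalT M (join ρ γ) (bᵗ n)) z) (eval-inner ρ t) (Sat-mem (aᵗ n) (bᵗ n) (inner t)))
    qf-correct ⊥̂ ρ = (λ x → x) , λ x → x
    qf-correct (p ⇒̂ q) ρ = (λ f x → proj₁ (qf-correct q ρ) (f (proj₂ (qf-correct p ρ) x))) ,
                           λ f x → proj₂ (qf-correct q ρ) (f (proj₁ (qf-correct p ρ) x))
    qf-correct (p & q) ρ =
      (λ s → let (x , y) = proj₁ (Sat-∧ (qf p) (qf q)) s in proj₁ (qf-correct p ρ) x , proj₁ (qf-correct q ρ) y) ,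
      λ { (x , y) → proj₂ (Sat-∧ (qf p) (qf q)) (proj₂ (qf-correct p ρ) x , proj₂ (qf-correct q ρ) y) }

    less-correct : ∀ {n} (ρ : Fin n → C) t (j : Fin 4) → Sat M (join ρ γ) (inner t `< var (n ↑ʳ j)) ⟺ (evalC ρ t < γ j)
    less-correct {n} ρ t j = subst₂ (λ x y → Sat M (join ρ γ) (inner t `< var (n ↑ʳ j)) ⟺ (x < y))
      (eval-inner ρ t) (join-↑ʳ ρ γ j) (Sat-< (inner t) (var (n ↑ʳ j)))

    qguard-correct : ∀ {n} (q : QF n) ρ → Sat M (join ρ γ) (qguard q) ⟺ QGuard q m ρ
    qguard-correct (t ≈̂ s) ρ = (λ _ → lift tt) , λ _ x → x
    qguard-correct (mem t) ρ = less-correct ρ t (suc (suc zero))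
    qguard-correct ⊥̂ ρ = (λ _ → lift tt) , λ _ x → x
    qguard-correct (p ⇒̂ q) ρ =
      (λ s → let (x , y) = proj₁ (Sat-∧ (qguard p) (qguard q)) s in proj₁ (qguard-correct p ρ) x , proj₁ (qguard-correct q ρ) y) ,
      λ { (x , y) → proj₂ (Sat-∧ (qguard p) (qguard q)) (proj₂ (qguard-correct p ρ) x , proj₂ (qguard-correct q ρ) y) }
    qguard-correct (p & q) ρ =
      (λ s → let (x , y) = proj₁ (Sat-∧ (qguard p) (qguard q)) s in proj₁ (qguard-correct p ρ) x , proj₁ (qguard-correct q ρ) y) ,
      λ { (x , y) → proj₂ (Sat-∧ (qguard p) (qguard q)) (proj₂ (qguard-correct p ρ) x , proj₂ (qguard-correct q ρ) y) }

    axiom-correct : ∀ {n} (ρ : Fin n → C) t →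
      Sat M (join ρ γ) (inner t `< kᵗ n ∧ᶠ subF (kᵗ n ◂ inner t ◂ ∅) (toFormula (axΔ halt))) ⟺ IsAxiom k (evalC ρ t)
    axiom-correct {n} ρ t =
      (λ s → let (x , y) = proj₁ split s in proj₁ (less-correct ρ t (suc (suc (suc zero)))) x ,
         proj₁ (toFormula-correct (axΔ halt) _) (proj₁ unsub y)) ,
      λ { (x , y) → proj₂ split (proj₂ (less-correct ρ t (suc (suc (suc zero)))) x ,
         proj₂ unsub (proj₂ (toFormula-correct (axΔ halt) _) y)) }
      where
      σ-eval : ∀ i → evalT M (join ρ γ) ((kᵗ n ◂ inner t ◂ ∅) i) ≡ cons M k (cons M (evalC ρ t) ∅) i
      σ-eval zero       = join-↑ʳ ρ γ (suc (suc (suc zero)))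
      σ-eval (suc zero) = eval-inner ρ t
      split = Sat-∧ {ρ = join ρ γ} (inner t `< kᵗ n) (subF (kᵗ n ◂ inner t ◂ ∅) (toFormula (axΔ halt)))
      unsub = Sat-sub {ρ = join ρ γ} (kᵗ n ◂ inner t ◂ ∅) σ-eval (toFormula (axΔ halt))

    clause-correct : ∀ {n} (c : Clause n) ρ → Sat M (join ρ γ) (clause c) ⟺ CSat c (Small k) (IsAxiom k) (Mem a b) ρ
    clause-correct ⟨ q ⟩ ρ = qf-correct q ρ
    clause-correct (c && d) ρ =
      (λ s → let (x , y) = proj₁ (Sat-∧ (clause c) (clause d)) s in proj₁ (clause-correct c ρ) x , proj₁ (clause-correct d ρ) y) ,
      λ { (x , y) → proj₂ (Sat-∧ (clause c) (clause d)) (proj₂ (clause-correct c ρ) x , proj₂ (clause-correct d ρ) y) }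
    clause-correct (small t ▷ c) ρ =
      (λ f x → proj₁ (clause-correct c ρ) (f (proj₂ (less-correct ρ t (suc (suc (suc zero)))) x))) ,
      λ f x → proj₂ (clause-correct c ρ) (f (proj₁ (less-correct ρ t (suc (suc (suc zero)))) x))
    clause-correct (axiom t ▷ c) ρ =
      (λ f x → proj₁ (clause-correct c ρ) (f (proj₂ (axiom-correct ρ t) x))) ,
      λ f x → proj₂ (clause-correct c ρ) (f (proj₁ (axiom-correct ρ t) x))

    cguard-correct : ∀ {n} (c : Clause n) ρ → Sat M (join ρ γ) (cguard c) ⟺ CGuard c m ρ
    cguard-correct ⟨ q ⟩ ρ = qguard-correct q ρ
    cguard-correct (c && d) ρ =
      (λ s → let (x , y) = proj₁ (Sat-∧ (cguard c) (cguard d)) s in proj₁ (cguard-correct c ρ) x , proj₁ (cguard-correct d ρ) y) ,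
      λ { (x , y) → proj₂ (Sat-∧ (cguard c) (cguard d)) (proj₂ (cguard-correct c ρ) x , proj₂ (cguard-correct d ρ) y) }
    cguard-correct (small t ▷ c) ρ = cguard-correct c ρ
    cguard-correct (axiom t ▷ c) ρ = cguard-correct c ρ

    good-correct : ∀ {n} (c : Clause n) → Sat M γ (goodᶠ c) ⟺ Good c (Small k) (IsAxiom k) m (Mem a b)
    good-correct {n} c =
      (λ s ρ g → proj₁ (clause-correct c ρ) (proj₁ (Sat-∀ⁿ n _ γ) s ρ (proj₂ (cguard-correct c ρ) g))) ,
      λ G → proj₂ (Sat-∀ⁿ n _ γ) λ ρ s → proj₂ (clause-correct c ρ) (G ρ (proj₁ (cguard-correct c ρ) s))

  Approximable : ∀ {n} → Clause n → C → Set ℓ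
  Approximable c k = ∀ m → Σ C λ a → Σ C λ b → Good c (Small k) (IsAxiom k) m (Mem a b)

  opaque
    good-correct′ : ∀ {n} (c : Clause n) (ρ : Fin 4 → C) →
      Sat M ρ (goodᶠ c) ⟺ Good c (Small (ρ (suc (suc (suc zero))))) (IsAxiom (ρ (suc (suc (suc zero))))) (ρ (suc (suc zero))) (Mem (ρ (suc zero)) (ρ zero))
    good-correct′ c ρ =
      (λ s → proj₁ (good-correct _ _ _ _ c) (Sat-ext (λ i → e i) (goodᶠ c) s)) ,
      λ G → Sat-ext (λ i → sym (e i)) (goodᶠ c) (proj₂ (good-correct _ _ _ _ c) G)
      where
      e : ∀ i → ρ i ≡ γ (ρ zero) (ρ (suc zero)) (ρ (suc (suc zero))) (ρ (suc (suc (suc zero)))) i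
      e zero = refl
      e (suc zero) = refl
      e (suc (suc zero)) = refl
      e (suc (suc (suc zero))) = refl

    approximable-correct : ∀ {n} (c : Clause n) (ρ : Fin 1 → C) → Sat M ρ (approximableᶠ c) ⟺ Approximable c (ρ zero)
    approximable-correct c ρ =
      (λ s m → let (a , t) = proj₁ (Sat-∃ {ρ = cons M m ρ} (∃̂ (goodᶠ c))) (s m) ; (b , u) = proj₁ (Sat-∃ {ρ = cons M a (cons M m ρ)} (goodᶠ c)) t in a , b , proj₁ (good-correct′ c _) u) ,
      λ h m → let (a , b , G) = h m in proj₂ (Sat-∃ {ρ = cons M m ρ} (∃̂ (goodᶠ c))) (a , proj₂ (Sat-∃ {ρ = cons M a (cons M m ρ)} (goodᶠ c)) (b , proj₂ (good-correct′ c _) G))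

-- Definable branches

-- A definable form of König's lemma: if a condition G k m X on X ∩ [0 , m) can be met for all m,
-- then a single definable set meets it for all m, and this simultaneously for all such k.
module Branch {ℓ} (M : Structure ℓ) (A : Arith M) (G : Carrier M → Carrier M → (Carrier M → Set ℓ) → Set ℓ) where
  open Arithmetic M A

  Agree : C → (C → Set ℓ) → (C → Set ℓ) → Set ℓ
  Agree m X Y = ∀ p → p < m → X p ⟺ Y p

  Inhabited : C → Set ℓ
  Inhabited k = ∀ m → Σ C λ a → Σ C λ b → G k m (Mem a b)

  module Leftmost (restrict : ∀ k m m' X Y → m' ≤ m → Agree m' X Y → G k m X → G k m' Y)
                  (antitone : ∀ k k' m X → k' ≤ k → G k m X → G k' m X)
                  (dG : Def {4} (λ ρ → G (ρ zero) (ρ (suc zero)) (Mem (ρ (suc (suc zero))) (ρ (suc (suc (suc zero))))))) where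

    opaque
      agree-sym : ∀ {m X Y} → Agree m X Y → Agree m Y X
      agree-sym h p l = proj₂ (h p l) , proj₁ (h p l)

      agree-trans : ∀ {m X Y Z} → Agree m X Y → Agree m Y Z → Agree m X Z
      agree-trans h k p l = (λ x → proj₁ (k p l) (proj₁ (h p l) x)) , λ z → proj₂ (h p l) (proj₂ (k p l) z)

      agree-≤ : ∀ {m m' X Y} → m' ≤ m → Agree m X Y → Agree m' X Y
      agree-≤ l h p l' = h p (≤-trans l' l)

      code : ∀ {X : C → Set ℓ} → Def {1} (λ ρ → X (ρ zero)) → ∀ m → Σ C λ a → Σ C λ b → Agree m (Mem a b) X
      code d m with base m
      ... | b , B with codeSet d B (proj₂ (commonMultiple m b))
      ...   | a , _ , h = a , b , h

    -- All inhabited `k` up to `m` are served together because the standard ones cannot be singled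
    -- out definably. Each `k` is taken into account from level `k` on.
    Node : C → C → C → Set ℓ
    Node m a b = ∀ k → k ≤ m → Inhabited k → G k m (Mem a b)

    Extendable : C → C → C → Set ℓ
    Extendable m a b = ∀ m' → m ≤ m' → Σ C λ a' → Σ C λ b' → Node m' a' b' × Agree m (Mem a b) (Mem a' b')

    -- Whether i belongs to the leftmost branch is determined by its part below i.
    Forced : C → C → C → Set ℓ
    Forced i a b = ∀ a' b' → Agree i (Mem a' b') (Mem a b) → ¬ Mem a' b' i → ¬ Extendable (S i) a' b'

    IsLeftmost : C → C → C → Set ℓ
    IsLeftmost m a b = ∀ i → i < m → Mem a b i ⟺ Forced i a b

    Path : C → Set ℓ
    Path p = Σ C λ a → Σ C λ b → IsLeftmost (S p) a b × Mem a b p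

    private
      pick : ∀ {n} → Fin n → Fin n → Fin n → Fin n → Fin 4 → Fin n
      pick x y z w zero = x
      pick x y z w (suc zero) = y
      pick x y z w (suc (suc zero)) = z
      pick x y z w (suc (suc (suc zero))) = w

    opaque
      dInhabited : ∀ {n} (i : Fin n) → Def (λ ρ → Inhabited (ρ i))
      dInhabited i = dAll (dEx (dEx (dRen (pick (suc (suc (suc i))) (suc (suc zero)) (suc zero) zero) dG)))

      dNode : ∀ {n} (m a b : Fin n) → Def (λ ρ → Node (ρ m) (ρ a) (ρ b))
      dNode m a b = dAll (dImp (fVar ≤̇ fVar) (dImp (dInhabited zero) (dRen (pick zero (suc m) (suc a) (suc b)) dG)))

      dAgree : ∀ {n} {f : Fun n} → DF f → (a b a' b' : Fin n) → Def (λ ρ → Agree (f ρ) (Mem (ρ a) (ρ b)) (Mem (ρ a') (ρ b')))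
      dAgree d a b a' b' = dAll (dImp (fVar <̇ weaken d) (dIffP (dMem fVar fVar fVar) (dMem fVar fVar fVar)))

      dExtendable : ∀ {n} {f : Fun n} → DF f → (a b : Fin n) → Def (λ ρ → Extendable (f ρ) (ρ a) (ρ b))
      dExtendable d a b = dAll (dImp (weaken d ≤̇ fVar) (dEx (dEx (dAnd (dNode (suc (suc zero)) (suc zero) zero)
        (dAgree (weaken (weaken (weaken d))) (suc (suc (suc a))) (suc (suc (suc b))) (suc zero) zero)))))

      dLeftmost : ∀ {n} {f : Fun n} → DF f → (a b : Fin n) → Def (λ ρ → IsLeftmost (f ρ) (ρ a) (ρ b))
      dLeftmost d a b = dAll (dImp (fVar <̇ weaken d) (dIffP (dMem fVar fVar fVar)
        (dAll (dAll (dImp (dAgree fVar (suc zero) zero (suc (suc (suc a))) (suc (suc (suc b))))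
          (dImp (dNot (dMem fVar fVar fVar)) (dNot (dExtendable (fSuc fVar) (suc zero) zero))))))))

      dPath : Def {1} (λ ρ → Path (ρ zero))
      dPath = dEx (dEx (dAnd (dLeftmost (fSuc fVar) (suc zero) zero) (dMem fVar fVar fVar)))

    opaque
      -- The condition weakens as `k` decreases, so a set that serves the largest inhabited `k`
      -- serves all of them. The induction replaces the set whenever it passes an inhabited `j`.
      node-exists : ∀ m → Σ C λ a → Σ C λ b → Node m a b
      node-exists m with ind {λ j → Σ C λ a → Σ C λ b → ∀ k → k < j → Inhabited k → G k m (Mem a b)}
          (dEx (dEx (dAll (dImp (fVar <̇ fVar) (dImp (dInhabited zero) dG')))))
          (O , O , λ k l → ⊥-elim (n≮0 l)) step (S m)
        where
        dG' : Def {4} (λ ρ → G (ρ zero) m (Mem (ρ (suc (suc zero))) (ρ (suc zero))))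
        dG' = compose₁ {R = λ x ρ → G (ρ zero) x (Mem (ρ (suc (suc zero))) (ρ (suc zero)))} fCst
                (dRen (pick (suc zero) zero (suc (suc (suc zero))) (suc (suc zero))) dG)
        step : ∀ j → (Σ C λ a → Σ C λ b → ∀ k → k < j → Inhabited k → G k m (Mem a b)) →
               Σ C λ a → Σ C λ b → ∀ k → k < S j → Inhabited k → G k m (Mem a b)
        step j (a , b , h) with em {Inhabited j}
        ... | yes I = proj₁ (I m) , proj₁ (proj₂ (I m)) , λ k l _ → antitone _ _ _ _ (s≤s⁻¹ l) (proj₂ (proj₂ (I m)))
        ... | no nI = a , b , λ k l I → either k I (<S⇒<∨≡ l)
          where
          either : ∀ k → Inhabited k → k < j ⊎ k ≡ j → G k m (Mem a b)
          either k I (inj₁ l) = h k l I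
          either k I (inj₂ refl) = ⊥-elim (nI I)
      ... | a , b , h = a , b , λ k l → h k (s≤s l)

      node-restrict : ∀ {m m' a b a' b'} → m' ≤ m → Agree m' (Mem a b) (Mem a' b') → Node m a b → Node m' a' b'
      node-restrict l h N k k≤ I = restrict _ _ _ _ _ l h (N k (≤-trans k≤ l) I)

      forced-agree : ∀ {i a b a' b'} → Agree i (Mem a b) (Mem a' b') → Forced i a b → Forced i a' b'
      forced-agree h F x y g = F x y (agree-trans g (agree-sym h))

    opaque
      -- If some extendable continuation omits `m`, it is taken. Otherwise `m` is put in: were this
      -- not extendable, all nodes of some level that continue the branch would omit `m`, and then
      -- omitting `m` would have been extendable.
      extend-leftmost : ∀ {m a b} → IsLeftmost m a b → Extendable m a b → Σ C λ a' → Σ C λ b' → IsLeftmost (S m) a' b' × Extendable (S m) a' b'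
      extend-leftmost {m} {a} {b} L E with em {Σ C λ a' → Σ C λ b' → Agree m (Mem a b) (Mem a' b') × ¬ Mem a' b' m × Extendable (S m) a' b'}
      ... | yes (a' , b' , h , nm , E') = a' , b' , (λ i l → at i (<S⇒<∨≡ l)) , E'
        where
        at : ∀ i → i < m ⊎ i ≡ m → Mem a' b' i ⟺ Forced i a' b'
        at i (inj₁ l) = (λ x → forced-agree (agree-≤ (<⇒≤ l) h) (proj₁ (L i l) (proj₂ (h i l) x))) ,
                        λ F → proj₁ (h i l) (proj₂ (L i l) (forced-agree (agree-≤ (<⇒≤ l) (agree-sym h)) F))
        at i (inj₂ refl) = (λ x → ⊥-elim (nm x)) , λ F → ⊥-elim (F a' b' (λ p _ → (λ x → x) , λ x → x) nm E')
      ... | no no-omit = a' , b' , (λ i l → at i (<S⇒<∨≡ l)) , E'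
        where
        with-m without-m : C → Set ℓ
        with-m p = p ≡ m ⊎ Mem a b p
        without-m p = p < m × Mem a b p
        c : Σ C λ a → Σ C λ b → Agree (S m) (Mem a b) with-m
        c = code {with-m} (dOr (fVar ≐ fCst) (dMem fCst fCst fVar)) (S m)
        c' : Σ C λ a → Σ C λ b → Agree (S m) (Mem a b) without-m
        c' = code {without-m} (dAnd (fVar <̇ fCst) (dMem fCst fCst fVar)) (S m)
        a' b' a'' b'' : C
        a' = proj₁ c
        b' = proj₁ (proj₂ c)
        a'' = proj₁ c'
        b'' = proj₁ (proj₂ c')
        h : Agree m (Mem a b) (Mem a' b')
        h p l = (λ x → proj₂ (proj₂ (proj₂ c) p (<-trans l n<Sn)) (inj₂ x)) , λ x → back (proj₁ (proj₂ (proj₂ c) p (<-trans l n<Sn)) x)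
          where
          back : with-m p → Mem a b p
          back (inj₁ refl) = ⊥-elim (<-irrefl l)
          back (inj₂ x) = x
        m∈ : Mem a' b' m
        m∈ = proj₂ (proj₂ (proj₂ c) m n<Sn) (inj₁ refl)
        h'' : Agree m (Mem a b) (Mem a'' b'')
        h'' p l = (λ x → proj₂ (proj₂ (proj₂ c') p (<-trans l n<Sn)) (l , x)) , λ x → proj₂ (proj₁ (proj₂ (proj₂ c') p (<-trans l n<Sn)) x)
        m∉ : ¬ Mem a'' b'' m
        m∉ x = <-irrefl (proj₁ (proj₁ (proj₂ (proj₂ c') m n<Sn) x))
        E' : Extendable (S m) a' b'
        E' m₁ l₁ = dne λ none → no-omit (a'' , b'' , h'' , m∉ , omit none)
          where
          omit : ¬ (Σ C λ x → Σ C λ y → Node m₁ x y × Agree (S m) (Mem a' b') (Mem x y)) → Extendable (S m) a'' b''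
          -- A node of the common level `m₁ + m₂` restricts to both levels: at `m₁` it shows that
          -- `m` is omitted, at `m₂` it is the continuation sought.
          omit none m₂ l₂ with E (m₁ + m₂) (≤-trans (<⇒≤ n<Sn) (≤-trans l₁ (m≤m+n m₁ m₂)))
          ... | x , y , N , g = x , y , node-restrict (m≤n+m m₂ m₁) (λ p _ → (λ x → x) , λ x → x) N , λ p l → agree p (<S⇒<∨≡ l)
            where
            m∉' : ¬ Mem x y m
            m∉' z = none (x , y , node-restrict (m≤m+n m₁ m₂) (λ p _ → (λ x → x) , λ x → x) N , λ p l → both p (<S⇒<∨≡ l))
              where
              both : ∀ p → p < m ⊎ p ≡ m → Mem a' b' p ⟺ Mem x y p
              both p (inj₁ l) = agree-trans (agree-sym h) g p l
              both p (inj₂ refl) = (λ _ → z) , λ _ → m∈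
            agree : ∀ p → p < m ⊎ p ≡ m → Mem a'' b'' p ⟺ Mem x y p
            agree p (inj₁ l) = agree-trans (agree-sym h'') g p l
            agree p (inj₂ refl) = (λ w → ⊥-elim (m∉ w)) , λ w → ⊥-elim (m∉' w)
        at : ∀ i → i < m ⊎ i ≡ m → Mem a' b' i ⟺ Forced i a' b'
        at i (inj₁ l) = (λ x → forced-agree (agree-≤ (<⇒≤ l) h) (proj₁ (L i l) (proj₂ (h i l) x))) ,
                        λ F → proj₁ (h i l) (proj₂ (L i l) (forced-agree (agree-≤ (<⇒≤ l) (agree-sym h)) F))
        at i (inj₂ refl) = (λ _ x y g n E₁ → no-omit (x , y , agree-trans h (agree-sym g) , n , E₁)) , λ _ → m∈

      leftmost-exists : ∀ m → Σ C λ a → Σ C λ b → IsLeftmost m a b × Extendable m a b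
      leftmost-exists = ind (dEx (dEx (dAnd (dLeftmost fVar (suc zero) zero) (dExtendable fVar (suc zero) zero))))
        (O , O , (λ i l → ⊥-elim (n≮0 l)) , λ m' _ → let (a , b , N) = node-exists m' in a , b , N , λ p l → ⊥-elim (n≮0 l))
        λ m (a , b , L , E) → extend-leftmost L E

      leftmost-unique : ∀ {m m' a b a' b'} → IsLeftmost m a b → IsLeftmost m' a' b' → ∀ p → p < m → p < m' → Mem a b p ⟺ Mem a' b' p
      leftmost-unique {m} {m'} {a} {b} {a'} {b'} L L' = strongInd
        (dImp (fVar <̇ fCst) (dImp (fVar <̇ fCst) (dIffP (dMem fCst fCst fVar) (dMem fCst fCst fVar))))
        λ p ih l l' → let h = λ u u<p → ih u u<p (<-trans u<p l) (<-trans u<p l') in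
          (λ x → proj₂ (L' p l') (forced-agree h (proj₁ (L p l) x))) ,
          λ x → proj₂ (L p l) (forced-agree (agree-sym h) (proj₁ (L' p l') x))

      branch : ∀ k → Inhabited k → ∀ m → G k m Path
      -- A node of level `m` is only known to serve `k` up to `m`; passing to level `m + k` covers
      -- the given `k`, and the result is then cut back to `m`.
      branch k I m with leftmost-exists (m + k)
      ... | a , b , L , E with E (m + k) ≤-refl
      ...   | a' , b' , N , h = restrict _ _ _ _ _ (m≤m+n m k) agree (N k (m≤n+m k m) I)
        where
        agree : Agree m (Mem a' b') Path
        agree p l = (λ x → a , b , (λ i i≤p → L i (≤-trans i≤p l')) , proj₂ (h p l') x) ,
                    λ { (x , y , L' , z) → proj₁ (h p l') (proj₁ (leftmost-unique L' L p n<Sn l') z) }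
          where
          l' : p < m + k
          l' = ≤-trans l (m≤m+n m k)

-- Henkin conditions

-- Twice Cantor's pair of a and b, which avoids the division by two.
Kᵗ : ∀ {n} → CTerm n → CTerm n → CTerm n
Kᵗ a b = ((a `+ b) `* `S (a `+ b)) `+ (b `+ b)

-- The tags of names start at 1, so that a name is larger than the argument of its tag. The tags 0
-- to 3 under `mem` form a separate numbering, that of the four relations.
tmᵗ wtᵗ : ∀ {n} → CTerm n → CTerm n → CTerm n → CTerm n
tmᵗ y n e = `J (numeral 1) (`J (`J y n) e)
wtᵗ y n e = `J (numeral 3) (`J (`J y n) e)

nmᵗ scᵗ : ∀ {n} → CTerm n → CTerm n
nmᵗ a = `J (numeral 2) a
scᵗ c = `J (numeral 4) c

plᵗ tiᵗ : ∀ {n} → CTerm n → CTerm n → CTerm n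
plᵗ c d = `J (numeral 5) (`J c d)
tiᵗ c d = `J (numeral 6) (`J c d)

Eqᶜ VTᶜ VFᶜ : ∀ {n} → CTerm n → CTerm n → QF n
Eqᶜ c d = mem (`J (numeral 0) (`J c d))
VTᶜ x n = mem (`J (numeral 2) (`J x n))
VFᶜ x n = mem (`J (numeral 3) (`J x n))

Trᶜ Paired : ∀ {n} → CTerm n → CTerm n → CTerm n → QF n
Trᶜ x n e = mem (`J (numeral 1) (`J (`J x n) e))
Paired x a b = (x `+ x) ≈̂ Kᵗ a b

-- The set to be approximated codes four relations: Eq (equality of names of elements), Tr (truth of the
-- formula with code x in n free variables under an environment e of names), and VT, VF (being the code of
-- a term or formula in n free variables).  Names: tm y n e is the value of a term, nm a the numeral of a,
-- wt y n e a counterexample to the universal closure of formula y, and sc, pl, ti apply the operations.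
module Theory (φ : Sentence) where
  private
    v : ∀ (k : ℕ) {k<8 : True (k ℕP.<? 8)} → CTerm 8
    v k {k<8} = var (#_ k {m<n = k<8})
    x y z q n e c i : CTerm 8
    x = v 0
    y = v 1
    z = v 2
    q = v 3
    n = v 4
    e = v 5
    c = v 6
    i = v 7

  equalityᶜ termᶜ formulaᶜ validityᶜ axiomᶜ theoryᶜ : Clause 8
  equalityᶜ =
    ⟨ Eqᶜ x x ⟩ &&
    ⟨ Eqᶜ x y ⇒̂ Eqᶜ x z ⇒̂ Eqᶜ y z ⟩ &&
    ⟨ Eqᶜ x y ⇒̂ Eqᶜ (scᵗ x) (scᵗ y) ⟩ &&
    ⟨ Eqᶜ x y ⇒̂ Eqᶜ z q ⇒̂ Eqᶜ (plᵗ x z) (plᵗ y q) ⟩ &&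
    ⟨ Eqᶜ x y ⇒̂ Eqᶜ z q ⇒̂ Eqᶜ (tiᵗ x z) (tiᵗ y q) ⟩ &&
    ⟨ Eqᶜ (nmᵗ (`S x)) (scᵗ (nmᵗ x)) ⟩
  termᶜ =
    -- An environment is a nested list with the name for variable zero in front. The next clause
    -- looks up a later variable by dropping the head of the list.
    ⟨ VTᶜ x (`S n) ⇒̂ Paired x `0 `0 ⇒̂ Eqᶜ (tmᵗ x (`S n) (`J c e)) c ⟩ &&
    ⟨ VTᶜ x (`S n) ⇒̂ VTᶜ y n ⇒̂ Paired x `0 (`S i) ⇒̂ Paired y `0 i ⇒̂ Eqᶜ (tmᵗ x (`S n) (`J c e)) (tmᵗ y n e) ⟩ &&
    ⟨ VTᶜ x n ⇒̂ Paired x (numeral 1) `0 ⇒̂ Eqᶜ (tmᵗ x n e) (nmᵗ `0) ⟩ &&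
    ⟨ VTᶜ x n ⇒̂ VTᶜ y n ⇒̂ Paired x (numeral 2) y ⇒̂ Eqᶜ (tmᵗ x n e) (scᵗ (tmᵗ y n e)) ⟩ &&
    ⟨ VTᶜ x n ⇒̂ VTᶜ y n ⇒̂ VTᶜ z n ⇒̂ Paired x (numeral 3) q ⇒̂ Paired q y z ⇒̂ Eqᶜ (tmᵗ x n e) (plᵗ (tmᵗ y n e) (tmᵗ z n e)) ⟩ &&
    ⟨ VTᶜ x n ⇒̂ VTᶜ y n ⇒̂ VTᶜ z n ⇒̂ Paired x (numeral 4) q ⇒̂ Paired q y z ⇒̂ Eqᶜ (tmᵗ x n e) (tiᵗ (tmᵗ y n e) (tmᵗ z n e)) ⟩
  formulaᶜ =
    ⟨ VFᶜ x n ⇒̂ Paired x `0 `0 ⇒̂ Trᶜ x n e ⇒̂ ⊥̂ ⟩ &&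
    ⟨ VFᶜ x n ⇒̂ VTᶜ y n ⇒̂ VTᶜ z n ⇒̂ Paired x (numeral 1) q ⇒̂ Paired q y z ⇒̂
        (Trᶜ x n e ⇒̂ Eqᶜ (tmᵗ y n e) (tmᵗ z n e)) & (Eqᶜ (tmᵗ y n e) (tmᵗ z n e) ⇒̂ Trᶜ x n e) ⟩ &&
    ⟨ VFᶜ x n ⇒̂ VFᶜ y n ⇒̂ VFᶜ z n ⇒̂ Paired x (numeral 2) q ⇒̂ Paired q y z ⇒̂
        (Trᶜ x n e ⇒̂ Trᶜ y n e ⇒̂ Trᶜ z n e) & ((Trᶜ y n e ⇒̂ Trᶜ z n e) ⇒̂ Trᶜ x n e) ⟩ &&
    -- The second half is the Henkin axiom: a formula true of its own alleged counterexample is true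
    -- of everything.
    ⟨ VFᶜ x n ⇒̂ VFᶜ y (`S n) ⇒̂ Paired x (numeral 3) y ⇒̂
        (Trᶜ x n e ⇒̂ Trᶜ y (`S n) (`J c e)) & (Trᶜ y (`S n) (`J (wtᵗ y n e) e) ⇒̂ Trᶜ x n e) ⟩
  -- No other clause forces a code into `VT` or `VF`. Being subject to `small`, these allow an
  -- approximation at a standard `k` to reject all codes from `k` on, so that truth is at stake for
  -- finitely many standard formulas only.
  validityᶜ = small x ▷ small n ▷ (
    -- `c` is the slack that witnesses `i < n`.
    ⟨ Paired x `0 i ⇒̂ (`S i `+ c) ≈̂ n ⇒̂ VTᶜ x n ⟩ &&
    ⟨ Paired x (numeral 1) `0 ⇒̂ VTᶜ x n ⟩ &&
    ⟨ VTᶜ y n ⇒̂ Paired x (numeral 2) y ⇒̂ VTᶜ x n ⟩ &&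
    ⟨ VTᶜ y n ⇒̂ VTᶜ z n ⇒̂ Paired x (numeral 3) q ⇒̂ Paired q y z ⇒̂ VTᶜ x n ⟩ &&
    ⟨ VTᶜ y n ⇒̂ VTᶜ z n ⇒̂ Paired x (numeral 4) q ⇒̂ Paired q y z ⇒̂ VTᶜ x n ⟩ &&
    ⟨ Paired x `0 `0 ⇒̂ VFᶜ x n ⟩ &&
    ⟨ VTᶜ y n ⇒̂ VTᶜ z n ⇒̂ Paired x (numeral 1) q ⇒̂ Paired q y z ⇒̂ VFᶜ x n ⟩ &&
    ⟨ VFᶜ y n ⇒̂ VFᶜ z n ⇒̂ Paired x (numeral 2) q ⇒̂ Paired q y z ⇒̂ VFᶜ x n ⟩ &&
    ⟨ VFᶜ y (`S n) ⇒̂ Paired x (numeral 3) y ⇒̂ VFᶜ x n ⟩)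
  axiomᶜ =
    axiom x ▷ ⟨ VFᶜ x `0 ⇒̂ Trᶜ x `0 `0 ⟩ &&
    -- The premise lets an approximation at small `k` leave `φ` undecided. In the limit the code of
    -- `φ` is valid, and `φ` has to be true.
    ⟨ VFᶜ (numeral (codeF φ)) `0 ⇒̂ Trᶜ (numeral (codeF φ)) `0 `0 ⟩
  theoryᶜ = equalityᶜ && termᶜ && formulaᶜ && validityᶜ && axiomᶜ

open Theory using (equalityᶜ; termᶜ; formulaᶜ; validityᶜ; axiomᶜ; theoryᶜ)

tri-double : ∀ k → tri k ℕ.+ tri k ≡ k ℕ.* suc k
tri-double zero    = refl
tri-double (suc k) = trans (rearrange k (tri k)) (trans (cong (λ t → suc k ℕ.+ suc k ℕ.+ t) (tri-double k)) (expand k))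
  where
  rearrange : ∀ k t → suc k ℕ.+ t ℕ.+ (suc k ℕ.+ t) ≡ suc k ℕ.+ suc k ℕ.+ (t ℕ.+ t)
  rearrange = solve-∀
  expand : ∀ k → suc k ℕ.+ suc k ℕ.+ k ℕ.* suc k ≡ suc k ℕ.* suc (suc k)
  expand = solve-∀

pair-double : ∀ a b → pair a b ℕ.+ pair a b ≡ (a ℕ.+ b) ℕ.* suc (a ℕ.+ b) ℕ.+ (b ℕ.+ b)
pair-double a b = trans (rearrange (tri (a ℕ.+ b)) b) (cong (ℕ._+ (b ℕ.+ b)) (tri-double (a ℕ.+ b)))
  where
  rearrange : ∀ t b → t ℕ.+ b ℕ.+ (t ℕ.+ b) ≡ t ℕ.+ t ℕ.+ (b ℕ.+ b)
  rearrange = solve-∀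

double-injective : ∀ a b → a ℕ.+ a ≡ b ℕ.+ b → a ≡ b
double-injective zero    zero    e = refl
double-injective zero    (suc b) ()
double-injective (suc a) zero    ()
double-injective (suc a) (suc b) e = cong suc (double-injective a b (ℕP.suc-injective (ℕP.suc-injective
  (trans (cong suc (sym (ℕP.+-suc a a))) (trans e (cong suc (ℕP.+-suc b b)))))))

module Names {ℓ} (M : Structure ℓ) (A : Arith M) (em₀ : ExcludedMiddle lzero) where
  open Arithmetic M A
  open Numerals M A em₀ public
  open Conditions M A using (evalC)

  tm wt : C → C → C → C
  tm y n e = J (num 1) (J (J y n) e)
  wt y n e = J (num 3) (J (J y n) e)

  nm sc : C → C
  nm a = J (num 2) a
  sc c = J (num 4) c

  pl ti : C → C → C
  pl c d = J (num 5) (J c d)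
  ti c d = J (num 6) (J c d)

  eqᵒ vtᵒ vfᵒ : C → C → C
  eqᵒ c d = J (num 0) (J c d)
  vtᵒ x n = J (num 2) (J x n)
  vfᵒ x n = J (num 3) (J x n)

  trᵒ : C → C → C → C
  trᵒ x n e = J (num 1) (J (J x n) e)

  IsPair : C → C → C → Set ℓ
  IsPair x a b = x + x ≡ (a + b) * S (a + b) + (b + b)

  env8 : C → C → C → C → C → C → C → C → Fin 8 → C
  env8 x y z q n e c i = cons M x (cons M y (cons M z (cons M q (cons M n (cons M e (cons M c (cons M i ∅)))))))

  opaque
    evalC-numeral : ∀ {n} {ρ : Fin n → C} k → evalC ρ (numeral k) ≡ num k
    evalC-numeral zero    = refl
    evalC-numeral (suc k) = cong S (evalC-numeral k)

    private
      K-num : ∀ x a b → (x N.+ x ≡ (a N.+ b) N.* suc (a N.+ b) N.+ (b N.+ b)) ⟺ IsPair (num x) (num a) (num b)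
      K-num x a b = absolute {3} (eq (#0 `+ #0) (((#1 `+ #2) `* `S (#1 `+ #2)) `+ (#2 `+ #2))) {cons ℕˢ x (cons ℕˢ a (cons ℕˢ b ∅))}
        {cons M (num x) (cons M (num a) (cons M (num b) ∅))} λ { zero → refl ; (suc zero) → refl ; (suc (suc zero)) → refl }

      flip : ∀ a b → (a ℕ.+ b) ℕ.* suc (a ℕ.+ b) ℕ.+ (b ℕ.+ b) ≡ (a N.+ b) N.* suc (a N.+ b) N.+ (b N.+ b)
      flip = flip'
        where
        flip' : ∀ a b → (a ℕ.+ b) ℕ.* suc (a ℕ.+ b) ℕ.+ (b ℕ.+ b) ≡ b ℕ.+ b ℕ.+ suc (b ℕ.+ a) ℕ.* (b ℕ.+ a)
        flip' = solve-∀

    isPair : ∀ a b → IsPair (num (pair a b)) (num a) (num b)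
    isPair a b = proj₁ (K-num (pair a b) a b) (trans (pair-double a b) (flip a b))

    isPair⁻¹ : ∀ x a b → IsPair (num x) (num a) (num b) → x ≡ pair a b
    isPair⁻¹ x a b h = double-injective x (pair a b) (trans (proj₂ (K-num x a b) h) (sym (trans (pair-double a b) (flip a b))))

-- The Henkin model

module Standard {ℓ} (M : Structure ℓ) (A : Arith M) (em₀ : ExcludedMiddle lzero) (T : Theory) where
  open Arithmetic M A
  open Numerals M A em₀

  IsStandard IsAxiomCode : C → Set ℓ
  IsStandard x = Σ ℕ λ j → x ≡ num j
  IsAxiomCode x = Σ Sentence λ σ → T σ × x ≡ num (codeF σ)

module Henkin {ℓ} (M : Structure ℓ) (A : Arith M) (em₀ : ExcludedMiddle lzero) (T : Theory) (pa : ∀ σ → PA σ → T σ)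
              (φ : Sentence) (X : Carrier M → Set ℓ) (dX : Arith.Def A {1} (λ ρ → X (ρ zero)))
              (hyp : ∀ ρ → Conditions.CSat M A (theoryᶜ φ) (Standard.IsStandard M A em₀ T) (Standard.IsAxiomCode M A em₀ T) X ρ) where
  open Arithmetic M A
  open Sequences M A
  open Names M A em₀
  open Conditions M A using (CSat)
  open Standard M A em₀ T

  infix 4 _≈_
  _≈_ : C → C → Set ℓ
  c ≈ d = X (eqᵒ c d)

  Tr : C → C → C → Set ℓ
  Tr x n e = X (trᵒ x n e)

  VT VF : C → C → Set ℓ
  VT x n = X (vtᵒ x n)
  VF x n = X (vfᵒ x n)

  equality : ∀ ρ → CSat (equalityᶜ φ) IsStandard IsAxiomCode X ρ
  equality ρ = proj₁ (hyp ρ)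

  terms : ∀ ρ → CSat (termᶜ φ) IsStandard IsAxiomCode X ρ
  terms ρ = proj₁ (proj₂ (hyp ρ))

  formulas : ∀ ρ → CSat (formulaᶜ φ) IsStandard IsAxiomCode X ρ
  formulas ρ = proj₁ (proj₂ (proj₂ (hyp ρ)))

  validity : ∀ ρ → CSat (validityᶜ φ) IsStandard IsAxiomCode X ρ
  validity ρ = proj₁ (proj₂ (proj₂ (proj₂ (hyp ρ))))

  axioms : ∀ ρ → CSat (axiomᶜ φ) IsStandard IsAxiomCode X ρ
  axioms ρ = proj₂ (proj₂ (proj₂ (proj₂ (hyp ρ))))

  opaque
    dX′ : ∀ {n} {f : Fun n} → DF f → Def (λ ρ → X (f ρ))
    dX′ d = compose₁ {R = λ x _ → X x} d (dRen (λ _ → zero) dX)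

    ≈-refl : ∀ c → c ≈ c
    ≈-refl c =
      proj₁ (equality (env8 c O O O O O O O))

    ≈-euclid : ∀ {c d d'} → c ≈ d → c ≈ d' → d ≈ d'
    ≈-euclid {c} {d} {d'} =
      proj₁ (proj₂ (equality (env8 c d d' O O O O O)))

    ≈-sym : ∀ {c d} → c ≈ d → d ≈ c
    ≈-sym h = ≈-euclid h (≈-refl _)

    ≈-trans : ∀ {c d d'} → c ≈ d → d ≈ d' → c ≈ d'
    ≈-trans h k = ≈-euclid (≈-sym h) k

    sc-cong : ∀ {c d} → c ≈ d → sc c ≈ sc d
    sc-cong {c} {d} =
      proj₁ (proj₂ (proj₂ (equality (env8 c d O O O O O O))))

    pl-cong : ∀ {c d c' d'} → c ≈ d → c' ≈ d' → pl c c' ≈ pl d d'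
    pl-cong {c} {d} {c'} {d'} =
      proj₁ (proj₂ (proj₂ (proj₂ (equality (env8 c d c' d' O O O O)))))

    ti-cong : ∀ {c d c' d'} → c ≈ d → c' ≈ d' → ti c c' ≈ ti d d'
    ti-cong {c} {d} {c'} {d'} =
      proj₁ (proj₂ (proj₂ (proj₂ (proj₂ (equality (env8 c d c' d' O O O O))))))

    nm-suc : ∀ a → nm (S a) ≈ sc (nm a)
    nm-suc a =
      proj₂ (proj₂ (proj₂ (proj₂ (proj₂ (equality (env8 a O O O O O O O))))))

    -- Induction on the actual term: its subterms have standard codes, so the hypotheses `small` can
    -- always be discharged.
    VT-code : ∀ {n} (t : Term n) → VT (num (codeT t)) (num n)
    VT-code {n} (var i) =
      proj₁ (
          validity (env8 (num (codeT (var i))) O O O (num n) O (num (n ℕ.∸ suc (toℕ i))) (num (toℕ i))) (codeT (var i) , refl) (n , refl))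
        (isPair 0 (toℕ i)) (trans (sym (num-+ (suc (toℕ i)) (n ℕ.∸ suc (toℕ i))))
                     (cong num (ℕP.m∸n+n≡m (FinP.toℕ<n i))))
    VT-code {n} `0 =
      proj₁ (proj₂ (validity (env8 (num (codeT {n} `0)) O O O (num n) O O O) (codeT {n} `0 , refl) (n , refl))) (isPair 1 0)
    VT-code {n} (`S t) =
      proj₁ (proj₂ (proj₂ (validity (env8 (num (codeT (`S t))) (num (codeT t)) O O (num n) O O O) (codeT (`S t) , refl) (n , refl))))
        (VT-code t) (isPair 2 (codeT t))
    VT-code {n} (t `+ s) =
      proj₁ (proj₂ (proj₂ (proj₂ (
          validity (env8 (num (codeT (t `+ s))) (num (codeT t)) (num (codeT s)) (num (pair (codeT t) (codeT s))) (num n) O O O) (codeT (t `+ s) , refl) (n , refl)))))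
        (VT-code t) (VT-code s) (isPair 3 (pair (codeT t) (codeT s))) (isPair (codeT t) (codeT s))
    VT-code {n} (t `* s) =
      proj₁ (proj₂ (proj₂ (proj₂ (proj₂ (
          validity (env8 (num (codeT (t `* s))) (num (codeT t)) (num (codeT s)) (num (pair (codeT t) (codeT s))) (num n) O O O) (codeT (t `* s) , refl) (n , refl))))))
        (VT-code t) (VT-code s) (isPair 4 (pair (codeT t) (codeT s))) (isPair (codeT t) (codeT s))

    VF-code : ∀ {n} (ψ : Formula n) → VF (num (codeF ψ)) (num n)
    VF-code {n} `⊥ =
      proj₁ (proj₂ (proj₂ (proj₂ (proj₂ (proj₂ (
          validity (env8 (num (codeF {n} `⊥)) O O O (num n) O O O) (codeF {n} `⊥ , refl) (n , refl)))))))
        (isPair 0 0)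
    VF-code {n} (t `≐ s) =
      proj₁ (proj₂ (proj₂ (proj₂ (proj₂ (proj₂ (proj₂ (
          validity (env8 (num (codeF (t `≐ s))) (num (codeT t)) (num (codeT s)) (num (pair (codeT t) (codeT s))) (num n) O O O) (codeF (t `≐ s) , refl) (n , refl))))))))
        (VT-code t) (VT-code s) (isPair 1 (pair (codeT t) (codeT s))) (isPair (codeT t) (codeT s))
    VF-code {n} (ψ `⇒ χ) =
      proj₁ (proj₂ (proj₂ (proj₂ (proj₂ (proj₂ (proj₂ (proj₂ (
          validity (env8 (num (codeF (ψ `⇒ χ))) (num (codeF ψ)) (num (codeF χ)) (num (pair (codeF ψ) (codeF χ))) (num n) O O O) (codeF (ψ `⇒ χ) , refl) (n , refl)))))))))
        (VF-code ψ) (VF-code χ) (isPair 2 (pair (codeF ψ) (codeF χ))) (isPair (codeF ψ) (codeF χ))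
    VF-code {n} (`∀ ψ) =
      proj₂ (proj₂ (proj₂ (proj₂ (proj₂ (proj₂ (proj₂ (proj₂ (
          validity (env8 (num (codeF (`∀ ψ))) (num (codeF ψ)) O O (num n) O O O) (codeF (`∀ ψ) , refl) (n , refl)))))))))
        (VF-code ψ) (isPair 3 (codeF ψ))

  -- Equality of names is definable, so every class has a least member. The least members serve as
  -- the elements of the model, in which equality thereby becomes identity.
  rep : C → C
  rep c = μ (c ≈_) (dX′ (fJ fCst (fJ fCst fVar)))

  opaque
    rep-≈ : ∀ c → c ≈ rep c
    rep-≈ c = proj₁ (μ-least {c ≈_} _ (c , ≈-refl c))

    rep-cong : ∀ {c d} → c ≈ d → rep c ≡ rep d
    rep-cong {c} {d} h = Least-unique
      (≈-trans (≈-sym h) (proj₁ lc) , λ u l k → proj₂ lc u l (≈-trans h k)) (μ-least {d ≈_} _ (d , ≈-refl d))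
      where
      lc : Least (c ≈_) (rep c)
      lc = μ-least {c ≈_} _ (c , ≈-refl c)

  Element : Set ℓ
  Element = Σ C λ c → rep c ≡ c

  [_] : C → Element
  [ c ] = rep c , sym (rep-cong (rep-≈ c))

  opaque
    element-≡ : ∀ {a b : Element} → proj₁ a ≡ proj₁ b → a ≡ b
    element-≡ {a , p} {_ , q} refl = cong (a ,_) (uip p q)

    []-cong : ∀ {c d} → c ≈ d → [ c ] ≡ [ d ]
    []-cong h = element-≡ (rep-cong h)

    []-cong⁻¹ : ∀ {c d} → [ c ] ≡ [ d ] → c ≈ d
    []-cong⁻¹ {c} {d} e = ≈-trans (subst (c ≈_) (cong proj₁ e) (rep-≈ c)) (≈-sym (rep-≈ d))

    []-proj : ∀ a → [ proj₁ a ] ≡ a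
    []-proj a = element-≡ (proj₂ a)

  K : Structure ℓ
  K = record { Carrier = Element ; zeroᴹ = [ nm O ] ; sucᴹ = λ a → [ sc (proj₁ a) ]
             ; _+ᴹ_ = λ a b → [ pl (proj₁ a) (proj₁ b) ] ; _*ᴹ_ = λ a b → [ ti (proj₁ a) (proj₁ b) ] }

  opaque
    [sc] : ∀ c → [ sc c ] ≡ sucᴹ K [ c ]
    [sc] c = []-cong (sc-cong (rep-≈ c))

    [pl] : ∀ c d → [ pl c d ] ≡ _+ᴹ_ K [ c ] [ d ]
    [pl] c d = []-cong (pl-cong (rep-≈ c) (rep-≈ d))

    [ti] : ∀ c d → [ ti c d ] ≡ _*ᴹ_ K [ c ] [ d ]
    [ti] c d = []-cong (ti-cong (rep-≈ c) (rep-≈ d))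

  environment : ∀ {n} → (Fin n → C) → C
  environment {zero}  g = O
  environment {suc n} g = J (g zero) (environment (λ i → g (suc i)))

  opaque
    [tm] : ∀ {n} (t : Term n) (g : Fin n → C) →
           [ tm (num (codeT t)) (num n) (environment g) ] ≡ evalT K (λ i → [ g i ]) t
    [tm] {suc n} (var zero) g =
      []-cong ((proj₁ (terms (env8 (num (pair 0 0)) O O O (num n) (environment (λ i → g (suc i))) (g zero) O)))
        (VT-code {suc n} (var zero)) (isPair 0 0))
    [tm] {suc n} (var (suc i)) g =
      trans ([]-cong ((proj₁ (proj₂ (
          terms (env8 (num (pair 0 (suc (toℕ i)))) (num (pair 0 (toℕ i))) O O (num n) (environment (λ i → g (suc i))) (g zero) (num (toℕ i))))))
        (VT-code (var (suc i))) (VT-code (var i)) (isPair 0 (suc (toℕ i))) (isPair 0 (toℕ i))))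
      ([tm] (var i) (λ i → g (suc i)))
    [tm] {n} `0 g =
      []-cong ((proj₁ (proj₂ (proj₂ (terms (env8 (num (pair 1 0)) O O O (num n) (environment g) O O))))) (VT-code {n} `0) (isPair 1 0))
    [tm] {n} (`S t) g =
      trans ([]-cong ((proj₁ (proj₂ (proj₂ (proj₂ (terms (env8 (num (codeT (`S t))) (num (codeT t)) O O (num n) (environment g) O O))))))
        (VT-code (`S t)) (VT-code t) (isPair 2 (codeT t))))
      (trans ([sc] _) (cong (sucᴹ K) ([tm] t g)))
    [tm] {n} (t `+ s) g =
      trans ([]-cong ((proj₁ (proj₂ (proj₂ (proj₂ (proj₂ (
          terms (env8 (num (codeT (t `+ s))) (num (codeT t)) (num (codeT s)) (num (pair (codeT t) (codeT s))) (num n) (environment g) O O)))))))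
        (VT-code (t `+ s)) (VT-code t) (VT-code s) (isPair 3 (pair (codeT t) (codeT s))) (isPair (codeT t) (codeT s))))
      (trans ([pl] _ _) (cong₂ (_+ᴹ_ K) ([tm] t g) ([tm] s g)))
    [tm] {n} (t `* s) g =
      trans ([]-cong ((proj₂ (proj₂ (proj₂ (proj₂ (proj₂ (
          terms (env8 (num (codeT (t `* s))) (num (codeT t)) (num (codeT s)) (num (pair (codeT t) (codeT s))) (num n) (environment g) O O)))))))
        (VT-code (t `* s)) (VT-code t) (VT-code s) (isPair 4 (pair (codeT t) (codeT s))) (isPair (codeT t) (codeT s))))
      (trans ([ti] _ _) (cong₂ (_*ᴹ_ K) ([tm] t g) ([tm] s g)))

  open Semantics K using (Sat-ext)

  opaque
    -- Induction on the actual formula. The quantifier case puts a name in front of the environment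
    -- instead of substituting it; every element is the class of a name, and the witness name
    -- handles the converse.
    truth : ∀ {n} (ψ : Formula n) (g : Fin n → C) → Tr (num (codeF ψ)) (num n) (environment g) ⟺ Sat K (λ i → [ g i ]) ψ
    truth {n} `⊥ g =
      (λ x → (proj₁ (formulas (env8 (num (pair 0 0)) O O O (num n) (environment g) O O))) (VF-code {n} `⊥) (isPair 0 0) x) , λ b → ⊥-elim (lower b)
    truth {n} (t `≐ s) g =
      (λ x → trans (sym ([tm] t g)) (trans ([]-cong (proj₁ clause x)) ([tm] s g))) ,
      λ e → proj₂ clause ([]-cong⁻¹ (trans ([tm] t g) (trans e (sym ([tm] s g)))))
      where
      e : C
      e = environment g
      clause : (Tr (num (codeF (t `≐ s))) (num n) e → tm (num (codeT t)) (num n) e ≈ tm (num (codeT s)) (num n) e) ×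
               (tm (num (codeT t)) (num n) e ≈ tm (num (codeT s)) (num n) e → Tr (num (codeF (t `≐ s))) (num n) e)
      clause = proj₁ (proj₂ (
          formulas (env8 (num (codeF (t `≐ s))) (num (codeT t)) (num (codeT s)) (num (pair (codeT t) (codeT s))) (num n) (environment g) O O)))
        (VF-code (t `≐ s)) (VT-code t) (VT-code s) (isPair 1 (pair (codeT t) (codeT s))) (isPair (codeT t) (codeT s))
    truth {n} (ψ `⇒ χ) g =
      (λ x y → proj₁ (truth χ g) (proj₁ clause x (proj₂ (truth ψ g) y))) ,
      λ f → proj₂ clause λ y → proj₂ (truth χ g) (f (proj₁ (truth ψ g) y))
      where
      e : C
      e = environment g
      clause : (Tr (num (codeF (ψ `⇒ χ))) (num n) e → Tr (num (codeF ψ)) (num n) e → Tr (num (codeF χ)) (num n) e) ×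
               ((Tr (num (codeF ψ)) (num n) e → Tr (num (codeF χ)) (num n) e) → Tr (num (codeF (ψ `⇒ χ))) (num n) e)
      clause = proj₁ (proj₂ (proj₂ (
          formulas (env8 (num (codeF (ψ `⇒ χ))) (num (codeF ψ)) (num (codeF χ)) (num (pair (codeF ψ) (codeF χ))) (num n) (environment g) O O))))
        (VF-code (ψ `⇒ χ)) (VF-code ψ) (VF-code χ) (isPair 2 (pair (codeF ψ) (codeF χ))) (isPair (codeF ψ) (codeF χ))
    truth {n} (`∀ ψ) g = forth , back
      where
      clauses : ∀ c → (Tr (num (codeF (`∀ ψ))) (num n) (environment g) → Tr (num (codeF ψ)) (S (num n)) (J c (environment g))) ×
                      (Tr (num (codeF ψ)) (S (num n)) (J (wt (num (codeF ψ)) (num n) (environment g)) (environment g)) → Tr (num (codeF (`∀ ψ))) (num n) (environment g))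
      clauses c = (proj₂ (proj₂ (proj₂ (formulas (env8 (num (codeF (`∀ ψ))) (num (codeF ψ)) O O (num n) (environment g) c O)))))
        (VF-code (`∀ ψ)) (VF-code ψ) (isPair 3 (codeF ψ))
      forth : Tr (num (codeF (`∀ ψ))) (num n) (environment g) → ∀ a → Sat K (cons K a (λ i → [ g i ])) ψ
      forth x a = Sat-ext (λ { zero → []-proj a ; (suc i) → refl }) ψ
        (proj₁ (truth ψ (cons M (proj₁ a) g)) (proj₁ (clauses (proj₁ a)) x))
      w : C
      w = wt (num (codeF ψ)) (num n) (environment g)
      back : (∀ a → Sat K (cons K a (λ i → [ g i ])) ψ) → Tr (num (codeF (`∀ ψ))) (num n) (environment g)
      back f = proj₂ (clauses O) (proj₂ (truth ψ (cons M w g)) (Sat-ext (λ { zero → refl ; (suc i) → refl }) ψ (f [ w ])))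

    K⊨T : K ⊨T T
    K⊨T σ Tσ =
      Sat-ext (λ ()) σ (proj₁ (truth σ ∅) ((proj₁ (axioms (env8 (num (codeF σ)) O O O O O O O))) (σ , Tσ , refl) (VF-code σ)))

    K⊨φ : K ⊨ φ
    K⊨φ =
      Sat-ext (λ ()) φ (proj₁ (truth φ ∅) (subst (λ x → Tr x O O) (evalC-numeral (codeF φ))
      ((proj₂ (axioms (env8 O O O O O O O O))) (subst (λ x → VF x O) (sym (evalC-numeral (codeF φ))) (VF-code φ)))))

  opaque
    KA : Arith K
    KA = Definability.arith K em (λ σ h → K⊨T σ (pa σ h))

  module KA = Arithmetic K KA

  emb : C → Element
  emb a = [ nm a ]

  opaque
    emb-suc : ∀ a → emb (S a) ≡ sucᴹ K (emb a)
    emb-suc a = trans ([]-cong (nm-suc a)) ([sc] (nm a))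

    -- The induction takes place in `M`, where the statement is definable because it speaks of names
    -- and of `X`. The recursion equations needed on the other side are axioms true in `K`.
    emb-+ : ∀ a b → emb (a + b) ≡ _+ᴹ_ K (emb a) (emb b)
    emb-+ a b = trans ([]-cong (ind {λ b → nm (a + b) ≈ pl (nm a) (nm b)}
        (dX′ (fJ fCst (fJ (fJ fCst (fCst ⊕ fVar)) (fJ fCst (fJ (fJ fCst fCst) (fJ fCst fVar)))))) base′ step b)) ([pl] _ _)
      where
      base′ : nm (a + O) ≈ pl (nm a) (nm O)
      base′ = []-cong⁻¹ (trans (cong emb (+0 a)) (trans (sym (KA.+0 (emb a))) (sym ([pl] _ _))))
      step : ∀ b → nm (a + b) ≈ pl (nm a) (nm b) → nm (a + S b) ≈ pl (nm a) (nm (S b))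
      step b h = []-cong⁻¹ (begin
        emb (a + S b)                        ≡⟨ cong emb (+S a b) ⟩
        emb (S (a + b))                      ≡⟨ emb-suc (a + b) ⟩
        KA.S (emb (a + b))                   ≡⟨ cong KA.S (trans ([]-cong h) ([pl] _ _)) ⟩
        KA.S (emb a KA.+ emb b)              ≡⟨ sym (KA.+S (emb a) (emb b)) ⟩
        emb a KA.+ KA.S (emb b)              ≡⟨ cong (emb a KA.+_) (sym (emb-suc b)) ⟩
        emb a KA.+ emb (S b)                 ≡⟨ sym ([pl] _ _) ⟩
        [ pl (nm a) (nm (S b)) ] ∎)
        where open ≡-Reasoning

    emb-* : ∀ a b → emb (a * b) ≡ _*ᴹ_ K (emb a) (emb b)
    emb-* a b = trans ([]-cong (ind {λ b → nm (a * b) ≈ ti (nm a) (nm b)}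
        (dX′ (fJ fCst (fJ (fJ fCst (fCst ⊛ fVar)) (fJ fCst (fJ (fJ fCst fCst) (fJ fCst fVar)))))) base′ step b)) ([ti] _ _)
      where
      base′ : nm (a * O) ≈ ti (nm a) (nm O)
      base′ = []-cong⁻¹ (trans (cong emb (*0 a)) (trans (sym (KA.*0 (emb a))) (sym ([ti] _ _))))
      step : ∀ b → nm (a * b) ≈ ti (nm a) (nm b) → nm (a * S b) ≈ ti (nm a) (nm (S b))
      step b h = []-cong⁻¹ (begin
        emb (a * S b)                        ≡⟨ cong emb (*S a b) ⟩
        emb (a * b + a)                      ≡⟨ emb-+ (a * b) a ⟩
        emb (a * b) KA.+ emb a               ≡⟨ cong (KA._+ emb a) (trans ([]-cong h) ([ti] _ _)) ⟩
        (emb a KA.* emb b) KA.+ emb a        ≡⟨ sym (KA.*S (emb a) (emb b)) ⟩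
        emb a KA.* KA.S (emb b)              ≡⟨ cong (emb a KA.*_) (sym (emb-suc b)) ⟩
        emb a KA.* emb (S b)                 ≡⟨ sym ([ti] _ _) ⟩
        [ ti (nm a) (nm (S b)) ] ∎)
        where open ≡-Reasoning

    emb-< : ∀ {a b} → a < b → emb a KA.< emb b
    emb-< {a} (z , refl) = emb z , trans (cong (KA._+ emb z) (sym (emb-suc a))) (sym (emb-+ (S a) z))

    emb-inj : ∀ a b → emb a ≡ emb b → a ≡ b
    emb-inj a b e with a ≤? b
    ... | inj₂ l = ⊥-elim (KA.<-irrefl (subst (emb b KA.<_) e (emb-< l)))
    ... | inj₁ l with ≤⇒<∨≡ l
    ...   | inj₁ m = ⊥-elim (KA.<-irrefl (subst (emb a KA.<_) (sym e) (emb-< m)))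
    ...   | inj₂ r = r

    -- Induction on `b` inside `M`, with the statement phrased for names to keep it definable. If
    -- `z` is zero in `K`, then `c` is the numeral of the bound itself; if it is a successor, one
    -- successor is cancelled and the bound decreases.
    emb-initial : ∀ b c z → pl c z ≈ nm b → Σ C λ a → nm a ≈ c
    emb-initial = ind
      (dAll (dAll (dImp (dX′ (fJ fCst (fJ (fJ fCst (fJ fVar fVar)) (fJ fCst fVar)))) (dEx (dX′ (fJ fCst (fJ (fJ fCst fVar) fVar)))))))
      (λ c z h → O , []-cong⁻¹ (sym (proj₁ (KA.+≡0 {[ c ]} {[ z ]} (trans (sym ([pl] c z)) ([]-cong h))))))
      step
      where
      step : ∀ b → (∀ c z → pl c z ≈ nm b → Σ C λ a → nm a ≈ c) → ∀ c z → pl c z ≈ nm (S b) → Σ C λ a → nm a ≈ c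
      step b ih c z h = split (KA.zero? [ z ])
        where
        sum : [ c ] KA.+ [ z ] ≡ KA.S (emb b)
        sum = trans (sym ([pl] c z)) (trans ([]-cong h) (emb-suc b))
        split : [ z ] ≡ KA.O ⊎ Σ Element (λ y → [ z ] ≡ KA.S y) → Σ C λ a → nm a ≈ c
        split (inj₁ e) = S b , []-cong⁻¹ (trans (emb-suc b) (trans (sym sum) (trans (cong ([ c ] KA.+_) e) (KA.+0 [ c ]))))
        split (inj₂ (y , e)) = ih c (proj₁ y) ([]-cong⁻¹ (trans ([pl] c (proj₁ y)) (trans (cong ([ c ] KA.+_) ([]-proj y))
          (KA.Sinj _ _ (trans (sym (KA.+S [ c ] y)) (trans (cong ([ c ] KA.+_) (sym e)) sum))))))

  extension : EndExtension M K
  extension = record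
    { emb = emb ; inj = emb-inj ; pres-0 = refl ; pres-S = emb-suc ; pres-+ = emb-+ ; pres-* = emb-*
    ; initial = λ { c b (z , h) → let (a , e) = emb-initial b (proj₁ c) (proj₁ z) ([]-cong⁻¹ h)
                                  in a , trans ([]-cong e) ([]-proj c) } }

-- Values of names

tri-mono : ∀ {s t} → s ℕ.≤ t → tri s ℕ.≤ tri t
tri-mono ℕ.z≤n       = ℕ.z≤n
tri-mono (ℕ.s≤s h) = ℕP.+-mono-≤ (ℕ.s≤s h) (tri-mono h)

pair-injective : ∀ a b c d → pair a b ≡ pair c d → a ≡ c × b ≡ d
pair-injective a b c d e = ℕP.+-cancelʳ-≡ b a c (trans sums (cong (c ℕ.+_) (sym b≡d))) , b≡d
  where
  bound : ∀ a b c d → a ℕ.+ b ℕ.< c ℕ.+ d → pair a b ℕ.< pair c d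
  bound a b c d l = ℕP.≤-trans (ℕ.s≤s (ℕP.≤-trans (ℕP.+-monoʳ-≤ (tri (a ℕ.+ b)) (ℕP.m≤n+m b a)) (ℕP.≤-reflexive (ℕP.+-comm (tri (a ℕ.+ b)) _))))
    (ℕP.≤-trans (tri-mono l) (ℕP.m≤m+n (tri (c ℕ.+ d)) d))
  sums : a ℕ.+ b ≡ c ℕ.+ d
  sums = ℕP.≤-antisym (ℕP.≮⇒≥ λ l → ℕP.<-irrefl (sym e) (bound c d a b l)) (ℕP.≮⇒≥ λ l → ℕP.<-irrefl e (bound a b c d l))
  b≡d : b ≡ d
  b≡d = ℕP.+-cancelˡ-≡ (tri (a ℕ.+ b)) b d (trans e (cong (λ s → tri s ℕ.+ d) (sym sums)))

-- Separating the tag from its argument reduces the injectivity of codes to the cases with equal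
-- head symbols.
tagT argT : ∀ {n} → Term n → ℕ
tagT (var i)  = 0
tagT `0       = 1
tagT (`S t)   = 2
tagT (t `+ s) = 3
tagT (t `* s) = 4
argT (var i)  = toℕ i
argT `0       = 0
argT (`S t)   = codeT t
argT (t `+ s) = pair (codeT t) (codeT s)
argT (t `* s) = pair (codeT t) (codeT s)

codeT-pair : ∀ {n} (t : Term n) → codeT t ≡ pair (tagT t) (argT t)
codeT-pair (var i)  = refl
codeT-pair `0       = refl
codeT-pair (`S t)   = refl
codeT-pair (t `+ s) = refl
codeT-pair (t `* s) = refl

codeT-tag : ∀ {n m} (t : Term n) (s : Term m) → codeT t ≡ codeT s → tagT t ≡ tagT s × argT t ≡ argT s
codeT-tag t s e = pair-injective (tagT t) (argT t) (tagT s) (argT s) (trans (sym (codeT-pair t)) (trans e (codeT-pair s)))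

codeT-injective : ∀ {n} (t s : Term n) → codeT t ≡ codeT s → t ≡ s
codeT-injective t s e = same t s (proj₁ (codeT-tag t s e)) (proj₂ (codeT-tag t s e))
  where
  same : ∀ {n} (t s : Term n) → tagT t ≡ tagT s → argT t ≡ argT s → t ≡ s
  same (var i)  (var j)    refl e = cong var (FinP.toℕ-injective e)
  same `0       `0         refl e = refl
  same (`S t)   (`S s)     refl e = cong `S (codeT-injective t s e)
  same (t `+ s) (t' `+ s') refl e = cong₂ _`+_ (codeT-injective t t' (proj₁ (pair-injective (codeT t) (codeT s) (codeT t') (codeT s') e))) (codeT-injective s s' (proj₂ (pair-injective (codeT t) (codeT s) (codeT t') (codeT s') e)))
  same (t `* s) (t' `* s') refl e = cong₂ _`*_ (codeT-injective t t' (proj₁ (pair-injective (codeT t) (codeT s) (codeT t') (codeT s') e))) (codeT-injective s s' (proj₂ (pair-injective (codeT t) (codeT s) (codeT t') (codeT s') e)))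

codeT-var : ∀ {n} (t : Term n) {i} → codeT t ≡ pair 0 i → Σ (Fin n) λ j → t ≡ var j × toℕ j ≡ i
codeT-var {n} t {i} e = find t (proj₁ tags) (proj₂ tags)
  where
  tags : tagT t ≡ 0 × argT t ≡ i
  tags = pair-injective (tagT t) (argT t) 0 i (trans (sym (codeT-pair t)) e)
  find : ∀ (t : Term n) → tagT t ≡ 0 → argT t ≡ i → Σ (Fin n) λ j → t ≡ var j × toℕ j ≡ i
  find (var j) refl e = j , refl , e

tagF argF : ∀ {n} → Formula n → ℕ
tagF `⊥       = 0
tagF (t `≐ s) = 1
tagF (φ `⇒ ψ) = 2
tagF (`∀ φ)   = 3
argF `⊥       = 0
argF (t `≐ s) = pair (codeT t) (codeT s)
argF (φ `⇒ ψ) = pair (codeF φ) (codeF ψ)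
argF (`∀ φ)   = codeF φ

codeF-pair : ∀ {n} (φ : Formula n) → codeF φ ≡ pair (tagF φ) (argF φ)
codeF-pair `⊥       = refl
codeF-pair (t `≐ s) = refl
codeF-pair (φ `⇒ ψ) = refl
codeF-pair (`∀ φ)   = refl

codeF-injective : ∀ {n} (φ ψ : Formula n) → codeF φ ≡ codeF ψ → φ ≡ ψ
codeF-injective φ ψ e = same φ ψ (proj₁ tags) (proj₂ tags)
  where
  tags : tagF φ ≡ tagF ψ × argF φ ≡ argF ψ
  tags = pair-injective (tagF φ) (argF φ) (tagF ψ) (argF ψ) (trans (sym (codeF-pair φ)) (trans e (codeF-pair ψ)))
  same : ∀ {n} (φ ψ : Formula n) → tagF φ ≡ tagF ψ → argF φ ≡ argF ψ → φ ≡ ψ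
  same `⊥       `⊥         refl e = refl
  same (t `≐ s) (t' `≐ s') refl e = cong₂ _`≐_ (codeT-injective t t' (proj₁ (pair-injective (codeT t) (codeT s) (codeT t') (codeT s') e))) (codeT-injective s s' (proj₂ (pair-injective (codeT t) (codeT s) (codeT t') (codeT s') e)))
  same (φ `⇒ ψ) (φ' `⇒ ψ') refl e = cong₂ _`⇒_ (codeF-injective φ φ' (proj₁ (pair-injective (codeF φ) (codeF ψ) (codeF φ') (codeF ψ') e))) (codeF-injective ψ ψ' (proj₂ (pair-injective (codeF φ) (codeF ψ) (codeF φ') (codeF ψ') e)))
  same (`∀ φ)   (`∀ ψ)     refl e = cong `∀ (codeF-injective φ ψ e)

-- The number of variables is bounded besides the code, since one code may belong to expressions in
-- arbitrarily many variables: that of zero occurs at every arity.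
Coded : (F : ℕ → Set) → (∀ {n} → F n → ℕ) → ℕ → Set
Coded F code k = Σ ℕ λ n → Σ (F n) λ t → n ℕ.< k × code t ℕ.< k

TermCode FormulaCode WitnessCode : ℕ → Set
TermCode    = Coded Term codeT
FormulaCode = Coded Formula codeF
WitnessCode = Coded (λ n → Formula (suc n)) codeF

-- Finite conjunctions and satisfaction of actual formulas

module FiniteDefinability {ℓ} (M : Structure ℓ) (A : Arith M) (em₀ : ExcludedMiddle lzero) where
  open Arithmetic M A
  open Semantics M using (Sat-ext)

  -- Finiteness in the sense relevant here: conjunctions over the index set preserve definability.
  -- Truth as a whole is not definable, but truth of the finitely many formulas below a standard
  -- bound is, by such a conjunction.
  Finitary : Set → Set (lsuc ℓ)
  Finitary I = ∀ {n} {P : I → Pred n} → (∀ i → Def (P i)) → Def (λ ρ → ∀ i → P i ρ)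

  opaque
    dTrue : ∀ {n} {P : Pred n} → (∀ ρ → P ρ) → Def P
    dTrue h = dIff (λ ρ → (λ _ → h ρ) , λ _ x → x) (dImp d⊥ d⊥)

    finitary-Fin : ∀ k → Finitary (Fin k)
    finitary-Fin zero    d = dTrue (λ ρ ())
    finitary-Fin (suc k) {P = P} d = dIff (λ ρ → (λ { (x , f) zero → x ; (x , f) (suc i) → f i }) , λ f → f zero , λ i → f (suc i))
      (dAnd (d zero) (finitary-Fin k {P = λ i → P (suc i)} (λ i → d (suc i))))

    finitary-prop : ∀ {I : Set} → (∀ (i j : I) → i ≡ j) → Finitary I
    finitary-prop {I} unique {P = P} d with em₀ {I}
    ... | yes i = dIff (λ ρ → (λ x j → subst (λ i → P i ρ) (unique i j) x) , λ f → f i) (d i)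
    ... | no n  = dTrue (λ ρ i → ⊥-elim (n i))

    finitary-Σ : ∀ {I : Set} {J : I → Set} → Finitary I → (∀ i → Finitary (J i)) → Finitary (Σ I J)
    finitary-Σ s t {P = P} d = dIff (λ ρ → (λ { f (i , j) → f i j }) , λ f i j → f (i , j))
      (s λ i → t i {P = λ j → P (i , j)} λ j → d (i , j))

    finitary-image : ∀ {I J : Set} → Finitary I → (g : I → J) → (∀ j → Σ I λ i → g i ≡ j) → Finitary J
    finitary-image s g surj {P = P} d = dIff (λ ρ → (λ f j → subst (λ j → P j ρ) (proj₂ (surj j)) (f (proj₁ (surj j)))) , λ f i → f (g i))
      (s {P = λ i → P (g i)} λ i → d (g i))

    -- The expressions are indexed by arity and code, both below `k`. Over each such pair there is
    -- at most one expression, by injectivity of the coding.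
    finitary-Coded : ∀ {F : ℕ → Set} {code : ∀ {n} → F n → ℕ} → (∀ {n} (t s : F n) → code t ≡ code s → t ≡ s) → ∀ k → Finitary (Coded F code k)
    finitary-Coded {F} {code} inj k = finitary-image
      (finitary-Σ {J = λ n → Σ (Fin k) λ j → Σ (F (toℕ n)) λ t → code t ≡ toℕ j} (finitary-Fin k) λ n →
        finitary-Σ {J = λ j → Σ (F (toℕ n)) λ t → code t ≡ toℕ j} (finitary-Fin k) λ j → finitary-prop (unique n j))
      decode
      λ { (n , t , n<k , t<k) → onto n t n<k t<k (fromℕ< n<k) (fromℕ< t<k) (FinP.toℕ-fromℕ< n<k) (FinP.toℕ-fromℕ< t<k) }
      where
      Index : Set
      Index = Σ (Fin k) λ n → Σ (Fin k) λ j → Σ (F (toℕ n)) λ t → code t ≡ toℕ j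
      decode : Index → Coded F code k
      decode (n , j , t , e) = toℕ n , t , FinP.toℕ<n n , subst (ℕ._< k) (sym e) (FinP.toℕ<n j)
      unique : ∀ (n j : Fin k) (x y : Σ (F (toℕ n)) λ t → code t ≡ toℕ j) → x ≡ y
      unique n j (t , e) (s , e') with inj t s (trans e (sym e'))
      ... | refl = cong (t ,_) (uip e e')
      onto : ∀ n (t : F n) (n<k : n ℕ.< k) (t<k : code t ℕ.< k) (i j : Fin k) → toℕ i ≡ n → toℕ j ≡ code t →
             Σ Index λ x → decode x ≡ (n , t , n<k , t<k)
      onto _ t n<k t<k i j refl e = (i , j , t , sym e) , cong₂ (λ p q → toℕ i , t , p , q) (ℕP.<-irrelevant _ _) (ℕP.<-irrelevant _ _)

    dExFinitary : ∀ {I : Set} → Finitary I → ∀ {n} {P : I → Pred n} → (∀ i → Def (P i)) → Def (λ ρ → Σ I λ i → P i ρ)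
    dExFinitary s {P = P} d = dIff (λ ρ → (λ f → dne λ n → f λ i x → n (i , x)) , λ { (i , x) f → f i x })
      (dNot (s {P = λ i ρ → ¬ P i ρ} λ i → dNot (d i)))

    fEval : ∀ {n m} (t : Term m) {g : Fin m → Fun n} → (∀ i → DF (g i)) → DF (λ ρ → evalT M (λ i → g i ρ) t)
    fEval (var i)  d = d i
    fEval `0       d = fCst
    fEval (`S t)   d = fSuc (fEval t d)
    fEval (t `+ s) d = fEval t d ⊕ fEval s d
    fEval (t `* s) d = fEval t d ⊛ fEval s d

    dSat : ∀ {n m} (φ : Formula m) {g : Fin m → Fun n} → (∀ i → DF (g i)) → Def (λ ρ → Sat M (λ i → g i ρ) φ)
    dSat `⊥       d = d⊥
    dSat (t `≐ s) d = fEval t d ≐ fEval s d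
    dSat (φ `⇒ ψ) d = dImp (dSat φ d) (dSat ψ d)
    dSat {n} {m} (`∀ φ) {g} d = dAll (dIff
        (λ ρ → Sat-ext (λ { zero → refl ; (suc i) → refl }) φ , Sat-ext (λ { zero → refl ; (suc i) → refl }) φ)
        (dSat φ {g'} λ { zero → fVar ; (suc i) → weaken (d i) }))
      where
      g' : Fin (suc m) → Fun (suc n)
      g' zero    ρ = ρ zero
      g' (suc i) ρ = g i (λ j → ρ (suc j))

module Valuation {ℓ} (M : Structure ℓ) (A : Arith M) (em₀ : ExcludedMiddle lzero) (k : ℕ) where
  open Arithmetic M A
  open Sequences M A
  open Names M A em₀
  open Semantics M
  open FiniteDefinability M A em₀

  hd tl : C → C
  hd e = μ (λ c → Σ C λ e' → e ≡ J c e') (dEx (fCst ≐ fJ fVar fVar))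
  tl e = μ (λ e' → Σ C λ c → e ≡ J c e') (dEx (fCst ≐ fJ fVar fVar))

  entry : ∀ {n} → C → Fin n → C
  entry e zero    = hd e
  entry e (suc i) = entry (tl e) i

  val : C → C → C → C
  val a b c = μ (λ v → Mem a b (J c v)) (dMem fCst fCst (fJ fCst fVar))

  opaque
    fhd : ∀ {n} {f : Fun n} → DF f → DF (λ ρ → hd (f ρ))
    fhd {f = f} d = fμ {P = λ ρ c → Σ C λ e' → f ρ ≡ J c e'} (dEx (weaken (weaken d) ≐ fJ fVar fVar))

    ftl : ∀ {n} {f : Fun n} → DF f → DF (λ ρ → tl (f ρ))
    ftl {f = f} d = fμ {P = λ ρ e' → Σ C λ c → f ρ ≡ J c e'} (dEx (weaken (weaken d) ≐ fJ fVar fVar))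

    fentry : ∀ {n m} {f : Fun n} (i : Fin m) → DF f → DF (λ ρ → entry (f ρ) i)
    fentry zero    d = fhd d
    fentry (suc i) d = fentry i (ftl d)

    fval : ∀ {n} {f g h : Fun n} → DF f → DF g → DF h → DF (λ ρ → val (f ρ) (g ρ) (h ρ))
    fval {f = f} {g} {h} d e p = fμ {P = λ ρ v → Mem (f ρ) (g ρ) (J (h ρ) v)} (dMem (weaken d) (weaken e) (fJ (weaken p) fVar))

    hd-J : ∀ c e → hd (J c e) ≡ c
    hd-J c e with μ-least {λ c' → Σ C λ e' → J c e ≡ J c' e'} (dEx (fCst ≐ fJ fVar fVar)) (c , e , refl)
    ... | (e' , h) , _ = sym (proj₁ (J-inj h))

    tl-J : ∀ c e → tl (J c e) ≡ e
    tl-J c e with μ-least {λ e' → Σ C λ c' → J c e ≡ J c' e'} (dEx (fCst ≐ fJ fVar fVar)) (e , c , refl)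
    ... | (c' , h) , _ = sym (proj₂ (J-inj h))

    hd-≤ : ∀ e → hd e ≤ e
    hd-≤ e with em {Σ C λ c → Σ C λ e' → e ≡ J c e'}
    ... | yes (c , e' , refl) = ≤-trans (≤-reflexive (hd-J c e')) (≤J₁ c e')
    ... | no n = ≤-trans (≤-reflexive (μ-zero _ n)) O≤

    tl-≤ : ∀ e → tl e ≤ e
    tl-≤ e with em {Σ C λ e' → Σ C λ c → e ≡ J c e'}
    ... | yes (e' , c , refl) = ≤-trans (≤-reflexive (tl-J c e')) (≤J₂ c e')
    ... | no n = ≤-trans (≤-reflexive (μ-zero _ n)) O≤

    entry-≤ : ∀ {n} e (i : Fin n) → entry e i ≤ e
    entry-≤ e zero    = hd-≤ e
    entry-≤ e (suc i) = ≤-trans (entry-≤ (tl e) i) (tl-≤ e)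

  -- What the value v of the name J (num t) r has to satisfy, in terms of the values f of smaller names.
  Cond : ℕ → (C → C) → C → C → Set ℓ
  Cond 1 f r v = (c : TermCode k) → hd (hd r) ≡ num (codeT (proj₁ (proj₂ c))) → tl (hd r) ≡ num (proj₁ c) →
                 v ≡ evalT M (λ i → f (entry (tl r) i)) (proj₁ (proj₂ c))
  Cond 2 f r v = v ≡ r
  -- As in the drinker's paradox: `v` is a counterexample if there is one, and otherwise arbitrary.
  Cond 3 f r v = (c : WitnessCode k) → hd (hd r) ≡ num (codeF (proj₁ (proj₂ c))) → tl (hd r) ≡ num (proj₁ c) →
                 Sat M (cons M v (λ i → f (entry (tl r) i))) (proj₁ (proj₂ c)) →
                 ∀ a → Sat M (cons M a (λ i → f (entry (tl r) i))) (proj₁ (proj₂ c))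
  Cond 4 f r v = v ≡ S (f r)
  Cond 5 f r v = v ≡ f (hd r) + f (tl r)
  Cond 6 f r v = v ≡ f (hd r) * f (tl r)
  Cond _ f r v = Lift ℓ ⊤

  Local : (C → C) → C → C → Set ℓ
  Local f c v = ∀ (t : Fin 7) r → c ≡ J (num (toℕ t)) r → Cond (toℕ t) f r v

  private
    consᶠ : ∀ {n m} → Fun n → (Fin m → Fun n) → Fin (suc m) → Fun n
    consᶠ v g zero    = v
    consᶠ v g (suc i) = g i

    dcons : ∀ {n m} {v : Fun n} {g : Fin m → Fun n} → DF v → (∀ i → DF (g i)) → ∀ i → DF (consᶠ v g i)
    dcons d e zero    = d
    dcons d e (suc i) = e i

  opaque
    dSat-cons : ∀ {n m} (φ : Formula (suc m)) {v : Fun n} {g : Fin m → Fun n} → DF v → (∀ i → DF (g i)) →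
                Def (λ ρ → Sat M (cons M (v ρ) (λ i → g i ρ)) φ)
    dSat-cons φ {v} {g} d e = dIff
      (λ ρ → Sat-ext (λ { zero → refl ; (suc i) → refl }) φ , Sat-ext (λ { zero → refl ; (suc i) → refl }) φ)
      (dSat φ {consᶠ v g} (dcons d e))

    dCond : ∀ t {n} {a b r v : Fun n} → DF a → DF b → DF r → DF v → Def (λ ρ → Cond t (val (a ρ) (b ρ)) (r ρ) (v ρ))
    dCond 0 da db dr dv = dTrue (λ _ → lift tt)
    dCond 1 {a = a} {b} {r} {v} da db dr dv = finitary-Coded codeT-injective k
      {P = λ c ρ → hd (hd (r ρ)) ≡ num (codeT (proj₁ (proj₂ c))) → tl (hd (r ρ)) ≡ num (proj₁ c) →
                   v ρ ≡ evalT M (λ i → val (a ρ) (b ρ) (entry (tl (r ρ)) i)) (proj₁ (proj₂ c))}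
      λ c → dImp (fhd (fhd dr) ≐ fCst) (dImp (ftl (fhd dr) ≐ fCst)
        (dv ≐ fEval (proj₁ (proj₂ c)) (λ i → fval da db (fentry i (ftl dr)))))
    dCond 2 da db dr dv = dv ≐ dr
    dCond 3 {a = a} {b} {r} {v} da db dr dv = finitary-Coded codeF-injective k
      {P = λ c ρ → hd (hd (r ρ)) ≡ num (codeF (proj₁ (proj₂ c))) → tl (hd (r ρ)) ≡ num (proj₁ c) →
                   Sat M (cons M (v ρ) (λ i → val (a ρ) (b ρ) (entry (tl (r ρ)) i))) (proj₁ (proj₂ c)) →
                   ∀ x → Sat M (cons M x (λ i → val (a ρ) (b ρ) (entry (tl (r ρ)) i))) (proj₁ (proj₂ c))}
      λ c → dImp (fhd (fhd dr) ≐ fCst) (dImp (ftl (fhd dr) ≐ fCst) (dImp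
        (dSat-cons (proj₁ (proj₂ c)) dv (λ i → fval da db (fentry i (ftl dr))))
        (dAll (dSat-cons (proj₁ (proj₂ c)) fVar (λ i → fval (weaken da) (weaken db) (fentry i (ftl (weaken dr))))))))
    dCond 4 da db dr dv = dv ≐ fSuc (fval da db dr)
    dCond 5 da db dr dv = dv ≐ fval da db (fhd dr) ⊕ fval da db (ftl dr)
    dCond 6 da db dr dv = dv ≐ fval da db (fhd dr) ⊛ fval da db (ftl dr)
    dCond (suc (suc (suc (suc (suc (suc (suc t))))))) da db dr dv = dTrue (λ _ → lift tt)

    dLocal : ∀ {n} {a b c v : Fun n} → DF a → DF b → DF c → DF v → Def (λ ρ → Local (val (a ρ) (b ρ)) (c ρ) (v ρ))
    dLocal {a = a} {b} {c} {v} da db dc dv = finitary-Fin 7 {P = λ t ρ → ∀ r → c ρ ≡ J (num (toℕ t)) r → Cond (toℕ t) (val (a ρ) (b ρ)) r (v ρ)}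
      λ t → dAll (dImp (weaken dc ≐ fJ fCst fVar) (dCond (toℕ t) (weaken da) (weaken db) fVar (weaken dv)))

    cond-exists : ∀ t f r → Σ C (Cond t f r)
    cond-exists 0 f r = O , lift tt
    cond-exists 1 f r with em {Σ (TermCode k) λ c → hd (hd r) ≡ num (codeT (proj₁ (proj₂ c))) × tl (hd r) ≡ num (proj₁ c)}
    ... | no n = O , λ c h h' → ⊥-elim (n (c , h , h'))
    ... | yes ((n , t , _) , h , h') = evalT M (λ i → f (entry (tl r) i)) t , same
      where
      -- The condition ranges over all matching terms, but injectivity of numerals and codes leaves
      -- only one, so its value meets every instance.
      same : (c : TermCode k) → hd (hd r) ≡ num (codeT (proj₁ (proj₂ c))) → tl (hd r) ≡ num (proj₁ c) →
             evalT M (λ i → f (entry (tl r) i)) t ≡ evalT M (λ i → f (entry (tl r) i)) (proj₁ (proj₂ c))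
      same (n' , t' , _) k k' with num-inj {n} {n'} (trans (sym h') k')
      ... | refl with codeT-injective t t' (num-inj {codeT t} {codeT t'} (trans (sym h) k))
      ...   | refl = refl
    cond-exists 2 f r = r , refl
    cond-exists 3 f r with em {Σ (WitnessCode k) λ c → hd (hd r) ≡ num (codeF (proj₁ (proj₂ c))) × tl (hd r) ≡ num (proj₁ c)}
    ... | no n = O , λ c h h' → ⊥-elim (n (c , h , h'))
    ... | yes ((n , ψ , _) , h , h') = proj₁ counterexample , same
      where
      g : Fin n → C
      g i = f (entry (tl r) i)
      counterexample : Σ C λ v → Sat M (cons M v g) ψ → ∀ a → Sat M (cons M a g) ψ
      counterexample with em {Σ C λ a → ¬ Sat M (cons M a g) ψ}
      ... | yes (a , na) = a , λ s → ⊥-elim (na s)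
      ... | no all = O , λ _ a → dne λ na → all (a , na)
      same : (c : WitnessCode k) → hd (hd r) ≡ num (codeF (proj₁ (proj₂ c))) → tl (hd r) ≡ num (proj₁ c) →
             Sat M (cons M (proj₁ counterexample) (λ i → f (entry (tl r) i))) (proj₁ (proj₂ c)) →
             ∀ a → Sat M (cons M a (λ i → f (entry (tl r) i))) (proj₁ (proj₂ c))
      same (n' , ψ' , _) k k' with num-inj {n} {n'} (trans (sym h') k')
      ... | refl with codeF-injective ψ ψ' (num-inj {codeF ψ} {codeF ψ'} (trans (sym h) k))
      ...   | refl = proj₂ counterexample
    cond-exists 4 f r = _ , refl
    cond-exists 5 f r = _ , refl
    cond-exists 6 f r = _ , refl
    cond-exists (suc (suc (suc (suc (suc (suc (suc t))))))) f r = O , lift tt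

    local-exists : ∀ f c → Σ C (Local f c)
    local-exists f c with em {Σ (Fin 7) λ t → Σ C λ r → c ≡ J (num (toℕ t)) r}
    ... | no n = O , λ t r e → ⊥-elim (n (t , r , e))
    ... | yes (t , r , e) with cond-exists (toℕ t) f r
    ...   | v , h = v , same
      where
      same : Local f c v
      same t' r' e' with J-inj (trans (sym e) e')
      ... | p , refl with FinP.toℕ-injective (num-inj {toℕ t} {toℕ t'} p)
      ...   | refl = h

    cond-ext : ∀ t {f g r v} → (∀ d → d ≤ r → f d ≡ g d) → Cond (suc t) f r v → Cond (suc t) g r v
    cond-ext 0 {f} {g} {r} h p c@(n , t , _) e e' = trans (p c e e') (evalT-ext (λ i → h _ (≤-trans (entry-≤ (tl r) i) (tl-≤ r))) t)
    cond-ext 1 h p = p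
    cond-ext 2 {f} {g} {r} {v} h p c@(n , ψ , _) e e' s a = Sat-ext (cons-ext a h') ψ (p c e e' (Sat-ext (cons-ext v λ i → sym (h' i)) ψ s) a)
      where
      h' : ∀ (i : Fin n) → f (entry (tl r) i) ≡ g (entry (tl r) i)
      h' i = h _ (≤-trans (entry-≤ (tl r) i) (tl-≤ r))
    cond-ext 3 h p = trans p (cong S (h _ ≤-refl))
    cond-ext 4 h p = trans p (cong₂ _+_ (h _ (hd-≤ _)) (h _ (tl-≤ _)))
    cond-ext 5 h p = trans p (cong₂ _*_ (h _ (hd-≤ _)) (h _ (tl-≤ _)))
    cond-ext (suc (suc (suc (suc (suc (suc t)))))) h p = p

    -- A name with positive tag exceeds its argument and all entries of its environment, so the
    -- condition on its value consults smaller names only. Tag zero carries no condition.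
    local-ext : ∀ {f g c v} → (∀ d → d < c → f d ≡ g d) → Local f c v → Local g c v
    local-ext h p zero r e = lift tt
    local-ext h p (suc t) r refl = cond-ext (toℕ t) (λ d l → h d (≤∧<⇒< l (<J₂ _ r))) (p (suc t) r refl)

  Locals : C → C → C → Set ℓ
  Locals n a b = ∀ c → c < n → Local (val a b) c (val a b c)

  opaque
    val-unique : ∀ {a b c v} → Val a b c v → val a b c ≡ v
    val-unique h = Least-unique (μ-least _ (_ , proj₁ h)) h

    -- Course-of-values recursion inside the model. The existence of a coded partial evaluation is a
    -- definable statement as `k` is standard, so induction applies. The step changes the sequence
    -- at `n` only, and by `local-ext` the earlier conditions survive.
    locals-exist : ∀ n → Σ C λ a → Σ C λ b → Locals n a b
    locals-exist = ind (dEx (dEx (dAll (dImp (fVar <̇ fVar) (dLocal fVar fVar fVar (fval fVar fVar fVar))))))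
      (O , O , λ c l → ⊥-elim (n≮0 l)) step
      where
      step : ∀ n → (Σ C λ a → Σ C λ b → Locals n a b) → Σ C λ a → Σ C λ b → Locals (S n) a b
      step n (a , b , h) = proj₁ code , proj₁ (proj₂ code) , local
        where
        v : C
        v = proj₁ (local-exists (val a b) n)
        choose : ∀ {c} → Dec (c ≡ n) → C
        choose {c} (yes _) = v
        choose {c} (no _)  = val a b c
        w : C → C
        w c = choose (em {c ≡ n})
        w-old : ∀ c → c < n → val a b c ≡ w c
        w-old c l with em {c ≡ n}
        ... | yes refl = ⊥-elim (<-irrefl l)
        ... | no _     = refl
        w-new : w n ≡ v
        w-new with em {n ≡ n}
        ... | yes _ = refl
        ... | no ne = ⊥-elim (ne refl)
        graph⟺ : ∀ (ρ : Fin 2 → C) →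
          ((ρ (suc zero) ≡ n × ρ zero ≡ v) ⊎ (¬ ρ (suc zero) ≡ n × ρ zero ≡ val a b (ρ (suc zero)))) ⟺ (ρ zero ≡ w (ρ (suc zero)))
        proj₁ (graph⟺ ρ) (inj₁ (e , e')) = trans e' (trans (sym w-new) (cong w (sym e)))
        proj₁ (graph⟺ ρ) (inj₂ (ne , e)) with em {ρ (suc zero) ≡ n}
        ... | yes p = ⊥-elim (ne p)
        ... | no _  = e
        proj₂ (graph⟺ ρ) e with em {ρ (suc zero) ≡ n}
        ... | yes p = inj₁ (p , e)
        ... | no ne = inj₂ (ne , e)
        dw : DF {1} (λ ρ → w (ρ zero))
        dw = df (dIff graph⟺ (dOr (dAnd (fVar ≐ fCst) (fVar ≐ fCst)) (dAnd (dNot (fVar ≐ fCst)) (fVar ≐ fval fCst fCst fVar))))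
        code : Σ C λ a' → Σ C λ b' → ∀ c → c < S n → Val a' b' c (w c)
        code = codeSequence dw (S n)
        agrees : ∀ c → c < S n → w c ≡ val (proj₁ code) (proj₁ (proj₂ code)) c
        agrees c l = sym (val-unique (proj₂ (proj₂ code) c l))
        at : ∀ c → c < n ⊎ c ≡ n → Local (val a b) c (w c)
        at c (inj₁ l) = subst (Local (val a b) c) (w-old c l) (h c l)
        at c (inj₂ refl) = subst (Local (val a b) n) (sym w-new) (proj₂ (local-exists (val a b) n))
        local : Locals (S n) (proj₁ code) (proj₁ (proj₂ code))
        local c l = subst (Local _ c) (agrees c l) (local-ext
          (λ d l' → trans (w-old d (≤-trans l' (s≤s⁻¹ l))) (agrees d (<-trans l' l))) (at c (<S⇒<∨≡ l)))

-- Approximations from models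

module AxiomCodes {ℓ} (M : Structure ℓ) (A : Arith M) (em₀ : ExcludedMiddle lzero) (T : Theory) (ce : CE T) where
  open Arithmetic M A
  open Numerals M A em₀
  module R = Representation em₀

  halt : Δ₀ 2
  halt = R.haltΔ (proj₁ ce)

  open TranslationCorrect M A halt using (IsAxiom)

  opaque
    num-< : ∀ {j k} → j ℕ.< k → num j < num k
    num-< l = num-≤ (R.ℕ<⇒< l)

    below-num : ∀ k {x} → x < num k → Σ ℕ λ j → x ≡ num j × j ℕ.< k
    below-num k l with num-below k l
    ... | j , e , l' = j , e , R.<⇒ℕ< l'

    absolute-axΔ : ∀ k j → NB.⟦ axΔ halt ⟧ (cons ℕˢ k (cons ℕˢ j ∅)) ⟺ Bounded.⟦_⟧ M A (axΔ halt) (cons M (num k) (cons M (num j) ∅))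
    absolute-axΔ k j = absolute (axΔ halt) λ { zero → refl ; (suc zero) → refl }

    -- Below a standard `k` the halting witness is standard too, so absoluteness turns the test made
    -- in the model into an actual halting computation.
    axiom-sound : ∀ k σ → IsAxiom (num k) (num (codeF σ)) → T σ
    axiom-sound k σ (_ , s) with proj₂ (absolute-axΔ k (codeF σ)) s
    ... | w , _ , h = proj₂ (proj₂ ce σ) (proj₂ (R.haltΔ-correct (proj₁ ce) (codeF σ))
                        (w , NB.⟦⟧-ext halt (λ { zero → refl ; (suc zero) → refl }) h))

    axiom-complete : ∀ σ → T σ → Σ ℕ λ k₀ → ∀ k → k₀ ℕ.≤ k → IsAxiom (num k) (num (codeF σ))
    axiom-complete σ Tσ with proj₁ (R.haltΔ-correct (proj₁ ce) (codeF σ)) (proj₁ (proj₂ ce σ) Tσ)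
    -- The threshold exceeds both the witness and the code, because `IsAxiom` puts both below `k`.
    ... | w , h = suc (w ℕ.+ codeF σ) , λ k l →
          num-< (ℕP.≤-trans (ℕ.s≤s (ℕP.m≤n+m (codeF σ) w)) l) ,
          proj₁ (absolute-axΔ k (codeF σ)) (w , R.ℕ<⇒< (ℕP.≤-trans (ℕ.s≤s (ℕP.m≤m+n w (codeF σ))) l) ,
            NB.⟦⟧-ext halt (λ { zero → refl ; (suc zero) → refl }) h)

-- The model here takes the part of the end-extension that satisfies `T + φ`, and `m` that of the
-- image of an element of the smaller model. Only names below `m` need values.
module Reflection {ℓ} (M : Structure ℓ) (A : Arith M) (em₀ : ExcludedMiddle lzero) (T : Theory) (ce : CE T) (M⊨T : M ⊨T T)
                  (φ : Sentence) (M⊨φ : M ⊨ φ) (k : ℕ) (m : Carrier M) where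
  open Arithmetic M A
  open Names M A em₀
  open Semantics M
  open FiniteDefinability M A em₀
  open Valuation M A em₀ k
  open AxiomCodes M A em₀ T ce using (halt; num-<; below-num; axiom-sound; module R)
  open TranslationCorrect M A halt using (IsAxiom) renaming (Small to Below)
  open Conditions M A using (CGuard; CSat; Good; evalC)

  private
    a b : C
    a = proj₁ (locals-exist m)
    b = proj₁ (proj₂ (locals-exist m))

  f : C → C
  f = val a b

  locals : ∀ c → c < m → Local f c (f c)
  locals = proj₂ (proj₂ (locals-exist m))

  assignment : ∀ {n} → C → Fin n → C
  assignment e i = f (entry e i)

  -- Truth is recorded only for formulas with arity and code below the standard `k`, which keeps `X`
  -- definable. Other codes count as neither terms nor formulas, so the clauses about them hold
  -- vacuously.
  X : C → Set ℓ
  X p = (Σ C λ c → Σ C λ d → p ≡ eqᵒ c d × f c ≡ f d) ⊎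
        (Σ (FormulaCode k) λ c → Σ C λ e → p ≡ trᵒ (num (codeF (proj₁ (proj₂ c)))) (num (proj₁ c)) e × Sat M (assignment e) (proj₁ (proj₂ c))) ⊎
        (Σ (TermCode k) λ c → p ≡ vtᵒ (num (codeT (proj₁ (proj₂ c)))) (num (proj₁ c))) ⊎
        (Σ (FormulaCode k) λ c → p ≡ vfᵒ (num (codeF (proj₁ (proj₂ c)))) (num (proj₁ c)))

  opaque
    dX : Def {1} (λ ρ → X (ρ zero))
    dX = dOr (dEx (dEx (dAnd (fVar ≐ fJ fCst (fJ fVar fVar)) (fval fCst fCst fVar ≐ fval fCst fCst fVar))))
      (dOr (dExFinitary (finitary-Coded codeF-injective k) {P = λ c ρ → Σ C λ e →
                ρ zero ≡ trᵒ (num (codeF (proj₁ (proj₂ c)))) (num (proj₁ c)) e × Sat M (assignment e) (proj₁ (proj₂ c))}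
              λ c → dEx (dAnd (fVar ≐ fJ fCst (fJ (fJ fCst fCst) fVar)) (dSat (proj₁ (proj₂ c)) (λ i → fval fCst fCst (fentry i fVar)))))
      (dOr (dExFinitary (finitary-Coded codeT-injective k) {P = λ c ρ → ρ zero ≡ vtᵒ (num (codeT (proj₁ (proj₂ c)))) (num (proj₁ c))} λ c → fVar ≐ fCst)
           (dExFinitary (finitary-Coded codeF-injective k) {P = λ c ρ → ρ zero ≡ vfᵒ (num (codeF (proj₁ (proj₂ c)))) (num (proj₁ c))} λ c → fVar ≐ fCst)))

    tags : ∀ i j {u v} → J (num i) u ≡ J (num j) v → i ≡ j
    tags i j h = num-inj {i} {j} (proj₁ (J-inj h))

    eq-intro : ∀ {c d} → f c ≡ f d → X (eqᵒ c d)
    eq-intro h = inj₁ (_ , _ , refl , h)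

    eq-elim : ∀ {c d} → X (eqᵒ c d) → f c ≡ f d
    eq-elim (inj₁ (c , d , e , h)) with J-inj (proj₂ (J-inj e))
    ... | refl , refl = h
    eq-elim (inj₂ (inj₁ (_ , _ , e , _))) with () ← tags 0 1 e
    eq-elim (inj₂ (inj₂ (inj₁ (_ , e)))) with () ← tags 0 2 e
    eq-elim (inj₂ (inj₂ (inj₂ (_ , e)))) with () ← tags 0 3 e

    tr-intro : ∀ {n} (ψ : Formula n) {e} → n ℕ.< k → codeF ψ ℕ.< k → Sat M (assignment e) ψ → X (trᵒ (num (codeF ψ)) (num n) e)
    tr-intro ψ l l' s = inj₂ (inj₁ ((_ , ψ , l , l') , _ , refl , s))

    tr-elim : ∀ {n} (ψ : Formula n) {e} → X (trᵒ (num (codeF ψ)) (num n) e) → Sat M (assignment e) ψ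
    tr-elim {n} ψ (inj₂ (inj₁ ((n' , ψ' , _) , e , h , s))) with J-inj (proj₂ (J-inj h))
    ... | h' , refl with num-inj {n} {n'} (proj₂ (J-inj h'))
    ...   | refl with codeF-injective ψ ψ' (num-inj {codeF ψ} {codeF ψ'} (proj₁ (J-inj h')))
    ...     | refl = s
    tr-elim ψ (inj₁ (_ , _ , e , _)) with () ← tags 1 0 e
    tr-elim ψ (inj₂ (inj₂ (inj₁ (_ , e)))) with () ← tags 1 2 e
    tr-elim ψ (inj₂ (inj₂ (inj₂ (_ , e)))) with () ← tags 1 3 e

    vt-intro : ∀ {n} (t : Term n) → n ℕ.< k → codeT t ℕ.< k → X (vtᵒ (num (codeT t)) (num n))
    vt-intro t l l' = inj₂ (inj₂ (inj₁ ((_ , t , l , l') , refl)))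

    vt-elim : ∀ {x n} → X (vtᵒ x n) → Σ (TermCode k) λ c → x ≡ num (codeT (proj₁ (proj₂ c))) × n ≡ num (proj₁ c)
    vt-elim (inj₂ (inj₂ (inj₁ (c , e)))) = c , J-inj (proj₂ (J-inj e))
    vt-elim (inj₁ (_ , _ , e , _)) with () ← tags 2 0 e
    vt-elim (inj₂ (inj₁ (_ , _ , e , _))) with () ← tags 2 1 e
    vt-elim (inj₂ (inj₂ (inj₂ (_ , e)))) with () ← tags 2 3 e

    vt-elim-at : ∀ {x} n → X (vtᵒ x (num n)) → Σ (Term n) λ t → x ≡ num (codeT t) × n ℕ.< k × codeT t ℕ.< k
    vt-elim-at n h with vt-elim h
    ... | (n' , t , l , l') , e , e' with num-inj {n} {n'} e'
    ...   | refl = t , e , l , l'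

    vf-intro : ∀ {n} (ψ : Formula n) → n ℕ.< k → codeF ψ ℕ.< k → X (vfᵒ (num (codeF ψ)) (num n))
    vf-intro ψ l l' = inj₂ (inj₂ (inj₂ ((_ , ψ , l , l') , refl)))

    vf-elim : ∀ {x n} → X (vfᵒ x n) → Σ (FormulaCode k) λ c → x ≡ num (codeF (proj₁ (proj₂ c))) × n ≡ num (proj₁ c)
    vf-elim (inj₂ (inj₂ (inj₂ (c , e)))) = c , J-inj (proj₂ (J-inj e))
    vf-elim (inj₁ (_ , _ , e , _)) with () ← tags 3 0 e
    vf-elim (inj₂ (inj₁ (_ , _ , e , _))) with () ← tags 3 1 e
    vf-elim (inj₂ (inj₂ (inj₁ (_ , e)))) with () ← tags 3 2 e

    vf-elim-at : ∀ {x} n → X (vfᵒ x (num n)) → Σ (Formula n) λ ψ → x ≡ num (codeF ψ) × n ℕ.< k × codeF ψ ℕ.< k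
    vf-elim-at n h with vf-elim h
    ... | (n' , ψ , l , l') , e , e' with num-inj {n} {n'} e'
    ...   | refl = ψ , e , l , l'

    -- Both components of a pair are at most its double, so a standard pair has standard components.
    -- This keeps subexpressions of standard expressions standard.
    unpair : ∀ x {a b} → IsPair (num x) a b → Σ ℕ λ a' → Σ ℕ λ b' → a ≡ num a' × b ≡ num b' × x ≡ pair a' b'
    unpair x {a} {b} h with num-below (suc (x N.+ x)) (s≤s (≤-trans a≤ bound)) | num-below (suc (x N.+ x)) (s≤s (≤-trans b≤ bound))
      where
      s : C
      s = a + b
      a≤ : a ≤ s * S s + (b + b)
      a≤ = ≤-trans (≤-trans (m≤m+n a b) (≤-trans (m≤n+m s (s * s)) (≤-reflexive (sym (*S s s))))) (m≤m+n _ _)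
      b≤ : b ≤ s * S s + (b + b)
      b≤ = ≤-trans (m≤m+n b b) (m≤n+m (b + b) (s * S s))
      bound : s * S s + (b + b) ≤ num (x N.+ x)
      bound = ≤-reflexive (trans (sym h) (sym (num-+ x x)))
    ... | a' , refl , _ | b' , refl , _ = a' , b' , refl , refl , isPair⁻¹ x a' b' h

    eq-left : ∀ {c d} → eqᵒ c d < m → c < m
    eq-left {c} {d} l = ≤∧<⇒< (≤-trans (≤J₁ c d) (≤J₂ _ (J c d))) l

    eq-right : ∀ {c d} → eqᵒ c d < m → d < m
    eq-right {c} {d} l = ≤∧<⇒< (≤-trans (≤J₂ c d) (≤J₂ _ (J c d))) l

    f-nm : ∀ {a} → nm a < m → f (nm a) ≡ a
    f-nm {a} l = locals (nm a) l (suc (suc zero)) a refl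

    f-sc : ∀ {c} → sc c < m → f (sc c) ≡ S (f c)
    f-sc {c} l = locals (sc c) l (suc (suc (suc (suc zero)))) c refl

    f-pl : ∀ {c d} → pl c d < m → f (pl c d) ≡ f c + f d
    f-pl {c} {d} l = trans (locals (pl c d) l (suc (suc (suc (suc (suc zero))))) (J c d) refl)
      (cong₂ (λ u v → f u + f v) (hd-J c d) (tl-J c d))

    f-ti : ∀ {c d} → ti c d < m → f (ti c d) ≡ f c * f d
    f-ti {c} {d} l = trans (locals (ti c d) l (suc (suc (suc (suc (suc (suc zero)))))) (J c d) refl)
      (cong₂ (λ u v → f u * f v) (hd-J c d) (tl-J c d))

    f-tm : ∀ {n} (t : Term n) {e} → n ℕ.< k → codeT t ℕ.< k → tm (num (codeT t)) (num n) e < m →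
           f (tm (num (codeT t)) (num n) e) ≡ evalT M (assignment e) t
    f-tm {n} t {e} p q l = trans (locals _ l (suc zero) r refl (n , t , p , q)
        (trans (cong hd (hd-J _ e)) (hd-J _ _)) (trans (cong tl (hd-J _ e)) (tl-J _ _)))
      (evalT-ext (λ i → cong (λ u → f (entry u i)) (tl-J _ e)) t)
      where
      r : C
      r = J (J (num (codeT t)) (num n)) e

    f-wt : ∀ {n} (ψ : Formula (suc n)) {e} → n ℕ.< k → codeF ψ ℕ.< k → wt (num (codeF ψ)) (num n) e < m →
           Sat M (cons M (f (wt (num (codeF ψ)) (num n) e)) (assignment e)) ψ → ∀ x → Sat M (cons M x (assignment e)) ψ
    f-wt {n} ψ {e} p q l s x = Sat-ext (cons-ext x same) ψ (locals _ l (suc (suc (suc zero))) r refl (n , ψ , p , q)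
        (trans (cong hd (hd-J _ e)) (hd-J _ _)) (trans (cong tl (hd-J _ e)) (tl-J _ _))
        (Sat-ext (cons-ext _ λ i → sym (same i)) ψ s) x)
      where
      r : C
      r = J (J (num (codeF ψ)) (num n)) e
      same : ∀ (i : Fin n) → f (entry (tl r) i) ≡ f (entry e i)
      same i = cong (λ u → f (entry u i)) (tl-J _ e)

    assignment-J : ∀ {n} c e (i : Fin (suc n)) → assignment (J c e) i ≡ cons M (f c) (assignment e) i
    assignment-J c e zero    = cong f (hd-J c e)
    assignment-J c e (suc i) = cong (λ u → f (entry u i)) (tl-J c e)

  private
    B Ax : C → Set ℓ
    B = Below (num k)
    Ax = IsAxiom (num k)

  opaque
    equality-holds : ∀ ρ → CGuard (equalityᶜ φ) m ρ → CSat (equalityᶜ φ) B Ax X ρ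
    equality-holds ρ (_ , _ , (_ , g₃) , (_ , _ , g₄) , (_ , _ , g₅) , g₆) =
      eq-intro refl ,
      (λ p q → eq-intro (trans (sym (eq-elim p)) (eq-elim q))) ,
      (λ p → eq-intro (trans (f-sc (eq-left g₃)) (trans (cong S (eq-elim p)) (sym (f-sc (eq-right g₃)))))) ,
      (λ p q → eq-intro (trans (f-pl (eq-left g₄)) (trans (cong₂ _+_ (eq-elim p) (eq-elim q)) (sym (f-pl (eq-right g₄)))))) ,
      (λ p q → eq-intro (trans (f-ti (eq-left g₅)) (trans (cong₂ _*_ (eq-elim p) (eq-elim q)) (sym (f-ti (eq-right g₅)))))) ,
      eq-intro (trans (f-nm (eq-left g₆)) (sym (trans (f-sc (eq-right g₆)) (cong S (f-nm nm<m)))))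
      where
      nm<m : nm (ρ zero) < m
      nm<m = ≤∧<⇒< (≤J₂ _ _) (eq-right g₆)

    var-zero : ∀ {x n c e} → tm x (S n) (J c e) < m → X (vtᵒ x (S n)) → IsPair x O O → X (eqᵒ (tm x (S n) (J c e)) c)
    var-zero {c = c} {e} l vx h with vt-elim vx
    ... | (zero , t , p , q) , refl , e' = ⊥-elim (S≢0 _ e')
    ... | (suc n , t , p , q) , refl , e' with Sinj _ _ e' | codeT-injective t (var zero) (isPair⁻¹ (codeT t) 0 0 h)
    ...   | refl | refl = eq-intro (trans (f-tm {suc n} (var zero) p q l) (cong f (hd-J c e)))

    unpair-tag : ∀ x tag {q} → IsPair (num x) (num tag) q → Σ ℕ λ q' → q ≡ num q' × x ≡ pair tag q'
    unpair-tag x tag h with unpair x h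
    ... | a' , q' , e , e' , h' with num-inj {tag} {a'} e
    ...   | refl = q' , e' , h'

    unpair₃ : ∀ x tag {q} u v → IsPair (num x) (num tag) q → IsPair q (num u) (num v) → x ≡ pair tag (pair u v)
    unpair₃ x tag u v h h' with unpair-tag x tag h
    ... | q' , refl , e = trans e (cong (pair tag) (isPair⁻¹ q' u v h'))

    var-suc : ∀ {x y n c e i} → tm x (S n) (J c e) < m → tm y n e < m → X (vtᵒ x (S n)) → X (vtᵒ y n) →
              IsPair x O (S i) → IsPair y O i → X (eqᵒ (tm x (S n) (J c e)) (tm y n e))
    var-suc {c = c} {e} l l' vx vy h h' with vt-elim vy
    ... | (n , t , p , q) , refl , refl with unpair-tag (codeT t) 0 h' | vt-elim-at (suc n) vx
    ...   | i , refl , e₁ | s , refl , p' , q' with codeT-var t {i} e₁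
    ...     | j , refl , refl with codeT-injective s (var (suc j)) (isPair⁻¹ (codeT s) 0 (suc (toℕ j)) h)
    ...       | refl = eq-intro (trans (f-tm {suc n} (var (suc j)) p' q' l) (trans (assignment-J c e (suc j)) (sym (f-tm (var j) p q l'))))

    zero-term : ∀ {x n e} → tm x n e < m → nm O < m → X (vtᵒ x n) → IsPair x (num 1) O → X (eqᵒ (tm x n e) (nm O))
    zero-term l l' vx h with vt-elim vx
    ... | (n , t , p , q) , refl , refl with codeT-injective t `0 (isPair⁻¹ (codeT t) 1 0 h)
    ...   | refl = eq-intro (trans (f-tm {n} `0 p q l) (sym (f-nm l')))

    suc-term : ∀ {x y n e} → tm x n e < m → sc (tm y n e) < m → X (vtᵒ x n) → X (vtᵒ y n) → IsPair x (num 2) y →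
               X (eqᵒ (tm x n e) (sc (tm y n e)))
    suc-term l l' vx vy h with vt-elim vx
    ... | (n , t , p , q) , refl , refl with vt-elim-at n vy
    ...   | s , refl , p' , q' with codeT-injective t (`S s) (isPair⁻¹ (codeT t) 2 (codeT s) h)
    ...     | refl = eq-intro (trans (f-tm (`S s) p q l) (sym (trans (f-sc l') (cong S (f-tm s p' q' (<-trans (<J₂ _ _) l'))))))

    pl-parts : ∀ {c d} → pl c d < m → c < m × d < m
    pl-parts {c} {d} l = ≤∧<⇒< (≤-trans (≤J₁ c d) (≤J₂ _ _)) l , ≤∧<⇒< (≤-trans (≤J₂ c d) (≤J₂ _ _)) l

    ti-parts : ∀ {c d} → ti c d < m → c < m × d < m
    ti-parts {c} {d} l = ≤∧<⇒< (≤-trans (≤J₁ c d) (≤J₂ _ _)) l , ≤∧<⇒< (≤-trans (≤J₂ c d) (≤J₂ _ _)) l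

    plus-term : ∀ {x y z q n e} → tm x n e < m → pl (tm y n e) (tm z n e) < m → X (vtᵒ x n) → X (vtᵒ y n) → X (vtᵒ z n) →
                IsPair x (num 3) q → IsPair q y z → X (eqᵒ (tm x n e) (pl (tm y n e) (tm z n e)))
    plus-term l l' vx vy vz h h' with vt-elim vx
    ... | (n , t , p , q) , refl , refl with vt-elim-at n vy | vt-elim-at n vz
    ...   | s , refl , p₁ , q₁ | u , refl , p₂ , q₂ with codeT-injective t (s `+ u) (unpair₃ (codeT t) 3 (codeT s) (codeT u) h h')
    ...     | refl = eq-intro (trans (f-tm (s `+ u) p q l) (sym (trans (f-pl l')
                       (cong₂ _+_ (f-tm s p₁ q₁ (proj₁ (pl-parts l'))) (f-tm u p₂ q₂ (proj₂ (pl-parts l')))))))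

    times-term : ∀ {x y z q n e} → tm x n e < m → ti (tm y n e) (tm z n e) < m → X (vtᵒ x n) → X (vtᵒ y n) → X (vtᵒ z n) →
                 IsPair x (num 4) q → IsPair q y z → X (eqᵒ (tm x n e) (ti (tm y n e) (tm z n e)))
    times-term l l' vx vy vz h h' with vt-elim vx
    ... | (n , t , p , q) , refl , refl with vt-elim-at n vy | vt-elim-at n vz
    ...   | s , refl , p₁ , q₁ | u , refl , p₂ , q₂ with codeT-injective t (s `* u) (unpair₃ (codeT t) 4 (codeT s) (codeT u) h h')
    ...     | refl = eq-intro (trans (f-tm (s `* u) p q l) (sym (trans (f-ti l')
                       (cong₂ _*_ (f-tm s p₁ q₁ (proj₁ (ti-parts l'))) (f-tm u p₂ q₂ (proj₂ (ti-parts l')))))))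

    terms-hold : ∀ ρ → CGuard (termᶜ φ) m ρ → CSat (termᶜ φ) B Ax X ρ
    terms-hold ρ ((_ , _ , g₁) , (_ , _ , _ , _ , g₂) , (_ , _ , g₃) , (_ , _ , _ , g₄) , (_ , _ , _ , _ , _ , g₅) , (_ , _ , _ , _ , _ , g₆)) =
      var-zero (eq-left g₁) , var-suc (eq-left g₂) (eq-right g₂) , zero-term (eq-left g₃) (eq-right g₃) ,
      suc-term (eq-left g₄) (eq-right g₄) , plus-term (eq-left g₅) (eq-right g₅) , times-term (eq-left g₆) (eq-right g₆)

    false-formula : ∀ {x n e} → X (vfᵒ x n) → IsPair x O O → X (trᵒ x n e) → Lift ℓ ⊥
    false-formula vx h s with vf-elim vx
    ... | (n , ψ , p , q) , refl , refl with codeF-injective ψ `⊥ (isPair⁻¹ (codeF ψ) 0 0 h)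
    ...   | refl = tr-elim {n} `⊥ s

    equation-formula : ∀ {x y z q n e} → tm y n e < m → tm z n e < m → X (vfᵒ x n) → X (vtᵒ y n) → X (vtᵒ z n) →
                       IsPair x (num 1) q → IsPair q y z → X (trᵒ x n e) ⟺ X (eqᵒ (tm y n e) (tm z n e))
    equation-formula l l' vx vy vz h h' with vf-elim vx
    ... | (n , ψ , p , q) , refl , refl with vt-elim-at n vy | vt-elim-at n vz
    ...   | s , refl , p₁ , q₁ | u , refl , p₂ , q₂ with codeF-injective ψ (s `≐ u) (unpair₃ (codeF ψ) 1 (codeT s) (codeT u) h h')
    ...     | refl = (λ x → eq-intro (trans (f-tm s p₁ q₁ l) (trans (tr-elim (s `≐ u) x) (sym (f-tm u p₂ q₂ l'))))) ,
                     λ x → tr-intro (s `≐ u) p q (trans (sym (f-tm s p₁ q₁ l)) (trans (eq-elim x) (f-tm u p₂ q₂ l')))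

    implication-formula : ∀ {x y z q n e} → X (vfᵒ x n) → X (vfᵒ y n) → X (vfᵒ z n) → IsPair x (num 2) q → IsPair q y z →
                          X (trᵒ x n e) ⟺ (X (trᵒ y n e) → X (trᵒ z n e))
    implication-formula vx vy vz h h' with vf-elim vx
    ... | (n , ψ , p , q) , refl , refl with vf-elim-at n vy | vf-elim-at n vz
    ...   | s , refl , p₁ , q₁ | u , refl , p₂ , q₂ with codeF-injective ψ (s `⇒ u) (unpair₃ (codeF ψ) 2 (codeF s) (codeF u) h h')
    ...     | refl = (λ x y → tr-intro u p₂ q₂ (tr-elim (s `⇒ u) x (tr-elim s y))) ,
                     λ g → tr-intro (s `⇒ u) p q λ y → tr-elim u (g (tr-intro s p₁ q₁ y))

    universal-formula : ∀ {x y n e c} → wt y n e < m → X (vfᵒ x n) → X (vfᵒ y (S n)) → IsPair x (num 3) y →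
                        (X (trᵒ x n e) → X (trᵒ y (S n) (J c e))) × (X (trᵒ y (S n) (J (wt y n e) e)) → X (trᵒ x n e))
    universal-formula {e = e} {c} l vx vy h with vf-elim vx
    ... | (n , ψ , p , q) , refl , refl with vf-elim-at (suc n) vy
    ...   | s , refl , p₁ , q₁ with codeF-injective ψ (`∀ s) (isPair⁻¹ (codeF ψ) 3 (codeF s) h)
    ...     | refl = (λ x → tr-intro s p₁ q₁ (Sat-ext (λ i → sym (assignment-J c e i)) s (tr-elim (`∀ s) x (f c)))) ,
                     λ x → tr-intro (`∀ s) p q (f-wt s p q₁ l (Sat-ext (assignment-J _ e) s (tr-elim s x)))

    formulas-hold : ∀ ρ → CGuard (formulaᶜ φ) m ρ → CSat (formulaᶜ φ) B Ax X ρ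
    formulas-hold ρ (_ , (_ , _ , _ , _ , _ , (_ , g₂) , _) , _ , (_ , _ , _ , _ , (g₄ , _))) =
      false-formula , equation-formula (eq-left g₂) (eq-right g₂) , implication-formula ,
      -- The queried position contains the witness name inside its environment, so the guard bounds
      -- this name as well and its value obeys the local condition.
      universal-formula (≤∧<⇒< (≤-trans (≤-trans (≤J₁ _ _) (≤J₂ _ _)) (≤J₂ _ _)) g₄)

    vt-intro′ : ∀ {n j} (t : Term n) → j ≡ codeT t → n ℕ.< k → j ℕ.< k → X (vtᵒ (num j) (num n))
    vt-intro′ t refl = vt-intro t

    vf-intro′ : ∀ {n j} (ψ : Formula n) → j ≡ codeF ψ → n ℕ.< k → j ℕ.< k → X (vfᵒ (num j) (num n))
    vf-intro′ ψ refl = vf-intro ψ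

    valid-var : ∀ {j n i c} → n ℕ.< k → j ℕ.< k → IsPair (num j) O i → S i + c ≡ num n → X (vtᵒ (num j) (num n))
    valid-var {j} {n} p q h e with unpair-tag j 0 h
    ... | i , refl , h' = vt-intro′ (var (fromℕ< i<n)) (trans h' (cong (pair 0) (sym (FinP.toℕ-fromℕ< i<n)))) p q
      where
      i<n : i ℕ.< n
      i<n = R.<⇒ℕ< (num-≤⁻¹ {suc i} {n} (_ , e))

    validity-holds : ∀ ρ → CSat (validityᶜ φ) B Ax X ρ
    validity-holds ρ bx bn = go (below-num k bx) (below-num k bn)
      where
      go : ∀ {x y z q n c i} → Σ ℕ (λ j → x ≡ num j × j ℕ.< k) → Σ ℕ (λ j → n ≡ num j × j ℕ.< k) →
           (IsPair x O i → S i + c ≡ n → X (vtᵒ x n)) ×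
           (IsPair x (num 1) O → X (vtᵒ x n)) ×
           (X (vtᵒ y n) → IsPair x (num 2) y → X (vtᵒ x n)) ×
           (X (vtᵒ y n) → X (vtᵒ z n) → IsPair x (num 3) q → IsPair q y z → X (vtᵒ x n)) ×
           (X (vtᵒ y n) → X (vtᵒ z n) → IsPair x (num 4) q → IsPair q y z → X (vtᵒ x n)) ×
           (IsPair x O O → X (vfᵒ x n)) ×
           (X (vtᵒ y n) → X (vtᵒ z n) → IsPair x (num 1) q → IsPair q y z → X (vfᵒ x n)) ×
           (X (vfᵒ y n) → X (vfᵒ z n) → IsPair x (num 2) q → IsPair q y z → X (vfᵒ x n)) ×
           (X (vfᵒ y (S n)) → IsPair x (num 3) y → X (vfᵒ x n))
      go {y = y} {z} {q} (j , refl , j<k) (n , refl , n<k) =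
        valid-var n<k j<k ,
        (λ h → vt-intro′ {n} `0 (isPair⁻¹ j 1 0 h) n<k j<k) ,
        unary ,
        (λ vy vz → binary 3 _`+_ (λ _ _ → refl) vy vz) ,
        (λ vy vz → binary 4 _`*_ (λ _ _ → refl) vy vz) ,
        (λ h → vf-intro′ {n} `⊥ (isPair⁻¹ j 0 0 h) n<k j<k) ,
        equation , implication , universal
        where
        unary : X (vtᵒ y (num n)) → IsPair (num j) (num 2) y → X (vtᵒ (num j) (num n))
        unary vy h with vt-elim-at n vy
        ... | t , refl , _ = vt-intro′ (`S t) (isPair⁻¹ j 2 (codeT t) h) n<k j<k
        binary : ∀ tag (op : Term n → Term n → Term n) → (∀ t s → codeT (op t s) ≡ pair tag (pair (codeT t) (codeT s))) →
                 X (vtᵒ y (num n)) → X (vtᵒ z (num n)) → IsPair (num j) (num tag) q → IsPair q y z → X (vtᵒ (num j) (num n))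
        binary tag op code vy vz h h' with vt-elim-at n vy | vt-elim-at n vz
        ... | t , refl , _ | s , refl , _ = vt-intro′ (op t s) (trans (unpair₃ j tag (codeT t) (codeT s) h h') (sym (code t s))) n<k j<k
        equation : X (vtᵒ y (num n)) → X (vtᵒ z (num n)) → IsPair (num j) (num 1) q → IsPair q y z → X (vfᵒ (num j) (num n))
        equation vy vz h h' with vt-elim-at n vy | vt-elim-at n vz
        ... | t , refl , _ | s , refl , _ = vf-intro′ (t `≐ s) (unpair₃ j 1 (codeT t) (codeT s) h h') n<k j<k
        implication : X (vfᵒ y (num n)) → X (vfᵒ z (num n)) → IsPair (num j) (num 2) q → IsPair q y z → X (vfᵒ (num j) (num n))
        implication vy vz h h' with vf-elim-at n vy | vf-elim-at n vz
        ... | ψ , refl , _ | χ , refl , _ = vf-intro′ (ψ `⇒ χ) (unpair₃ j 2 (codeF ψ) (codeF χ) h h') n<k j<k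
        universal : X (vfᵒ y (num (suc n))) → IsPair (num j) (num 3) y → X (vfᵒ (num j) (num n))
        universal vy h with vf-elim-at (suc n) vy
        ... | ψ , refl , _ = vf-intro′ (`∀ ψ) (isPair⁻¹ j 3 (codeF ψ) h) n<k j<k

    axioms-hold : ∀ ρ → CSat (axiomᶜ φ) B Ax X ρ
    axioms-hold ρ = axiom-true , φ-true
      where
      axiom-true : Ax (ρ zero) → X (vfᵒ (ρ zero) O) → X (trᵒ (ρ zero) O O)
      axiom-true ax v with ρ zero | vf-elim-at 0 v
      ... | _ | ψ , refl , p , q = tr-intro ψ p q (Sat-ext (λ ()) ψ (M⊨T ψ (axiom-sound k ψ ax)))
      φ-true : X (vfᵒ (evalC ρ (numeral (codeF φ))) O) → X (trᵒ (evalC ρ (numeral (codeF φ))) O O)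
      φ-true v with evalC ρ (numeral (codeF φ)) | evalC-numeral {ρ = ρ} (codeF φ)
      ... | _ | refl with vf-elim-at 0 v
      ...   | ψ , e , p , q with codeF-injective φ ψ (num-inj {codeF φ} {codeF ψ} e)
      ...     | refl = tr-intro φ p q (Sat-ext (λ ()) φ M⊨φ)

    theory-good : Good (theoryᶜ φ) B Ax m X
    theory-good ρ (g₁ , g₂ , g₃ , _) = equality-holds ρ g₁ , terms-hold ρ g₂ , formulas-hold ρ g₃ , validity-holds ρ , axioms-hold ρ

-- Possibility in end-extensions

module Descent {ℓ} (M N : Structure ℓ) (A : Arith M) (A' : Arith N) (E : EndExtension M N)
               (em₀ : ExcludedMiddle lzero) (T : Theory) (ce : CE T) where
  open Arithmetic M A
  open Conditions M A
  open Numerals M A em₀ using (num)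
  open AxiomCodes M A em₀ T ce using (halt; below-num; absolute-axΔ)
  open TranslationCorrect M A halt
  open EndExtension E
  module N = Arithmetic N A'
  module NC = Conditions N A'
  module NN = Numerals N A' em₀
  module NX = AxiomCodes N A' em₀ T ce
  module NT = TranslationCorrect N A' halt

  opaque
    emb-≤ : ∀ {a b} → a ≤ b → emb a N.≤ emb b
    emb-≤ {a} (z , refl) = emb z , sym (pres-+ a z)

    emb-< : ∀ {a b} → a < b → emb a N.< emb b
    emb-< {a} l = subst (N._≤ _) (pres-S a) (emb-≤ l)

    emb-<⁻¹ : ∀ {a b} → emb a N.< emb b → a < b
    emb-<⁻¹ {a} {b} l with b ≤? a
    ... | inj₁ l' = ⊥-elim (N.<-irrefl (N.≤-trans l (emb-≤ l')))
    ... | inj₂ l' = l'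

    below : ∀ {c} b → c N.≤ emb b → Σ C λ a → emb a ≡ c
    below b l = initial _ b l

    emb-num : ∀ k → emb (num k) ≡ NN.num k
    emb-num zero    = pres-0
    emb-num (suc k) = trans (pres-S (num k)) (cong N.S (emb-num k))

    emb-J : ∀ a b → emb (J a b) ≡ N.J (emb a) (emb b)
    emb-J a b = trans (cong emb (J≡ a b)) (trans (pres-+ _ b) (trans (cong (N._+ emb b)
      (trans (pres-* (a + b) (a + b)) (cong₂ N._*_ (pres-+ a b) (pres-+ a b)))) (sym (N.J≡ (emb a) (emb b)))))

    emb-evalC : ∀ {n} (ρ : Fin n → C) t → emb (evalC ρ t) ≡ NC.evalC (λ i → emb (ρ i)) t
    emb-evalC ρ (var i)  = refl
    emb-evalC ρ `0       = pres-0
    emb-evalC ρ (`S t)   = trans (pres-S _) (cong N.S (emb-evalC ρ t))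
    emb-evalC ρ (t `+ s) = trans (pres-+ _ _) (cong₂ N._+_ (emb-evalC ρ t) (emb-evalC ρ s))
    emb-evalC ρ (t `* s) = trans (pres-* _ _) (cong₂ N._*_ (emb-evalC ρ t) (emb-evalC ρ s))
    emb-evalC ρ (`J t s) = trans (emb-J _ _) (cong₂ N.J (emb-evalC ρ t) (emb-evalC ρ s))

    emb-modulus : ∀ b p → emb (modulus b p) ≡ N.modulus (emb b) (emb p)
    emb-modulus b p = trans (pres-S _) (cong N.S (trans (pres-* (S p) b) (cong (N._* emb b) (pres-S p))))

    -- A modulus is positive, so a quotient found in `N` is at most the image of `a` and comes from
    -- `M`, the image being an initial segment.
    emb-Mem : ∀ {a b p} → Mem a b p ⟺ N.Mem (emb a) (emb b) (emb p)
    proj₁ (emb-Mem {a} {b} {p}) (q , e) = emb q ,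
      trans (cong (N._* emb q) (sym (emb-modulus b p))) (trans (sym (pres-* _ q)) (cong emb e))
    proj₂ (emb-Mem {a} {b} {p}) (q , e) with below a (N.≤-trans (N.m≤n+m q (N.S (emb p) N.* emb b N.* q))
                                               (N.≤-reflexive (trans (sym (N.*-sucˡ (N.S (emb p) N.* emb b) q)) e)))
    ... | q' , refl = q' , inj _ _ (trans (pres-* _ q') (trans (cong (N._* emb q') (emb-modulus b p)) e))

    emb-Base : ∀ {n b} → Base n b → N.Base (emb n) (emb b)
    emb-Base {n} {b} (b≢0 , h) = (λ e → b≢0 (inj _ _ (trans e (sym pres-0)))) , divide
      where
      divide : ∀ j → j N.< emb n → Σ N.C λ q → N.S j N.* q ≡ emb b
      divide j l with below n (N.<⇒≤ l)
      ... | i , refl with h i (emb-<⁻¹ l)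
      ...   | q , e = emb q , trans (cong (N._* emb q) (sym (pres-S i))) (trans (sym (pres-* (S i) q)) (cong emb e))

    emb-CommonMultiple : ∀ {n b m} → CommonMultiple n b m → N.CommonMultiple (emb n) (emb b) (emb m)
    emb-CommonMultiple {n} {b} {m} (m≢0 , h) = (λ e → m≢0 (inj _ _ (trans e (sym pres-0)))) , divide
      where
      divide : ∀ j → j N.< emb n → N.Mem (emb m) (emb b) j
      divide j l with below n (N.<⇒≤ l)
      ... | i , refl = proj₁ emb-Mem (h i (emb-<⁻¹ l))

    emb-QGuard : ∀ {n} (q : QF n) {m ρ} → QGuard q m ρ → NC.QGuard q (emb m) (λ i → emb (ρ i))
    emb-QGuard (t ≈̂ s) g = g
    emb-QGuard (mem t) {m} {ρ} g = subst (N._< emb m) (emb-evalC ρ t) (emb-< g)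
    emb-QGuard ⊥̂ g = g
    emb-QGuard (p ⇒̂ q) (g , h) = emb-QGuard p g , emb-QGuard q h
    emb-QGuard (p & q) (g , h) = emb-QGuard p g , emb-QGuard q h

    emb-CGuard : ∀ {n} (c : Clause n) {m ρ} → CGuard c m ρ → NC.CGuard c (emb m) (λ i → emb (ρ i))
    emb-CGuard ⟨ q ⟩ g = emb-QGuard q g
    emb-CGuard (c && d) (g , h) = emb-CGuard c g , emb-CGuard d h
    emb-CGuard (small t ▷ c) g = emb-CGuard c g
    emb-CGuard (axiom t ▷ c) g = emb-CGuard c g

    emb-QSat : ∀ {n} (q : QF n) {X Y ρ} → (∀ p → X p ⟺ Y (emb p)) → QSat q X ρ ⟺ NC.QSat q Y (λ i → emb (ρ i))
    emb-QSat (t ≈̂ s) {ρ = ρ} h =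
      (λ e → trans (sym (emb-evalC ρ t)) (trans (cong emb e) (emb-evalC ρ s))) ,
      λ e → inj _ _ (trans (emb-evalC ρ t) (trans e (sym (emb-evalC ρ s))))
    emb-QSat (mem t) {X} {Y} {ρ} h = (λ x → subst Y (emb-evalC ρ t) (proj₁ (h _) x)) , λ y → proj₂ (h _) (subst Y (sym (emb-evalC ρ t)) y)
    emb-QSat ⊥̂ h = (λ x → x) , λ x → x
    emb-QSat (p ⇒̂ q) {X} {Y} {ρ} h =
      (λ f x → proj₁ (emb-QSat q {X} {Y} {ρ} h) (f (proj₂ (emb-QSat p {X} {Y} {ρ} h) x))) ,
      λ f x → proj₂ (emb-QSat q {X} {Y} {ρ} h) (f (proj₁ (emb-QSat p {X} {Y} {ρ} h) x))
    emb-QSat (p & q) {X} {Y} {ρ} h =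
      (λ { (x , y) → proj₁ (emb-QSat p {X} {Y} {ρ} h) x , proj₁ (emb-QSat q {X} {Y} {ρ} h) y }) ,
      λ { (x , y) → proj₂ (emb-QSat p {X} {Y} {ρ} h) x , proj₂ (emb-QSat q {X} {Y} {ρ} h) y }

    emb-Small : ∀ k x → Small (num k) x → NT.Small (NN.num k) (emb x)
    emb-Small k x l = subst (emb x N.<_) (emb-num k) (emb-< l)

    -- An element below a standard `k` is standard, so both tests can be compared with the one on
    -- `ℕ`.
    emb-IsAxiom : ∀ k x → IsAxiom (num k) x → NT.IsAxiom (NN.num k) (emb x)
    emb-IsAxiom k x (l , s) with below-num k l
    ... | j , refl , _ = emb-Small k (num j) l , subst (λ y → Bounded.⟦_⟧ N A' (axΔ halt) (cons N (NN.num k) (cons N y ∅)))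
                           (sym (emb-num j)) (proj₁ (NX.absolute-axΔ k j) (proj₂ (absolute-axΔ k j) s))

    -- The tests `small` and `axiom` occur as hypotheses only, so their preservation upwards makes
    -- clauses pass downwards.
    emb-CSat : ∀ {n} (c : Clause n) {k X Y ρ} → (∀ p → X p ⟺ Y (emb p)) →
               NC.CSat c (NT.Small (NN.num k)) (NT.IsAxiom (NN.num k)) Y (λ i → emb (ρ i)) →
               CSat c (Small (num k)) (IsAxiom (num k)) X ρ
    emb-CSat ⟨ q ⟩ {k} {X} {Y} {ρ} h s = proj₂ (emb-QSat q {X} {Y} {ρ} h) s
    emb-CSat (c && d) {k} {X} {Y} {ρ} h (s , s') = emb-CSat c {k} {X} {Y} {ρ} h s , emb-CSat d {k} {X} {Y} {ρ} h s'
    emb-CSat (small t ▷ c) {k} {X} {Y} {ρ} h s x =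
      emb-CSat c {k} {X} {Y} {ρ} h (s (subst (NT.Small (NN.num k)) (emb-evalC ρ t) (emb-Small k (evalC ρ t) x)))
    emb-CSat (axiom t ▷ c) {k} {X} {Y} {ρ} h s x =
      emb-CSat c {k} {X} {Y} {ρ} h (s (subst (NT.IsAxiom (NN.num k)) (emb-evalC ρ t) (emb-IsAxiom k (evalC ρ t) x)))

    -- The least code in N of a set bounded by an element of M is itself an element of M.
    descend : ∀ {n} (c : Clause n) k m {Y : N.C → Set ℓ} → N.Def {1} (λ ρ → Y (ρ zero)) →
              NC.Good c (NT.Small (NN.num k)) (NT.IsAxiom (NN.num k)) (emb m) Y →
              Σ C λ a → Σ C λ b → Good c (Small (num k)) (IsAxiom (num k)) m (Mem a b)
    descend c k m {Y} dY G with base m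
    ... | b , B with commonMultiple m b
    ...   | u , U with N.codeSet dY (emb-Base B) (emb-CommonMultiple U)
    ...     | a' , a'≤ , h with below u a'≤
    ...       | a , refl = a , b , λ ρ g → emb-CSat c {k} {Mem a b} {N.Mem (emb a) (emb b)} {ρ} (λ p → emb-Mem) (NC.Good-restrict c {X = Y} {N.Mem (emb a) (emb b)} N.≤-refl
                  (λ p l → proj₂ (h p l) , proj₁ (h p l)) (λ _ x → x) (λ _ x → x) G (λ i → emb (ρ i)) (emb-CGuard c g))

module Possibility {ℓ} (em : ExcludedMiddle (lsuc ℓ)) (T : Theory) (pa : ∀ σ → PA σ → T σ) (ce : CE T) where

  emℓ : ExcludedMiddle ℓ
  emℓ {P} with em {Lift (lsuc ℓ) P}
  ... | yes p = yes (lower p)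
  ... | no n  = no λ p → n (lift p)

  em₀ : ExcludedMiddle lzero
  em₀ {P} with em {Lift (lsuc ℓ) P}
  ... | yes p = yes (lower p)
  ... | no n  = no λ p → n (lift p)

  halt : Δ₀ 2
  halt = Representation.haltΔ em₀ (proj₁ ce)

  opaque
    arithmetic : ∀ (M : Structure ℓ) → M ⊨T T → Arith M
    arithmetic M h = Definability.arith M emℓ λ σ p → h σ (pa σ p)

    dSatisfaction : ∀ (M : Structure ℓ) (h : M ⊨T T) {n} (φ : Formula n) → Arith.Def (arithmetic M h) (λ ρ → Sat M ρ φ)
    dSatisfaction M h φ = Definability.satisfaction M φ

  opaque
    conditions : Sentence → Clause 8
    conditions = theoryᶜ

  -- Restricted to the axioms of T with a code and a halting witness below k, T + φ has Henkin approximations.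
  approximable : Sentence → ℕ → Sentence
  approximable φ k = subF (λ _ → toTerm (numeral k)) (Translation.approximableᶠ halt (conditions φ))

  Possible : Sentence → Structure ℓ → Set (lsuc ℓ)
  Possible φ M = Σ (Structure ℓ) λ K → EndExtension M K × K ⊨T T × K ⊨ φ

  module _ (M : Structure ℓ) (M⊨T : M ⊨T T) (φ : Sentence) where
    private
      A : Arith M
      A = arithmetic M M⊨T

    open Arithmetic M A hiding (em)
    open Names M A em₀
    open Conditions M A
    open TranslationCorrect M A halt
    open AxiomCodes M A em₀ T ce using (axiom-complete; num-<)
    open Standard M A em₀ T

    opaque
      approximable-sat : ∀ k → M ⊨ approximable φ k ⟺ Approximable (conditions φ) (num k)
      approximable-sat k = (λ s → proj₁ (approximable-correct (conditions φ) (λ _ → num k)) (proj₁ unsub s)) ,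
                           λ h → proj₂ unsub (proj₂ (approximable-correct (conditions φ) (λ _ → num k)) h)
        where
        unsub : M ⊨ approximable φ k ⟺ Sat M (λ _ → num k) (Translation.approximableᶠ halt (conditions φ))
        unsub = Semantics.Sat-sub M {ρ = emptyEnv M} {λ _ → num k} (λ _ → toTerm (numeral k))
          (λ _ → trans (evalT-toTerm (emptyEnv M) (numeral k)) (evalC-numeral k)) (Translation.approximableᶠ halt (conditions φ))

    opaque
      unfolding conditions
      possible⇒approximable : Possible φ M → ∀ k → M ⊨ approximable φ k
      possible⇒approximable (K , E , K⊨T , K⊨φ) k = proj₂ (approximable-sat k) λ m →
        D.descend (conditions φ) k m {R.X m} (R.dX m) (R.theory-good m)
        where
        module D = Descent M K A (arithmetic K K⊨T) E em₀ T ce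
        module R (m : C) = Reflection K (arithmetic K K⊨T) em₀ T ce K⊨T φ K⊨φ k (EndExtension.emb E m)

    private
      G : C → C → (C → Set ℓ) → Set ℓ
      G k m X = Good (conditions φ) (Small k) (IsAxiom k) m X

      reverse : Fin 4 → Fin 4
      reverse zero                   = suc (suc (suc zero))
      reverse (suc zero)             = suc (suc zero)
      reverse (suc (suc zero))       = suc zero
      reverse (suc (suc (suc zero))) = zero

    opaque
      IsAxiom-mono : ∀ {k k'} → k' ≤ k → ∀ x → IsAxiom k' x → IsAxiom k x
      IsAxiom-mono l x (l' , w , w<k , s) = ≤-trans l' l , w , ≤-trans w<k l ,
        Bounded.⟦⟧-ext M A halt (λ { zero → refl ; (suc zero) → refl }) s

      dG : Def {4} (λ ρ → G (ρ zero) (ρ (suc zero)) (Mem (ρ (suc (suc zero))) (ρ (suc (suc (suc zero))))))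
      dG = dRen {P = λ ρ → G (ρ (suc (suc (suc zero)))) (ρ (suc (suc zero))) (Mem (ρ (suc zero)) (ρ zero))} reverse
             (dIff (good-correct′ (conditions φ)) (dSatisfaction M M⊨T (Translation.goodᶠ halt (conditions φ))))

      restrict : ∀ k m m' X Y → m' ≤ m → (∀ p → p < m' → X p ⟺ Y p) → G k m X → G k m' Y
      restrict k m m' X Y l h = Good-restrict (conditions φ) {X = X} {Y} {Small k} {Small k} {IsAxiom k} {IsAxiom k} l h (λ _ x → x) (λ _ x → x)

      antitone : ∀ k k' m X → k' ≤ k → G k m X → G k' m X
      antitone k k' m X l = Good-restrict (conditions φ) {X = X} {X} {Small k} {Small k'} {IsAxiom k} {IsAxiom k'} ≤-refl (λ _ _ → (λ x → x) , λ x → x) (λ _ l' → ≤-trans l' l) (IsAxiom-mono l)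

      -- A clause contains finitely many hypotheses, and each one that holds in the standard sense
      -- holds at `num k` for all large `k`. `k₀` collects these thresholds.
      standard-limit : ∀ {n} (c : Clause n) {X ρ} k₀ → (∀ k → k₀ ℕ.≤ k → CSat c (Small (num k)) (IsAxiom (num k)) X ρ) →
                       CSat c IsStandard IsAxiomCode X ρ
      standard-limit ⟨ q ⟩ k₀ h = h k₀ ℕP.≤-refl
      standard-limit (c && d) {X} {ρ} k₀ h = standard-limit c {X} {ρ} k₀ (λ k l → proj₁ (h k l)) , standard-limit d {X} {ρ} k₀ (λ k l → proj₂ (h k l))
      standard-limit (small t ▷ c) {X} {ρ} k₀ h (j , e) = standard-limit c {X} {ρ} (k₀ ℕ.+ suc j) λ k l →
        h k (ℕP.≤-trans (ℕP.m≤m+n k₀ _) l) (subst (_< num k) (sym e) (num-< (ℕP.≤-trans (ℕP.m≤n+m (suc j) k₀) l)))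
      standard-limit (axiom t ▷ c) {X} {ρ} k₀ h (σ , Tσ , e) = standard-limit c {X} {ρ} (k₀ ℕ.+ proj₁ (axiom-complete σ Tσ)) λ k l →
        h k (ℕP.≤-trans (ℕP.m≤m+n k₀ _) l) (subst (IsAxiom (num k)) (sym e)
          (proj₂ (axiom-complete σ Tσ) k (ℕP.≤-trans (ℕP.m≤n+m _ k₀) l)))

    opaque
      unfolding conditions
      approximable⇒possible : (∀ k → M ⊨ approximable φ k) → Possible φ M
      approximable⇒possible h = H.K , H.extension , H.K⊨T , H.K⊨φ
        where
        module B = Branch.Leftmost M A G restrict antitone dG
        path : C → Set ℓ
        path = B.Path
        henkin : ∀ ρ → CSat (conditions φ) IsStandard IsAxiomCode path ρ
        -- With the environment fixed, `m` can be chosen to guard it, whereas the path is the same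
        -- for all `m` and all standard `k`.
        henkin ρ = standard-limit (conditions φ) {path} {ρ} 0 λ k _ → let (m , g) = CGuard-exists (conditions φ) ρ in
          B.branch (num k) (proj₁ (approximable-sat k) (h k)) m ρ g
        module H = Henkin M A em₀ T pa φ path B.dPath henkin

theorem32 : {ℓ : Level} → ExcludedMiddle (lsuc ℓ) →
    (T : Theory) → (∀ σ → PA σ → T σ) → CE T →
    (M N : Structure ℓ) → M ⊨T T → N ⊨T T →
    AMP T M → M ≡ₑ N → AMP T N
theorem32 {ℓ} em T pa ce M N M⊨T N⊨T amp M≡N σ (N' , N≤N' , N'⊨T , N'□σ) =
  proj₁ (M≡N σ) (amp σ (M' , M≤M' , M'⊨T , M'□σ))
  where
  open Possibility {ℓ} em T pa ce
  dne : ∀ {P : Set ℓ} → ¬ ¬ P → P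
  dne {P} h with emℓ {P}
  ... | yes p = p
  ... | no n  = ⊥-elim (h n)
  -- As `σ` is necessary in `N'`, its negation is impossible there, so one of the approximation
  -- sentences fails.
  refuted : Σ ℕ λ k → ¬ N' ⊨ approximable (`¬ σ) k
  refuted = dne λ none → let (K , E , K⊨T , K⊨¬σ) = approximable⇒possible N' N'⊨T (`¬ σ) (λ k → dne λ n → none (k , n))
                         in lower (K⊨¬σ (lower (N'□σ K E K⊨T)))
  k : ℕ
  k = proj₁ refuted
  -- This single sentence holds in `N'` and guarantees the necessity of `σ`. Its possibility in `N`
  -- is expressed by sentences true in `N`, and these carry over to `M`.
  ψ : Sentence
  ψ = `¬ (approximable (`¬ σ) k)
  M◇ψ : Possible ψ M
  M◇ψ = approximable⇒possible M M⊨T ψ λ j → proj₂ (M≡N (approximable ψ j))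
          (possible⇒approximable N N⊨T ψ (N' , N≤N' , N'⊨T , λ s → lift (proj₂ refuted s)) j)
  M' : Structure ℓ
  M' = proj₁ M◇ψ
  M≤M' : EndExtension M M'
  M≤M' = proj₁ (proj₂ M◇ψ)
  M'⊨T : M' ⊨T T
  M'⊨T = proj₁ (proj₂ (proj₂ M◇ψ))
  M'□σ : □end T M' (λ K → Lift (lsuc ℓ) (K ⊨ σ))
  -- An end-extension of `M'` in which `σ` failed would make the `k`-th approximation sentence true
  -- in `M'`, against `ψ`.
  M'□σ K E K⊨T = lift (dne λ n → lower (proj₂ (proj₂ (proj₂ M◇ψ))
    (possible⇒approximable M' M'⊨T (`¬ σ) (K , E , K⊨T , λ s → lift (n s)) k)))
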